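{- For every $\eta>0$ there is $b_0$ such that for every integer constant $b\ge b_0$ there is a constant $C$ for which the following holds for every $k\ge 2$. If $k$ stations execute the protocol SublinearDecrease$(b)$ and are activated by any adaptive adversary, then, even in the case where acknowledgements are not allowed (so that stations never switch off after a successful transmission), with probability at least $1-1/k^{\eta}$ every station transmits successfully within $C k\ln^2 k$ rounds after its own activation.
   Context: Model. $k$ anonymous identical stations share a channel. Time is divided into discrete synchronous rounds; there is no global clock available to the stations and no collision detection. Initially all stations are asleep. Each station holds one packet and is activated once, at a time chosen by an adversary. The activation round is round $0$ of the station's local clock, and the station may transmit from its local round $1$ on. In each round every active station either transmits or listens. A transmission is successful if and only if exactly one active station transmits in that round. The stations do not know $k$. Here acknowledgements are not available: a station gets no feedback on its transmissions and continues the protocol after a successful transmission. An adaptive adversary decides online which station to activate and when, knowing the algorithm's code and the history of the computation but not future randomness; in total it activates $k$ stations. Protocol SublinearDecrease$(b)$ (executed by each station from its activation): for $j=3,4,5,\ldots$: for $b$ rounds, transmit in each round with probability $\frac{\ln j}{j}$, independently over rounds and stations. -}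

module Defs where

open import Data.Bool.Base using (Bool; true; false; if_then_else_)
import Data.Bool.Properties as Bool
open import Data.Empty using (⊥)
open import Data.Fin.Base using (Fin; zero; suc)
open import Data.Fin.Properties using (all?)
open import Data.Fin.Subset using (Subset; ⁅_⁆)
open import Data.Integer.Base as ℤ using (+_)
import Data.Integer.Properties as ℤ
open import Data.List.Base using (List; []; _∷_; concatMap; map; foldr)
open import Data.Maybe.Base using (Maybe; just; nothing)
open import Data.Nat.Base as ℕ using (ℕ; zero; suc; NonZero)
import Data.Nat.Coprimality as Coprime
open import Data.Nat.DivMod using (_/_)
import Data.Nat.Properties as ℕ
open import Data.Product.Base using (∃; _×_; _,_; proj₁; proj₂)
open import Data.Rational.Base as ℚ using (ℚ; mkℚ; 0ℚ; 1ℚ; ∣_∣; toℚᵘ)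
import Data.Rational.Properties as ℚ
open import Data.Rational.Solver using (module +-*-Solver)
open import Data.Rational.Unnormalised.Base as ℚᵘ using (mkℚᵘ; *≡*; *≤*)
import Data.Rational.Unnormalised.Properties as ℚᵘ
open import Data.Sum.Base using (_⊎_; inj₁; inj₂)
open import Data.Vec.Base using ([]; _∷_; lookup)
import Data.Vec.Properties as Vec
open import Function.Base using (_∘_)
open import Relation.Binary.PropositionalEquality hiding (J)
open import Relation.Nullary.Decidable using (Dec; yes; no; does; _×-dec_; _⊎-dec_; _→-dec_; map′)
open import Relation.Unary using (Decidable)
open +-*-Solver using (solve; _:+_; _:*_; _:-_; :-_; _:=_; con)

------------------------------------------------------------------------
-- Real numbers, as Cauchy sequences of rationals.

IsCauchy : (ℕ → ℚ) → Set
IsCauchy x = ∀ ε → 0ℚ ℚ.< ε →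
  ∃ λ N → ∀ m n → N ℕ.≤ m → N ℕ.≤ n → ∣ x m ℚ.- x n ∣ ℚ.≤ ε

record ℝ : Set where
  constructor mkℝ
  field
    seq    : ℕ → ℚ
    cauchy : IsCauchy seq

open ℝ public

-- Both fractions are written in lowest terms, as computing with _/_ on open
-- terms unfolds the gcd.
natℚ : ℕ → ℚ
natℚ n = mkℚ (+ n) 0 (Coprime.sym (Coprime.1-coprimeTo n))

1/suc : ℕ → ℚ
1/suc n = mkℚ (+ 1) n (Coprime.1-coprimeTo (suc n))

to-nat : ∀ n → toℚᵘ (natℚ n) ℚᵘ.≃ mkℚᵘ (+ n) 0
to-nat n = ℚᵘ.≃-refl

to-inv : ∀ n → toℚᵘ (1/suc n) ℚᵘ.≃ mkℚᵘ (+ 1) n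
to-inv n = ℚᵘ.≃-refl

1/suc-pos : ∀ n → 0ℚ ℚ.< 1/suc n
1/suc-pos n = ℚ.positive⁻¹ (1/suc n)

natℚ-nonNeg : ∀ n → 0ℚ ℚ.≤ natℚ n
natℚ-nonNeg n = ℚ.nonNegative⁻¹ (natℚ n)

1/suc-antimono : ∀ {m n} → m ℕ.≤ n → 1/suc n ℚ.≤ 1/suc m
1/suc-antimono {m} {n} m≤n = ℚ.toℚᵘ-cancel-≤
  (ℚᵘ.≤-respˡ-≃ (ℚᵘ.≃-sym (to-inv n)) (ℚᵘ.≤-respʳ-≃ (ℚᵘ.≃-sym (to-inv m))
    (*≤* (subst₂ ℤ._≤_ (sym (ℤ.*-identityˡ (+ suc m))) (sym (ℤ.*-identityˡ (+ suc n)))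
      (ℤ.+≤+ (ℕ.s≤s m≤n))))))

natℚ-suc : ∀ n → natℚ (suc n) ≡ 1ℚ ℚ.+ natℚ n
natℚ-suc n = ℚ.toℚᵘ-injective (ℚᵘ.≃-trans (to-nat (suc n)) (ℚᵘ.≃-sym
  (ℚᵘ.≃-trans (ℚ.toℚᵘ-homo-+ 1ℚ (natℚ n))
  (ℚᵘ.≃-trans (ℚᵘ.+-cong (ℚᵘ.≃-refl {toℚᵘ 1ℚ}) (to-nat n))
    (*≡* (cong (ℤ._* (+ 1)) (cong (λ z → + 1 ℤ.+ z) (ℤ.*-identityʳ (+ n)))))))))

natℚ-* : ∀ p n → natℚ (suc p) ℚ.* 1/suc (p ℕ.+ n ℕ.* suc p) ≡ 1/suc n
natℚ-* p n = ℚ.toℚᵘ-injective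
  (ℚᵘ.≃-trans (ℚ.toℚᵘ-homo-* (natℚ (suc p)) (1/suc (p ℕ.+ n ℕ.* suc p)))
  (ℚᵘ.≃-trans (ℚᵘ.*-cong (to-nat (suc p)) (to-inv (p ℕ.+ n ℕ.* suc p)))
  (ℚᵘ.≃-trans (*≡* eq) (ℚᵘ.≃-sym (to-inv n)))))
  where
  eq : (+ suc p ℤ.* + 1) ℤ.* + suc n ≡ + 1 ℤ.* (+ 1 ℤ.* + suc (p ℕ.+ n ℕ.* suc p))
  eq = begin
    (+ suc p ℤ.* + 1) ℤ.* + suc n   ≡⟨ cong (ℤ._* + suc n) (ℤ.*-identityʳ (+ suc p)) ⟩
    + suc p ℤ.* + suc n             ≡⟨ sym (ℤ.pos-* (suc p) (suc n)) ⟩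
    + (suc p ℕ.* suc n)             ≡⟨ cong +_ (ℕ.*-comm (suc p) (suc n)) ⟩
    + suc (p ℕ.+ n ℕ.* suc p)       ≡⟨ sym (ℤ.*-identityˡ _) ⟩
    + 1 ℤ.* + suc (p ℕ.+ n ℕ.* suc p) ≡⟨ sym (ℤ.*-identityˡ _) ⟩
    _ ∎
    where open ≡-Reasoning

natℚ-inverse : ∀ n → natℚ (suc n) ℚ.* 1/suc n ≡ 1ℚ
natℚ-inverse n = trans (cong (λ z → natℚ (suc n) ℚ.* 1/suc z)
  (sym (ℕ.+-identityʳ n))) (natℚ-* n 0)

archimedean : ∀ ε → 0ℚ ℚ.< ε → ∃ λ N → 1/suc N ℚ.≤ ε
archimedean ε@(mkℚ (+ suc a) d _) _ = d , ℚ.toℚᵘ-cancel-≤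
  (ℚᵘ.≤-respˡ-≃ (ℚᵘ.≃-sym (to-inv d))
    (*≤* (ℤ.*-monoʳ-≤-nonNeg (+ suc d) (ℤ.+≤+ (ℕ.s≤s (ℕ.z≤n {a}))))))
archimedean (mkℚ (+ 0) d _) (ℚ.*<* (ℤ.+<+ ()))
archimedean (mkℚ (ℤ.-[1+ _ ]) d _) (ℚ.*<* ())

natBound : ∀ q → ∃ λ K → ∣ q ∣ ℚ.≤ natℚ K
natBound (mkℚ i d _) = ℤ.∣ i ∣ , ℚ.toℚᵘ-cancel-≤
  (ℚᵘ.≤-respʳ-≃ (ℚᵘ.≃-sym (to-nat ℤ.∣ i ∣))
    (*≤* (ℤ.*-monoˡ-≤-nonNeg (+ ℤ.∣ i ∣) (ℤ.+≤+ (ℕ.s≤s (ℕ.z≤n {d}))))))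

*-monoˡ : ∀ {p q} r → 0ℚ ℚ.≤ r → p ℚ.≤ q → r ℚ.* p ℚ.≤ r ℚ.* q
*-monoˡ r 0≤r = ℚ.*-monoˡ-≤-nonNeg r {{ℚ.nonNegative 0≤r}}

*-monoʳ : ∀ {p q} r → 0ℚ ℚ.≤ r → p ℚ.≤ q → p ℚ.* r ℚ.≤ q ℚ.* r
*-monoʳ r 0≤r = ℚ.*-monoʳ-≤-nonNeg r {{ℚ.nonNegative 0≤r}}

*-nonNeg : ∀ {p q} → 0ℚ ℚ.≤ p → 0ℚ ℚ.≤ q → 0ℚ ℚ.≤ p ℚ.* q
*-nonNeg {p} {q} 0≤p 0≤q = subst (ℚ._≤ p ℚ.* q) (ℚ.*-zeroʳ p) (*-monoˡ p 0≤p 0≤q)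

*-mono : ∀ {p q r s} → 0ℚ ℚ.≤ p → 0ℚ ℚ.≤ s → p ℚ.≤ q → r ℚ.≤ s → p ℚ.* r ℚ.≤ q ℚ.* s
*-mono {p} {q} {r} {s} 0≤p 0≤s p≤q r≤s =
  ℚ.≤-trans (*-monoˡ p 0≤p r≤s) (*-monoʳ s 0≤s p≤q)

∣-∣-intro : ∀ {p q d} → p ℚ.≤ q ℚ.+ d → q ℚ.≤ p ℚ.+ d → ∣ p ℚ.- q ∣ ℚ.≤ d
∣-∣-intro {p} {q} {d} p≤ q≤ with ℚ.∣p∣≡p∨∣p∣≡-p (p ℚ.- q)
... | inj₁ eq = subst₂ ℚ._≤_ (sym eq)
  (solve 2 (λ q d → (q :+ d) :- q := d) refl q d) (ℚ.+-monoˡ-≤ (ℚ.- q) p≤)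
... | inj₂ eq = subst₂ ℚ._≤_
  (trans (solve 2 (λ p q → q :- p := :- (p :- q)) refl p q) (sym eq))
  (solve 2 (λ p d → (p :+ d) :- p := d) refl p d) (ℚ.+-monoˡ-≤ (ℚ.- p) q≤)

∣-∣-via : ∀ p q r → ∣ p ℚ.- r ∣ ℚ.≤ ∣ p ℚ.- q ∣ ℚ.+ ∣ q ℚ.- r ∣
∣-∣-via p q r = subst (λ z → ∣ z ∣ ℚ.≤ ∣ p ℚ.- q ∣ ℚ.+ ∣ q ℚ.- r ∣)
  (solve 3 (λ p q r → (p :- q) :+ (q :- r) := p :- r) refl p q r)
  (ℚ.∣p+q∣≤∣p∣+∣q∣ (p ℚ.- q) (q ℚ.- r))

∣-∣-sym : ∀ p q → ∣ p ℚ.- q ∣ ≡ ∣ q ℚ.- p ∣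
∣-∣-sym p q = trans (cong ∣_∣ (solve 2 (λ p q → p :- q := :- (q :- p)) refl p q))
  (ℚ.∣-p∣≡∣p∣ (q ℚ.- p))

∣-∣-bound : ∀ p q → ∣ p ∣ ℚ.≤ ∣ p ℚ.- q ∣ ℚ.+ ∣ q ∣
∣-∣-bound p q = subst (λ z → ∣ z ∣ ℚ.≤ ∣ p ℚ.- q ∣ ℚ.+ ∣ q ∣)
  (solve 2 (λ p q → (p :- q) :+ q := p) refl p q)
  (ℚ.∣p+q∣≤∣p∣+∣q∣ (p ℚ.- q) q)

1ℚ-nonNeg : 0ℚ ℚ.≤ 1ℚ
1ℚ-nonNeg = ℚ.nonNegative⁻¹ 1ℚ

p≤1+p : ∀ p → p ℚ.≤ 1ℚ ℚ.+ p
p≤1+p p = subst (ℚ._≤ 1ℚ ℚ.+ p) (ℚ.+-identityˡ p) (ℚ.+-monoˡ-≤ p 1ℚ-nonNeg)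

rescaleEq : ∀ k e i → k ℚ.* i ≡ 1ℚ → k ℚ.* (e ℚ.* i) ≡ e
rescaleEq k e i ki≡1 = trans
  (solve 3 (λ k e i → k :* (e :* i) := (k :* i) :* e) refl k e i)
  (trans (cong (ℚ._* e) ki≡1) (ℚ.*-identityˡ e))

*-pos : ∀ {p q} → 0ℚ ℚ.< p → 0ℚ ℚ.< q → 0ℚ ℚ.< p ℚ.* q
*-pos {p} {q} 0<p 0<q = ℚ.positive⁻¹ (p ℚ.* q)
  {{ℚ.pos*pos⇒pos p {{ℚ.positive 0<p}} q {{ℚ.positive 0<q}}}}

rescale : ∀ ε K → 0ℚ ℚ.< ε → ∃ λ δ → 0ℚ ℚ.< δ × natℚ K ℚ.* δ ℚ.≤ ε
rescale ε K 0<ε = ε ℚ.* 1/suc K , 0<δ , ℚ.≤-trans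
  (*-monoʳ (ε ℚ.* 1/suc K) (ℚ.<⇒≤ 0<δ)
    (subst (natℚ K ℚ.≤_) (sym (natℚ-suc K)) (p≤1+p (natℚ K))))
  (ℚ.≤-reflexive (rescaleEq (natℚ (suc K)) ε (1/suc K) (natℚ-inverse K)))
  where
  0<δ : 0ℚ ℚ.< ε ℚ.* 1/suc K
  0<δ = *-pos 0<ε (1/suc-pos K)

cauchyUpTo : ∀ {x} K →
  (∀ δ → 0ℚ ℚ.< δ → ∃ λ N → ∀ m n → N ℕ.≤ m → N ℕ.≤ n → ∣ x m ℚ.- x n ∣ ℚ.≤ natℚ K ℚ.* δ) →
  IsCauchy x
cauchyUpTo K h ε 0<ε =
  let δ , 0<δ , Kδ≤ε = rescale ε K 0<ε
      N , near       = h δ 0<δ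
  in N , λ m n N≤m N≤n → ℚ.≤-trans (near m n N≤m N≤n) Kδ≤ε

eventuallyBounded : ∀ {x} → IsCauchy x →
  ∃ λ K → ∃ λ N → ∀ n → N ℕ.≤ n → ∣ x n ∣ ℚ.≤ natℚ K
eventuallyBounded {x} c =
  let N , near = c 1ℚ (ℚ.positive⁻¹ 1ℚ)
      K , xN≤K = natBound (x N)
  in suc K , N , λ n N≤n → subst (∣ x n ∣ ℚ.≤_) (sym (natℚ-suc K))
    (ℚ.≤-trans (∣-∣-bound (x n) (x N))
      (ℚ.+-mono-≤ (near n N N≤n ℕ.≤-refl) xN≤K))

natℚ-+ : ∀ m n → natℚ (m ℕ.+ n) ≡ natℚ m ℚ.+ natℚ n
natℚ-+ zero    n = sym (ℚ.+-identityˡ (natℚ n))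
natℚ-+ (suc m) n = begin
  natℚ (suc (m ℕ.+ n))             ≡⟨ natℚ-suc (m ℕ.+ n) ⟩
  1ℚ ℚ.+ natℚ (m ℕ.+ n)            ≡⟨ cong (1ℚ ℚ.+_) (natℚ-+ m n) ⟩
  1ℚ ℚ.+ (natℚ m ℚ.+ natℚ n)       ≡⟨ sym (ℚ.+-assoc 1ℚ (natℚ m) (natℚ n)) ⟩
  1ℚ ℚ.+ natℚ m ℚ.+ natℚ n         ≡⟨ cong (ℚ._+ natℚ n) (sym (natℚ-suc m)) ⟩
  natℚ (suc m) ℚ.+ natℚ n ∎
  where open ≡-Reasoning

double : ∀ p → p ℚ.+ p ≡ natℚ 2 ℚ.* p
double p = solve 1 (λ d → d :+ d := con (natℚ 2) :* d) refl p

natℚ-mono : ∀ {m n} → m ℕ.≤ n → natℚ m ℚ.≤ natℚ n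
natℚ-mono {m} {n} m≤n = subst₂ ℚ._≤_ (ℚ.+-identityʳ (natℚ m))
  (trans (sym (natℚ-+ m (n ℕ.∸ m))) (cong natℚ (ℕ.m+[n∸m]≡n m≤n)))
  (ℚ.+-monoʳ-≤ (natℚ m) (natℚ-nonNeg (n ℕ.∸ m)))

const-cauchy : ∀ q → IsCauchy (λ _ → q)
const-cauchy q ε 0<ε = 0 , λ _ _ _ _ →
  subst (ℚ._≤ ε) (sym (cong ∣_∣ (ℚ.+-inverseʳ q))) (ℚ.<⇒≤ 0<ε)

+-cauchy : ∀ {x y} → IsCauchy x → IsCauchy y → IsCauchy (λ n → x n ℚ.+ y n)
+-cauchy {x} {y} cx cy = cauchyUpTo {λ n → x n ℚ.+ y n} 2 λ δ 0<δ → let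
    Nx , nearx = cx δ 0<δ
    Ny , neary = cy δ 0<δ
  in Nx ℕ.⊔ Ny , λ m n N≤m N≤n → begin
    ∣ (x m ℚ.+ y m) ℚ.- (x n ℚ.+ y n) ∣
      ≡⟨ cong ∣_∣ (solve 4 (λ a b c d → (a :+ b) :- (c :+ d) := (a :- c) :+ (b :- d)) refl (x m) (y m) (x n) (y n)) ⟩
    ∣ (x m ℚ.- x n) ℚ.+ (y m ℚ.- y n) ∣
      ≤⟨ ℚ.∣p+q∣≤∣p∣+∣q∣ (x m ℚ.- x n) (y m ℚ.- y n) ⟩
    ∣ x m ℚ.- x n ∣ ℚ.+ ∣ y m ℚ.- y n ∣
      ≤⟨ ℚ.+-mono-≤ (nearx m n (ℕ.m⊔n≤o⇒m≤o Nx Ny N≤m) (ℕ.m⊔n≤o⇒m≤o Nx Ny N≤n))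
                    (neary m n (ℕ.m⊔n≤o⇒n≤o Nx Ny N≤m) (ℕ.m⊔n≤o⇒n≤o Nx Ny N≤n)) ⟩
    δ ℚ.+ δ
      ≡⟨ double δ ⟩
    natℚ 2 ℚ.* δ ∎
  where open ℚ.≤-Reasoning

neg-cauchy : ∀ {x} → IsCauchy x → IsCauchy (λ n → ℚ.- x n)
neg-cauchy {x} cx ε 0<ε with cx ε 0<ε
... | N , near = N , λ m n N≤m N≤n → subst (ℚ._≤ ε)
  (trans (∣-∣-sym (x m) (x n))
    (cong ∣_∣ (solve 2 (λ a b → b :- a := (:- a) :- (:- b)) refl (x m) (x n))))
  (near m n N≤m N≤n)

*-cauchy : ∀ {x y} → IsCauchy x → IsCauchy y → IsCauchy (λ n → x n ℚ.* y n)
*-cauchy {x} {y} cx cy = let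
    A , NA , x≤A = eventuallyBounded cx
    B , NB , y≤B = eventuallyBounded cy
  in cauchyUpTo {λ n → x n ℚ.* y n} (A ℕ.+ B) λ δ 0<δ → let
    Nx , nearx = cx δ 0<δ
    Ny , neary = cy δ 0<δ
    N = (NA ℕ.⊔ NB) ℕ.⊔ (Nx ℕ.⊔ Ny)
    toA = λ {k} (p : N ℕ.≤ k) → ℕ.m⊔n≤o⇒m≤o NA NB (ℕ.m⊔n≤o⇒m≤o (NA ℕ.⊔ NB) (Nx ℕ.⊔ Ny) p)
    toB = λ {k} (p : N ℕ.≤ k) → ℕ.m⊔n≤o⇒n≤o NA NB (ℕ.m⊔n≤o⇒m≤o (NA ℕ.⊔ NB) (Nx ℕ.⊔ Ny) p)
    toX = λ {k} (p : N ℕ.≤ k) → ℕ.m⊔n≤o⇒m≤o Nx Ny (ℕ.m⊔n≤o⇒n≤o (NA ℕ.⊔ NB) (Nx ℕ.⊔ Ny) p)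
    toY = λ {k} (p : N ℕ.≤ k) → ℕ.m⊔n≤o⇒n≤o Nx Ny (ℕ.m⊔n≤o⇒n≤o (NA ℕ.⊔ NB) (Nx ℕ.⊔ Ny) p)
  in N , λ m n N≤m N≤n → begin
    ∣ x m ℚ.* y m ℚ.- x n ℚ.* y n ∣
      ≡⟨ cong ∣_∣ (solve 4 (λ a b c d → a :* b :- c :* d := a :* (b :- d) :+ (a :- c) :* d) refl (x m) (y m) (x n) (y n)) ⟩
    ∣ x m ℚ.* (y m ℚ.- y n) ℚ.+ (x m ℚ.- x n) ℚ.* y n ∣
      ≤⟨ ℚ.∣p+q∣≤∣p∣+∣q∣ (x m ℚ.* (y m ℚ.- y n)) ((x m ℚ.- x n) ℚ.* y n) ⟩
    ∣ x m ℚ.* (y m ℚ.- y n) ∣ ℚ.+ ∣ (x m ℚ.- x n) ℚ.* y n ∣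
      ≡⟨ cong₂ ℚ._+_ (ℚ.∣p*q∣≡∣p∣*∣q∣ (x m) (y m ℚ.- y n)) (ℚ.∣p*q∣≡∣p∣*∣q∣ (x m ℚ.- x n) (y n)) ⟩
    ∣ x m ∣ ℚ.* ∣ y m ℚ.- y n ∣ ℚ.+ ∣ x m ℚ.- x n ∣ ℚ.* ∣ y n ∣
      ≤⟨ ℚ.+-mono-≤
           (*-mono (ℚ.0≤∣p∣ (x m)) (ℚ.<⇒≤ 0<δ) (x≤A m (toA N≤m)) (neary m n (toY N≤m) (toY N≤n)))
           (*-mono (ℚ.0≤∣p∣ (x m ℚ.- x n)) (natℚ-nonNeg B) (nearx m n (toX N≤m) (toX N≤n)) (y≤B n (toB N≤n))) ⟩
    natℚ A ℚ.* δ ℚ.+ δ ℚ.* natℚ B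
      ≡⟨ solve 3 (λ a b d → a :* d :+ d :* b := (a :+ b) :* d) refl (natℚ A) (natℚ B) δ ⟩
    (natℚ A ℚ.+ natℚ B) ℚ.* δ
      ≡⟨ cong (ℚ._* δ) (sym (natℚ-+ A B)) ⟩
    natℚ (A ℕ.+ B) ℚ.* δ ∎
  where open ℚ.≤-Reasoning

∑ : ℕ → (ℕ → ℚ) → ℚ
∑ zero    f = 0ℚ
∑ (suc n) f = ∑ n f ℚ.+ f n

-- The Riemann sum (right endpoints) of ∫₁ʲ dt/t for the mesh 1 / suc n; its
-- m-th summand is (1 / suc n) / (1 + (m + 1) / suc n) = 1 / (suc n + m + 1).
lnSeq : ℕ → ℕ → ℚ
lnSeq j n = ∑ ((j ℕ.∸ 1) ℕ.* suc n) (λ m → 1/suc (suc n ℕ.+ m))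

∑-upper : ∀ p f c → (∀ l → f l ℚ.≤ c) → ∑ p f ℚ.≤ natℚ p ℚ.* c
∑-upper zero f c h = ℚ.≤-reflexive (sym (ℚ.*-zeroˡ c))
∑-upper (suc p) f c h = begin
  ∑ p f ℚ.+ f p         ≤⟨ ℚ.+-mono-≤ (∑-upper p f c h) (h p) ⟩
  natℚ p ℚ.* c ℚ.+ c    ≡⟨ solve 2 (λ a c → a :* c :+ c := (con 1ℚ :+ a) :* c) refl (natℚ p) c ⟩
  (1ℚ ℚ.+ natℚ p) ℚ.* c ≡⟨ cong (ℚ._* c) (sym (natℚ-suc p)) ⟩
  natℚ (suc p) ℚ.* c ∎
  where open ℚ.≤-Reasoning

∑-lower : ∀ p f c → (∀ l → l ℕ.< p → c ℚ.≤ f l) → natℚ p ℚ.* c ℚ.≤ ∑ p f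
∑-lower zero f c h = ℚ.≤-reflexive (ℚ.*-zeroˡ c)
∑-lower (suc p) f c h = begin
  natℚ (suc p) ℚ.* c    ≡⟨ cong (ℚ._* c) (natℚ-suc p) ⟩
  (1ℚ ℚ.+ natℚ p) ℚ.* c ≡⟨ solve 2 (λ a c → (con 1ℚ :+ a) :* c := a :* c :+ c) refl (natℚ p) c ⟩
  natℚ p ℚ.* c ℚ.+ c    ≤⟨ ℚ.+-mono-≤ (∑-lower p f c (λ l l<p → h l (ℕ.m<n⇒m<1+n l<p))) (h p ℕ.≤-refl) ⟩
  ∑ p f ℚ.+ f p ∎
  where open ℚ.≤-Reasoning

∑-split : ∀ a b f → ∑ (b ℕ.+ a) f ≡ ∑ a f ℚ.+ ∑ b (λ l → f (l ℕ.+ a))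
∑-split a zero f = sym (ℚ.+-identityʳ (∑ a f))
∑-split a (suc b) f = trans (cong (ℚ._+ f (b ℕ.+ a)) (∑-split a b f))
  (ℚ.+-assoc (∑ a f) (∑ b (λ l → f (l ℕ.+ a))) (f (b ℕ.+ a)))

-- Refining the grid of mesh 1 / suc n by the factor suc p.
module Refine (n p : ℕ) where
  f g : ℕ → ℚ
  f m = 1/suc (suc n ℕ.+ m)
  g m = 1/suc (suc n ℕ.* suc p ℕ.+ m)

  block : ℕ → ℚ
  block c = ∑ (suc p) (λ l → g (l ℕ.+ c ℕ.* suc p))

  block-upper : ∀ c → block c ℚ.≤ 1/suc (n ℕ.+ c)
  block-upper c = ℚ.≤-trans
    (∑-upper (suc p) _ (1/suc (p ℕ.+ (n ℕ.+ c) ℕ.* suc p)) λ l →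
      1/suc-antimono (begin
        p ℕ.+ (n ℕ.+ c) ℕ.* suc p                ≡⟨ cong (p ℕ.+_) (ℕ.*-distribʳ-+ (suc p) n c) ⟩
        p ℕ.+ (n ℕ.* suc p ℕ.+ c ℕ.* suc p)      ≡⟨ sym (ℕ.+-assoc p _ _) ⟩
        p ℕ.+ n ℕ.* suc p ℕ.+ c ℕ.* suc p        ≤⟨ ℕ.+-mono-≤ (ℕ.n≤1+n (p ℕ.+ n ℕ.* suc p)) (ℕ.m≤n+m (c ℕ.* suc p) l) ⟩
        suc n ℕ.* suc p ℕ.+ (l ℕ.+ c ℕ.* suc p)  ∎))
    (ℚ.≤-reflexive (natℚ-* p (n ℕ.+ c)))
    where open ℕ.≤-Reasoning

  block-lower : ∀ c → 1/suc (suc n ℕ.+ c) ℚ.≤ block c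
  block-lower c = ℚ.≤-trans
    (ℚ.≤-reflexive (sym (natℚ-* p (suc n ℕ.+ c))))
    (∑-lower (suc p) _ (1/suc (p ℕ.+ (suc n ℕ.+ c) ℕ.* suc p)) λ l l<sp →
      1/suc-antimono (begin
        suc n ℕ.* suc p ℕ.+ (l ℕ.+ c ℕ.* suc p)     ≤⟨ ℕ.+-monoʳ-≤ (suc n ℕ.* suc p) (ℕ.+-monoˡ-≤ (c ℕ.* suc p) (ℕ.≤-pred l<sp)) ⟩
        suc n ℕ.* suc p ℕ.+ (p ℕ.+ c ℕ.* suc p)     ≡⟨ sym (ℕ.+-assoc (suc n ℕ.* suc p) p _) ⟩
        suc n ℕ.* suc p ℕ.+ p ℕ.+ c ℕ.* suc p       ≡⟨ cong (ℕ._+ c ℕ.* suc p) (ℕ.+-comm (suc n ℕ.* suc p) p) ⟩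
        p ℕ.+ suc n ℕ.* suc p ℕ.+ c ℕ.* suc p       ≡⟨ ℕ.+-assoc p _ _ ⟩
        p ℕ.+ (suc n ℕ.* suc p ℕ.+ c ℕ.* suc p)     ≡⟨ cong (p ℕ.+_) (sym (ℕ.*-distribʳ-+ (suc p) (suc n) c)) ⟩
        p ℕ.+ (suc n ℕ.+ c) ℕ.* suc p               ∎))
    where open ℕ.≤-Reasoning

  lower : ∀ c → ∑ c f ℚ.≤ ∑ (c ℕ.* suc p) g
  lower zero = ℚ.≤-refl
  lower (suc c) = ℚ.≤-trans (ℚ.+-mono-≤ (lower c) (block-lower c))
    (ℚ.≤-reflexive (sym (∑-split (c ℕ.* suc p) (suc p) g)))

  upper : ∀ c → ∑ (c ℕ.* suc p) g ℚ.+ 1/suc (n ℕ.+ c) ℚ.≤ ∑ c f ℚ.+ 1/suc n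
  upper zero = ℚ.≤-reflexive (cong (λ z → 0ℚ ℚ.+ 1/suc z) (ℕ.+-identityʳ n))
  upper (suc c) = begin
    ∑ (suc p ℕ.+ c ℕ.* suc p) g ℚ.+ 1/suc (n ℕ.+ suc c)
      ≡⟨ cong₂ (λ s z → s ℚ.+ 1/suc z) (∑-split (c ℕ.* suc p) (suc p) g) (ℕ.+-suc n c) ⟩
    (∑ (c ℕ.* suc p) g ℚ.+ block c) ℚ.+ f c
      ≤⟨ ℚ.+-monoˡ-≤ (f c) (ℚ.+-monoʳ-≤ (∑ (c ℕ.* suc p) g) (block-upper c)) ⟩
    (∑ (c ℕ.* suc p) g ℚ.+ 1/suc (n ℕ.+ c)) ℚ.+ f c
      ≤⟨ ℚ.+-monoˡ-≤ (f c) (upper c) ⟩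
    (∑ c f ℚ.+ 1/suc n) ℚ.+ f c
      ≡⟨ solve 3 (λ a b c → (a :+ b) :+ c := (a :+ c) :+ b) refl (∑ c f) (1/suc n) (f c) ⟩
    ∑ (suc c) f ℚ.+ 1/suc n ∎
    where open ℚ.≤-Reasoning

refine : ∀ j n p →
  ∣ lnSeq j n ℚ.- lnSeq j (p ℕ.+ n ℕ.* suc p) ∣ ℚ.≤ 1/suc n
refine j n p = subst (λ z → ∣ lnSeq j n ℚ.- z ∣ ℚ.≤ 1/suc n) eq (∣-∣-intro
  (ℚ.≤-trans (lower c) (subst (ℚ._≤ ∑ (c ℕ.* suc p) g ℚ.+ 1/suc n) (ℚ.+-identityʳ _)
    (ℚ.+-monoʳ-≤ (∑ (c ℕ.* suc p) g) (ℚ.<⇒≤ (1/suc-pos n)))))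
  (ℚ.≤-trans (subst (ℚ._≤ ∑ (c ℕ.* suc p) g ℚ.+ 1/suc (n ℕ.+ c)) (ℚ.+-identityʳ _)
    (ℚ.+-monoʳ-≤ (∑ (c ℕ.* suc p) g) (ℚ.<⇒≤ (1/suc-pos (n ℕ.+ c))))) (upper c)))
  where
  open Refine n p
  c = (j ℕ.∸ 1) ℕ.* suc n
  eq : ∑ (c ℕ.* suc p) g ≡ lnSeq j (p ℕ.+ n ℕ.* suc p)
  eq = cong (λ z → ∑ z g) (ℕ.*-assoc (j ℕ.∸ 1) (suc n) (suc p))

ln-cauchy : ∀ j → IsCauchy (lnSeq j)
ln-cauchy j = cauchyUpTo {lnSeq j} 2 λ δ 0<δ → let N , N≤ = archimedean δ 0<δ in
  N , λ m n N≤m N≤n → begin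
    ∣ lnSeq j m ℚ.- lnSeq j n ∣
      ≤⟨ ∣-∣-via (lnSeq j m) (lnSeq j (n ℕ.+ m ℕ.* suc n)) (lnSeq j n) ⟩
    ∣ lnSeq j m ℚ.- lnSeq j (n ℕ.+ m ℕ.* suc n) ∣ ℚ.+ ∣ lnSeq j (n ℕ.+ m ℕ.* suc n) ℚ.- lnSeq j n ∣
      ≡⟨ cong (∣ lnSeq j m ℚ.- lnSeq j (n ℕ.+ m ℕ.* suc n) ∣ ℚ.+_)
          (trans (∣-∣-sym (lnSeq j (n ℕ.+ m ℕ.* suc n)) (lnSeq j n))
            (cong (λ z → ∣ lnSeq j n ℚ.- lnSeq j z ∣) (ℕ.suc-injective (ℕ.*-comm (suc m) (suc n))))) ⟩
    ∣ lnSeq j m ℚ.- lnSeq j (n ℕ.+ m ℕ.* suc n) ∣ ℚ.+ ∣ lnSeq j n ℚ.- lnSeq j (m ℕ.+ n ℕ.* suc m) ∣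
      ≤⟨ ℚ.+-mono-≤ (refine j m n) (refine j n m) ⟩
    1/suc m ℚ.+ 1/suc n
      ≤⟨ ℚ.+-mono-≤ (ℚ.≤-trans (1/suc-antimono N≤m) N≤) (ℚ.≤-trans (1/suc-antimono N≤n) N≤) ⟩
    δ ℚ.+ δ
      ≡⟨ double δ ⟩
    natℚ 2 ℚ.* δ ∎
  where open ℚ.≤-Reasoning

-- qⁱ / i!
expTerm : ℚ → ℕ → ℚ
expTerm q zero    = 1ℚ
expTerm q (suc i) = expTerm q i ℚ.* q ℚ.* 1/suc i

expSum : ℚ → ℕ → ℚ
expSum q n = ∑ (suc n) (expTerm q)

∑-nonNeg : ∀ n f → (∀ i → 0ℚ ℚ.≤ f i) → 0ℚ ℚ.≤ ∑ n f
∑-nonNeg zero    f h = ℚ.≤-refl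
∑-nonNeg (suc n) f h = subst (ℚ._≤ ∑ (suc n) f) (ℚ.+-identityʳ 0ℚ)
  (ℚ.+-mono-≤ (∑-nonNeg n f h) (h n))

∣∑∣≤∑ : ∀ n f g → (∀ i → ∣ f i ∣ ℚ.≤ g i) → ∣ ∑ n f ∣ ℚ.≤ ∑ n g
∣∑∣≤∑ zero    f g h = ℚ.≤-refl
∣∑∣≤∑ (suc n) f g h = ℚ.≤-trans (ℚ.∣p+q∣≤∣p∣+∣q∣ (∑ n f) (f n))
  (ℚ.+-mono-≤ (∣∑∣≤∑ n f g h) (h n))

p≤p+q : ∀ p {q} → 0ℚ ℚ.≤ q → p ℚ.≤ p ℚ.+ q
p≤p+q p {q} 0≤q = subst (ℚ._≤ p ℚ.+ q) (ℚ.+-identityʳ p) (ℚ.+-monoʳ-≤ p 0≤q)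

p+q-p : ∀ p q → p ℚ.+ q ℚ.- p ≡ q
p+q-p = solve 2 (λ p q → p :+ q :- p := q) refl

1/suc-nonNeg : ∀ n → 0ℚ ℚ.≤ 1/suc n
1/suc-nonNeg n = ℚ.<⇒≤ (1/suc-pos n)

∣*1/suc∣ : ∀ p n → ∣ p ℚ.* 1/suc n ∣ ≡ ∣ p ∣ ℚ.* 1/suc n
∣*1/suc∣ p n = trans (ℚ.∣p*q∣≡∣p∣*∣q∣ p (1/suc n))
  (cong (∣ p ∣ ℚ.*_) (ℚ.0≤p⇒∣p∣≡p (1/suc-nonNeg n)))

∣*∣-mono : ∀ {p q r s} → 0ℚ ℚ.≤ s → ∣ p ∣ ℚ.≤ r → ∣ q ∣ ℚ.≤ s → ∣ p ℚ.* q ∣ ℚ.≤ r ℚ.* s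
∣*∣-mono {p} {q} {r} {s} 0≤s p≤r q≤s = subst (ℚ._≤ r ℚ.* s) (sym (ℚ.∣p*q∣≡∣p∣*∣q∣ p q))
  (*-mono (ℚ.0≤∣p∣ p) 0≤s p≤r q≤s)

step-diff : ∀ s t x y → s ℚ.* x ℚ.- t ℚ.* y ≡ (s ℚ.- t) ℚ.* x ℚ.+ t ℚ.* (x ℚ.- y)
step-diff = solve 4 (λ s t x y → s :* x :- t :* y := (s :- t) :* x :+ t :* (x :- y)) refl

factor-diff : ∀ p q r → p ℚ.* r ℚ.- q ℚ.* r ≡ (p ℚ.- q) ℚ.* r
factor-diff = solve 3 (λ p q r → p :* r :- q :* r := (p :- q) :* r) refl

lipschitz-eq : ∀ d t b k r s → k ℚ.* r ≡ 1ℚ → (1ℚ ℚ.+ k) ℚ.* s ≡ 1ℚ →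
  (d ℚ.* t ℚ.* b ℚ.+ t ℚ.* b ℚ.* r ℚ.* d) ℚ.* s ≡ d ℚ.* (t ℚ.* b ℚ.* r)
lipschitz-eq d t b k r s kr≡1 ks≡1 = begin
  (d ℚ.* t ℚ.* b ℚ.+ t ℚ.* b ℚ.* r ℚ.* d) ℚ.* s
    ≡⟨ solve 5 (λ d t b r s → (d :* t :* b :+ t :* b :* r :* d) :* s
                 := (d :* t :* b :* con 1ℚ :+ t :* b :* r :* d) :* s) refl d t b r s ⟩
  (d ℚ.* t ℚ.* b ℚ.* 1ℚ ℚ.+ t ℚ.* b ℚ.* r ℚ.* d) ℚ.* s
    ≡⟨ cong (λ z → (d ℚ.* t ℚ.* b ℚ.* z ℚ.+ t ℚ.* b ℚ.* r ℚ.* d) ℚ.* s) (sym kr≡1) ⟩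
  (d ℚ.* t ℚ.* b ℚ.* (k ℚ.* r) ℚ.+ t ℚ.* b ℚ.* r ℚ.* d) ℚ.* s
    ≡⟨ solve 6 (λ d t b k r s → (d :* t :* b :* (k :* r) :+ t :* b :* r :* d) :* s
                 := ((con 1ℚ :+ k) :* s) :* (d :* (t :* b :* r))) refl d t b k r s ⟩
  ((1ℚ ℚ.+ k) ℚ.* s) ℚ.* (d ℚ.* (t ℚ.* b ℚ.* r))
    ≡⟨ cong (ℚ._* (d ℚ.* (t ℚ.* b ℚ.* r))) ks≡1 ⟩
  1ℚ ℚ.* (d ℚ.* (t ℚ.* b ℚ.* r))
    ≡⟨ ℚ.*-identityˡ _ ⟩
  d ℚ.* (t ℚ.* b ℚ.* r) ∎
  where open ≡-Reasoning

module ExpBounds (B : ℚ) (0≤B : 0ℚ ℚ.≤ B) where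

  T : ℕ → ℚ
  T = expTerm B

  T-nonNeg : ∀ i → 0ℚ ℚ.≤ T i
  T-nonNeg zero    = 1ℚ-nonNeg
  T-nonNeg (suc i) = *-nonNeg (*-nonNeg (T-nonNeg i) 0≤B) (1/suc-nonNeg i)

  term-bound : ∀ {x} → ∣ x ∣ ℚ.≤ B → ∀ i → ∣ expTerm x i ∣ ℚ.≤ T i
  term-bound x≤B zero    = ℚ.≤-refl
  term-bound {x} x≤B (suc i) =
    subst (ℚ._≤ T (suc i)) (sym (∣*1/suc∣ (expTerm x i ℚ.* x) i))
      (*-monoʳ (1/suc i) (1/suc-nonNeg i) (∣*∣-mono 0≤B (term-bound x≤B i) x≤B))

  module _ {x y : ℚ} (x≤B : ∣ x ∣ ℚ.≤ B) (y≤B : ∣ y ∣ ℚ.≤ B) where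

    d : ℚ
    d = ∣ x ℚ.- y ∣

    term-step : ∀ i {c} → ∣ expTerm x i ℚ.- expTerm y i ∣ ℚ.≤ c →
      ∣ expTerm x (suc i) ℚ.- expTerm y (suc i) ∣ ℚ.≤ (c ℚ.* B ℚ.+ T i ℚ.* d) ℚ.* 1/suc i
    term-step i {c} h = subst (ℚ._≤ (c ℚ.* B ℚ.+ T i ℚ.* d) ℚ.* 1/suc i)
      (sym (trans (cong ∣_∣ (factor-diff (expTerm x i ℚ.* x) (expTerm y i ℚ.* y) (1/suc i)))
                  (∣*1/suc∣ (expTerm x i ℚ.* x ℚ.- expTerm y i ℚ.* y) i)))
      (*-monoʳ (1/suc i) (1/suc-nonNeg i)
        (subst (λ z → ∣ z ∣ ℚ.≤ c ℚ.* B ℚ.+ T i ℚ.* d)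
          (sym (step-diff (expTerm x i) (expTerm y i) x y))
          (ℚ.≤-trans
            (ℚ.∣p+q∣≤∣p∣+∣q∣ ((expTerm x i ℚ.- expTerm y i) ℚ.* x) (expTerm y i ℚ.* (x ℚ.- y)))
            (ℚ.+-mono-≤ (∣*∣-mono 0≤B h x≤B)
                        (∣*∣-mono (ℚ.0≤∣p∣ (x ℚ.- y)) (term-bound y≤B i) ℚ.≤-refl)))))

    term-lipschitz : ∀ i → ∣ expTerm x (suc i) ℚ.- expTerm y (suc i) ∣ ℚ.≤ d ℚ.* T i
    term-lipschitz zero = ℚ.≤-trans (term-step 0 {0ℚ} ℚ.≤-refl)
      (ℚ.≤-reflexive (solve 2 (λ b d → (con 0ℚ :* b :+ con 1ℚ :* d) :* con 1ℚ := d :* con 1ℚ) refl B d))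
    term-lipschitz (suc i) = ℚ.≤-trans (term-step (suc i) (term-lipschitz i))
      (ℚ.≤-reflexive (lipschitz-eq d (T i) B (natℚ (suc i)) (1/suc i) (1/suc (suc i))
        (natℚ-inverse i)
        (trans (cong (ℚ._* 1/suc (suc i)) (sym (natℚ-suc (suc i)))) (natℚ-inverse (suc i)))))

    sum-lipschitz : ∀ n → ∣ expSum x n ℚ.- expSum y n ∣ ℚ.≤ d ℚ.* ∑ n T
    sum-lipschitz zero    = ℚ.≤-reflexive (sym (ℚ.*-zeroʳ d))
    sum-lipschitz (suc n) = subst₂ ℚ._≤_
      (cong ∣_∣ (solve 4 (λ a b c d → (a :- b) :+ (c :- d) := (a :+ c) :- (b :+ d)) refl
        (expSum x n) (expSum y n) (expTerm x (suc n)) (expTerm y (suc n))))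
      (sym (ℚ.*-distribˡ-+ d (∑ n T) (T n)))
      (ℚ.≤-trans
        (ℚ.∣p+q∣≤∣p∣+∣q∣ (expSum x n ℚ.- expSum y n) (expTerm x (suc n) ℚ.- expTerm y (suc n)))
        (ℚ.+-mono-≤ (sum-lipschitz n) (term-lipschitz n)))

  module _ (M : ℕ) (2B≤M : B ℚ.+ B ℚ.≤ natℚ M) where

    halving : ∀ i → M ℕ.≤ i → T (suc i) ℚ.+ T (suc i) ℚ.≤ T i
    halving i M≤i = begin
      T (suc i) ℚ.+ T (suc i)
        ≡⟨ solve 3 (λ t b r → t :* b :* r :+ t :* b :* r := t :* ((b :+ b) :* r)) refl (T i) B (1/suc i) ⟩
      T i ℚ.* ((B ℚ.+ B) ℚ.* 1/suc i)
        ≤⟨ *-monoˡ (T i) (T-nonNeg i) (*-monoʳ (1/suc i) (1/suc-nonNeg i)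
             (ℚ.≤-trans 2B≤M (natℚ-mono (ℕ.m≤n⇒m≤1+n M≤i)))) ⟩
      T i ℚ.* (natℚ (suc i) ℚ.* 1/suc i)
        ≡⟨ cong (T i ℚ.*_) (natℚ-inverse i) ⟩
      T i ℚ.* 1ℚ
        ≡⟨ ℚ.*-identityʳ (T i) ⟩
      T i ∎
      where open ℚ.≤-Reasoning

    decreasing : ∀ l → T (l ℕ.+ M) ℚ.≤ T M
    decreasing zero    = ℚ.≤-refl
    decreasing (suc l) = ℚ.≤-trans (p≤p+q (T (suc (l ℕ.+ M))) (T-nonNeg (suc (l ℕ.+ M))))
      (ℚ.≤-trans (halving (l ℕ.+ M) (ℕ.m≤n+m M l)) (decreasing l))

    tail-term : ∀ i → M ℕ.≤ i → T (suc i) ℚ.≤ T M ℚ.* B ℚ.* 1/suc i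
    tail-term i M≤i = *-monoʳ (1/suc i) (1/suc-nonNeg i) (*-monoʳ B 0≤B
      (subst (λ z → T z ℚ.≤ T M) (ℕ.m∸n+n≡m M≤i) (decreasing (i ℕ.∸ M))))

    tail-sum′ : ∀ N → M ℕ.≤ N → ∀ l →
      ∑ l (λ i → T (i ℕ.+ N)) ℚ.+ (T (l ℕ.+ N) ℚ.+ T (l ℕ.+ N)) ℚ.≤ T N ℚ.+ T N
    tail-sum′ N M≤N zero    = ℚ.≤-reflexive (ℚ.+-identityˡ (T N ℚ.+ T N))
    tail-sum′ N M≤N (suc l) = ℚ.≤-trans
      (ℚ.+-monoʳ-≤ (S ℚ.+ T (l ℕ.+ N)) (halving (l ℕ.+ N) (ℕ.≤-trans M≤N (ℕ.m≤n+m N l))))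
      (subst (ℚ._≤ T N ℚ.+ T N) (sym (ℚ.+-assoc S (T (l ℕ.+ N)) (T (l ℕ.+ N)))) (tail-sum′ N M≤N l))
      where S = ∑ l (λ i → T (i ℕ.+ N))

    tail-sum : ∀ N → M ℕ.≤ N → ∀ l → ∑ l (λ i → T (i ℕ.+ N)) ℚ.≤ T N ℚ.+ T N
    tail-sum N M≤N l = ℚ.≤-trans
      (p≤p+q (∑ l (λ i → T (i ℕ.+ N)))
        (subst (ℚ._≤ T (l ℕ.+ N) ℚ.+ T (l ℕ.+ N)) (ℚ.+-identityʳ 0ℚ)
          (ℚ.+-mono-≤ (T-nonNeg (l ℕ.+ N)) (T-nonNeg (l ℕ.+ N)))))
      (tail-sum′ N M≤N l)

    sum-bounded : ∀ n → ∑ n T ℚ.≤ ∑ M T ℚ.+ (T M ℚ.+ T M)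
    sum-bounded n = ℚ.≤-trans
      (p≤p+q (∑ n T) (∑-nonNeg M (λ l → T (l ℕ.+ n)) (λ l → T-nonNeg (l ℕ.+ n))))
      (subst (ℚ._≤ ∑ M T ℚ.+ (T M ℚ.+ T M))
        (trans (sym (∑-split M n T)) (trans (cong (λ z → ∑ z T) (ℕ.+-comm n M)) (∑-split n M T)))
        (ℚ.+-monoʳ-≤ (∑ M T) (tail-sum M ℕ.≤-refl n)))

    tail : ∀ {x} → ∣ x ∣ ℚ.≤ B → ∀ N → M ℕ.≤ N → ∀ n → N ℕ.≤ n →
      ∣ ∑ n (expTerm x) ℚ.- ∑ N (expTerm x) ∣ ℚ.≤ T N ℚ.+ T N
    tail {x} x≤B N M≤N n N≤n = subst (ℚ._≤ T N ℚ.+ T N)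
      (sym (cong ∣_∣ (trans
        (cong (ℚ._- ∑ N (expTerm x))
          (trans (cong (λ z → ∑ z (expTerm x)) (sym (ℕ.m∸n+n≡m N≤n)))
                 (∑-split N (n ℕ.∸ N) (expTerm x))))
        (p+q-p (∑ N (expTerm x)) (∑ (n ℕ.∸ N) (λ l → expTerm x (l ℕ.+ N)))))))
      (ℚ.≤-trans
        (∣∑∣≤∑ (n ℕ.∸ N) (λ l → expTerm x (l ℕ.+ N)) (λ l → T (l ℕ.+ N)) (λ l → term-bound x≤B (l ℕ.+ N)))
        (tail-sum N M≤N (n ℕ.∸ N)))

exp-final : ∀ δ k l → δ ℚ.* k ℚ.+ ((l ℚ.* δ ℚ.+ l ℚ.* δ) ℚ.+ (l ℚ.* δ ℚ.+ l ℚ.* δ))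
  ≡ (k ℚ.+ ((l ℚ.+ l) ℚ.+ (l ℚ.+ l))) ℚ.* δ
exp-final = solve 3 (λ d k l → d :* k :+ ((l :* d :+ l :* d) :+ (l :* d :+ l :* d))
  := (k :+ ((l :+ l) :+ (l :+ l))) :* d) refl

natℚ-+³ : ∀ k l → natℚ (k ℕ.+ ((l ℕ.+ l) ℕ.+ (l ℕ.+ l)))
  ≡ natℚ k ℚ.+ ((natℚ l ℚ.+ natℚ l) ℚ.+ (natℚ l ℚ.+ natℚ l))
natℚ-+³ k l = trans (natℚ-+ k ((l ℕ.+ l) ℕ.+ (l ℕ.+ l)))
  (cong (natℚ k ℚ.+_) (trans (natℚ-+ (l ℕ.+ l) (l ℕ.+ l)) (cong₂ ℚ._+_ (natℚ-+ l l) (natℚ-+ l l))))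

≤∣∣ : ∀ p → p ℚ.≤ ∣ p ∣
≤∣∣ p with ℚ.≤-total 0ℚ p
... | inj₁ 0≤p = ℚ.≤-reflexive (sym (ℚ.0≤p⇒∣p∣≡p 0≤p))
... | inj₂ p≤0 = ℚ.≤-trans p≤0 (ℚ.0≤∣p∣ p)

exp-cauchy : ∀ {x} → IsCauchy x → IsCauchy (λ n → expSum (x n) n)
exp-cauchy {x} cx = cauchyUpTo {λ n → expSum (x n) n} (K ℕ.+ ((L ℕ.+ L) ℕ.+ (L ℕ.+ L)))
  λ δ 0<δ → near δ 0<δ (proj₂ (cx δ 0<δ)) (proj₂ (archimedean δ 0<δ))
  where
  bounded = eventuallyBounded cx
  b  = proj₁ bounded
  NB = proj₁ (proj₂ bounded)
  x≤B = proj₂ (proj₂ bounded)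
  M  = b ℕ.+ b
  2B≤M = ℚ.≤-reflexive (sym (natℚ-+ b b))
  open ExpBounds (natℚ b) (natℚ-nonNeg b)
  K = proj₁ (natBound (∑ M T ℚ.+ (T M ℚ.+ T M)))
  L = proj₁ (natBound (T M ℚ.* natℚ b))

  sum≤K : ∀ n → ∑ n T ℚ.≤ natℚ K
  sum≤K n = ℚ.≤-trans (sum-bounded M 2B≤M n)
    (ℚ.≤-trans (≤∣∣ (∑ M T ℚ.+ (T M ℚ.+ T M))) (proj₂ (natBound (∑ M T ℚ.+ (T M ℚ.+ T M)))))

  near : ∀ δ → 0ℚ ℚ.< δ → ∀ {Nx Na} →
    (∀ m n → Nx ℕ.≤ m → Nx ℕ.≤ n → ∣ x m ℚ.- x n ∣ ℚ.≤ δ) → 1/suc Na ℚ.≤ δ →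
    ∃ λ N → ∀ m n → N ℕ.≤ m → N ℕ.≤ n →
      ∣ expSum (x m) m ℚ.- expSum (x n) n ∣ ℚ.≤ natℚ (K ℕ.+ ((L ℕ.+ L) ℕ.+ (L ℕ.+ L))) ℚ.* δ
  near δ 0<δ {Nx} {Na} x-near small = N , λ m n N≤m N≤n →
    subst (∣ expSum (x m) m ℚ.- expSum (x n) n ∣ ℚ.≤_)
      (trans (exp-final δ (natℚ K) (natℚ L)) (cong (ℚ._* δ) (sym (natℚ-+³ K L))))
      (ℚ.≤-trans (∣-∣-via (expSum (x m) m) (expSum (x n) m) (expSum (x n) n))
        (ℚ.+-mono-≤
          (ℚ.≤-trans (sum-lipschitz (x≤B m (toB N≤m)) (x≤B n (toB N≤n)) m)
            (*-mono (ℚ.0≤∣p∣ (x m ℚ.- x n)) (natℚ-nonNeg K)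
              (x-near m n (toX N≤m) (toX N≤n)) (sum≤K m)))
          (ℚ.≤-trans (∣-∣-via (expSum (x n) m) (∑ J (expTerm (x n))) (expSum (x n) n))
            (ℚ.+-mono-≤
              (tail≤ n N≤n m N≤m)
              (subst (ℚ._≤ natℚ L ℚ.* δ ℚ.+ natℚ L ℚ.* δ)
                (∣-∣-sym (expSum (x n) n) (∑ J (expTerm (x n))))
                (tail≤ n N≤n n N≤n))))))
    where
    I = M ℕ.⊔ Na
    J = suc I
    N = J ℕ.⊔ (NB ℕ.⊔ Nx)
    toJ : ∀ {k} → N ℕ.≤ k → J ℕ.≤ k
    toJ = ℕ.m⊔n≤o⇒m≤o J (NB ℕ.⊔ Nx)
    toB : ∀ {k} → N ℕ.≤ k → NB ℕ.≤ k
    toB p = ℕ.m⊔n≤o⇒m≤o NB Nx (ℕ.m⊔n≤o⇒n≤o J (NB ℕ.⊔ Nx) p)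
    toX : ∀ {k} → N ℕ.≤ k → Nx ℕ.≤ k
    toX p = ℕ.m⊔n≤o⇒n≤o NB Nx (ℕ.m⊔n≤o⇒n≤o J (NB ℕ.⊔ Nx) p)

    TJ≤ : T J ℚ.≤ natℚ L ℚ.* δ
    TJ≤ = ℚ.≤-trans (tail-term M 2B≤M I (ℕ.m≤m⊔n M Na))
      (*-mono (*-nonNeg (T-nonNeg M) (natℚ-nonNeg b)) (ℚ.<⇒≤ 0<δ)
        (ℚ.≤-trans (≤∣∣ (T M ℚ.* natℚ b)) (proj₂ (natBound (T M ℚ.* natℚ b))))
        (ℚ.≤-trans (1/suc-antimono (ℕ.m≤n⊔m M Na)) small))

    tail≤ : ∀ n → N ℕ.≤ n → ∀ m → N ℕ.≤ m →
      ∣ expSum (x n) m ℚ.- ∑ J (expTerm (x n)) ∣ ℚ.≤ natℚ L ℚ.* δ ℚ.+ natℚ L ℚ.* δ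
    tail≤ n N≤n m N≤m = ℚ.≤-trans
      (tail M 2B≤M (x≤B n (toB N≤n)) J (ℕ.m≤n⇒m≤1+n (ℕ.m≤m⊔n M Na)) (suc m) (ℕ.m≤n⇒m≤1+n (toJ N≤m)))
      (ℚ.+-mono-≤ TJ≤ TJ≤)

------------------------------------------------------------------------

fromℚ : ℚ → ℝ
fromℚ q = mkℝ (λ _ → q) (const-cauchy q)

fromℕ : ℕ → ℝ
fromℕ n = fromℚ (natℚ n)

infixr 8 _^_
infix  8 -_
infixl 7 _*_
infixl 6 _+_ _-_
infix  4 _≤_ _<_

_+_ : ℝ → ℝ → ℝ
x + y = mkℝ (λ n → seq x n ℚ.+ seq y n) (+-cauchy {seq x} {seq y} (cauchy x) (cauchy y))

-_ : ℝ → ℝ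
- x = mkℝ (λ n → ℚ.- seq x n) (neg-cauchy {seq x} (cauchy x))

_-_ : ℝ → ℝ → ℝ
x - y = x + (- y)

_*_ : ℝ → ℝ → ℝ
x * y = mkℝ (λ n → seq x n ℚ.* seq y n) (*-cauchy {seq x} {seq y} (cauchy x) (cauchy y))

_≤_ : ℝ → ℝ → Set
x ≤ y = ∀ ε → 0ℚ ℚ.< ε → ∃ λ N → ∀ n → N ℕ.≤ n → seq x n ℚ.≤ seq y n ℚ.+ ε

_<_ : ℝ → ℝ → Set
x < y = ∃ λ ε → 0ℚ ℚ.< ε × ∃ λ N → ∀ n → N ℕ.≤ n → seq x n ℚ.+ ε ℚ.≤ seq y n

exp : ℝ → ℝ
exp x = mkℝ (λ n → expSum (seq x n) n) (exp-cauchy {seq x} (cauchy x))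

-- The natural logarithm of a positive integer; ln 0 is the junk value 0.
ln : ℕ → ℝ
ln j = mkℝ (lnSeq j) (ln-cauchy j)

_^_ : ℕ → ℝ → ℝ
k ^ x = exp (x * ln k)

------------------------------------------------------------------------
-- Finitely supported distributions, as lists of weighted outcomes.

Dist : Set → Set
Dist A = List (ℝ × A)

return : ∀ {A} → A → Dist A
return a = (fromℕ 1 , a) ∷ []

infixl 1 _>>=_

_>>=_ : ∀ {A B} → Dist A → (A → Dist B) → Dist B
d >>= f = concatMap (λ (p , a) → map (λ (q , b) → p * q , b) (f a)) d

Pr : ∀ {A} → Dist A → {P : A → Set} → Decidable P → ℝ
Pr d P? = foldr (λ (p , a) s → (if does (P? a) then p else fromℕ 0) + s) (fromℕ 0) d

bernoulli : ℝ → Dist Bool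
bernoulli p = (p , true) ∷ (fromℕ 1 - p , false) ∷ []

independentCoins : ∀ {n} → (Fin n → ℝ) → Dist (Subset n)
independentCoins {zero}  p = return []
independentCoins {suc n} p =
  bernoulli (p zero) >>= λ c →
  independentCoins (p ∘ suc) >>= λ cs →
  return (c ∷ cs)

------------------------------------------------------------------------
-- The channel.

-- The sets of transmitting stations in the rounds played so far, latest first.
History : ℕ → Set
History k = List (Subset k)

-- In the round that follows a history the adversary wakes the stations of the
-- returned set that are still asleep. It may leave stations asleep forever.
Adversary : ℕ → Set
Adversary k = History k → Subset k

tick : Bool → Maybe ℕ → Maybe ℕ
tick _     (just r) = just (suc r)
tick true  nothing  = just 0
tick false nothing  = nothing

-- The local clock of a station in the round that follows the history (nothing
-- while it is asleep).
clock : ∀ {k} → Adversary k → Fin k → History k → Maybe ℕ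
clock adv i []           = tick (lookup (adv []) i) nothing
clock adv i h@(_ ∷ past) = tick (lookup (adv h) i) (clock adv i past)

-- SublinearDecrease(b): phase j = 3, 4, … covers the local rounds
-- (j - 3) b + 1, …, (j - 2) b and transmits with probability ln j / j.
transmitProb : (b : ℕ) .{{_ : NonZero b}} → Maybe ℕ → ℝ
transmitProb b nothing        = fromℕ 0
transmitProb b (just zero)    = fromℕ 0
transmitProb b (just (suc r)) = ln (3 ℕ.+ r / b) * fromℚ (1/suc (2 ℕ.+ r / b))

-- The first N rounds.
run : ∀ {k} (b : ℕ) .{{_ : NonZero b}} → Adversary k → ℕ → Dist (History k)
run b adv zero    = return []
run b adv (suc N) =
  run b adv N >>= λ h →
  independentCoins (λ i → transmitProb b (clock adv i h)) >>= λ v →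
  return (v ∷ h)

-- Station i was the only transmitter in one of its local rounds 1, …, T.
SucceedsWithin : ∀ {k} → Adversary k → ℕ → Fin k → History k → Set
SucceedsWithin adv T i []         = ⊥
SucceedsWithin adv T i (v ∷ past) =
  (v ≡ ⁅ i ⁆ × ∃ λ r → clock adv i past ≡ just r × 1 ℕ.≤ r × r ℕ.≤ T)
  ⊎ SucceedsWithin adv T i past

-- Every station whose local rounds 1, …, T all lie in the history succeeded in
-- one of them. Along an infinite execution this event decreases with the length
-- of the history, and its intersection over all lengths is the event that every
-- station transmits successfully within T rounds after its activation. Hence the
-- latter has probability at least p if and only if the former does for each length.
AllOnTime : ∀ {k} → Adversary k → ℕ → History k → Set
AllOnTime adv T h = ∀ i → ∀ r → clock adv i h ≡ just r → T ℕ.< r → SucceedsWithin adv T i h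

withinClock? : ∀ T (c : Maybe ℕ) → Dec (∃ λ r → c ≡ just r × 1 ℕ.≤ r × r ℕ.≤ T)
withinClock? T nothing  = no λ { (_ , () , _) }
withinClock? T (just r) = map′ (λ p → r , refl , p) (λ { (_ , refl , p) → p })
  (1 ℕ.≤? r ×-dec r ℕ.≤? T)

succeedsWithin? : ∀ {k} (adv : Adversary k) T i → Decidable (SucceedsWithin adv T i)
succeedsWithin? adv T i []         = no λ ()
succeedsWithin? adv T i (v ∷ past) =
  (Vec.≡-dec Bool._≟_ v ⁅ i ⁆ ×-dec withinClock? T (clock adv i past))
  ⊎-dec succeedsWithin? adv T i past

afterDeadline? : ∀ T (c : Maybe ℕ) {S : Set} → Dec S → Dec (∀ r → c ≡ just r → T ℕ.< r → S)
afterDeadline? T nothing  S? = yes λ _ ()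
afterDeadline? T (just r) S? = map′ (λ { f _ refl → f }) (λ f → f r refl) (T ℕ.<? r →-dec S?)

allOnTime? : ∀ {k} (adv : Adversary k) T → Decidable (AllOnTime adv T)
allOnTime? adv T h = all? λ i → afterDeadline? T (clock adv i h) (succeedsWithin? adv T i h)

{-# OPTIONS --safe #-}
-- Over its whole life a station contributes only O(b log² k) to the contention,
-- apart from phases in which it transmits with probability at most 1 / (4 k). So,
-- whatever the adversary does, the contention exceeds 1/2 in O(b k log² k) rounds
-- only, and at most half of the local rounds W + 1, …, 2 W of a station are spoilt
-- for a suitable W = Θ(b k log² k). In each of the G = W / 2 or more others the
-- station succeeds with conditional probability at least s = Ω(1 / (k log k)). As
-- (1 - s) ^ (G - the number of such rounds so far) on the event of no success yet
-- is a supermartingale, the station fails with probability at most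
-- (1 - s) ^ G = k ^ (- Ω(b)), and a union bound over the k stations finishes the
-- proof.
module Submission where

open import Defs
open import Data.Nat.Base as ℕ using (ℕ; zero; suc; NonZero)
open import Data.Product.Base using (∃; _×_; _,_; proj₁; proj₂)
open import Algebra.Bundles using (CommutativeRing)
open import Data.Bool.Base using (Bool; true; false; if_then_else_)
open import Data.Empty using (⊥-elim)
open import Data.Fin.Base using (Fin; zero; suc)
open import Data.Fin.Properties using (¬∀⟶∃¬)
open import Data.Fin.Subset using (Subset; ⊥; ⁅_⁆)
import Data.Integer.Base as ℤ
open import Data.List.Base using ([]; _∷_; _++_; map; foldr)
open import Data.Maybe.Base using (Maybe; just; nothing)
open import Data.Maybe.Properties using (just-injective)
open import Data.Nat.DivMod using (_/_; m*n/n≡m; m<n⇒m/n≡0; +-distrib-/-∣ʳ; /-monoˡ-≤; m<n*o⇒m/o<n)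
open import Data.Nat.Divisibility using (divides-refl)
import Data.Nat.Properties as ℕ
open import Data.Nat.Solver using () renaming (module +-*-Solver to ℕ-Solver)
open import Data.Rational.Base as ℚ using (ℚ; 0ℚ; 1ℚ; ½; ∣_∣)
import Data.Rational.Properties as ℚ
open import Data.Rational.Solver using (module +-*-Solver)
open import Data.Sum.Base using (_⊎_; inj₁; inj₂)
open import Data.Vec.Base using ([]; _∷_; lookup)
open import Function.Base using (_∘_; const; case_of_)
open import Relation.Binary.PropositionalEquality
open import Relation.Nullary.Decidable using (Dec; yes; no; does; _×-dec_; map′; dec-true; dec-false)
open import Relation.Nullary.Negation using (¬_; contradiction)
open import Relation.Unary using (Decidable)
open +-*-Solver using (solve; _:+_; _:*_; _:-_; :-_; _:=_; con)
open import Algebra.Properties.CommutativeMonoid.Sum ℚ.+-0-commutativeMonoid using (sum; ∑-distrib-+)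
open import Algebra.Properties.CommutativeSemiring.Exp (CommutativeRing.commutativeSemiring ℚ.+-*-commutativeRing)
  using (^-homo-*) renaming (_^_ to _^ℚ_)

-- Adaptivity does no harm because the adversary acts only through the clocks, which are functions
-- of the history: given the history, the coins of the next round are independent with known biases.
-- The count of crowded rounds involves no probability; it holds on every history, since each such
-- round uses up more than 1/4 of a total budget `k * Y`. For each fixed `n` the n-th terms of all
-- reals describe a channel with rational biases, and the Riemann sums `lnSeq j n` obey the needed
-- bounds on ln at every `n` without error terms. So the failure bound `k * (1 - s) ^ G` is proved
-- at every index. Only the comparison with `k ^ (- η)` is asymptotic: it asks for a lower bound on
-- the exponential at a negative argument, whose truncated alternating series can be far from its
-- limit. The two sides meet at `U = 4 ^ (H * L)`, where `H` eventually bounds `η` and `L` bounds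
-- `ln k`: the failure probability is at most 1 / `U`, and `exp` of `- η ln k` is at least 1 / `U`
-- up to any ε.

≤-slack : ∀ {p q} d → 0ℚ ℚ.≤ d → p ℚ.+ d ≡ q → p ℚ.≤ q
≤-slack {p} d 0≤d eq = subst (p ℚ.≤_) eq (p≤p+q p 0≤d)

natℚ-homo-* : ∀ m n → natℚ (m ℕ.* n) ≡ natℚ m ℚ.* natℚ n
natℚ-homo-* zero    n = sym (ℚ.*-zeroˡ (natℚ n))
natℚ-homo-* (suc m) n = begin
  natℚ (n ℕ.+ m ℕ.* n)              ≡⟨ natℚ-+ n (m ℕ.* n) ⟩
  natℚ n ℚ.+ natℚ (m ℕ.* n)         ≡⟨ cong (natℚ n ℚ.+_) (natℚ-homo-* m n) ⟩
  natℚ n ℚ.+ natℚ m ℚ.* natℚ n      ≡⟨ solve 2 (λ a b → b :+ a :* b := (con 1ℚ :+ a) :* b) refl (natℚ m) (natℚ n) ⟩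
  (1ℚ ℚ.+ natℚ m) ℚ.* natℚ n        ≡⟨ cong (ℚ._* natℚ n) (sym (natℚ-suc m)) ⟩
  natℚ (suc m) ℚ.* natℚ n           ∎
  where open ≡-Reasoning

natℚ-cancel-≤ : ∀ {m n} → natℚ m ℚ.≤ natℚ n → m ℕ.≤ n
natℚ-cancel-≤ {m} {n} le with m ℕ.≤? n
... | yes m≤n = m≤n
... | no  m≰n = ⊥-elim (ℚ.<-irrefl {natℚ n} refl (ℚ.<-≤-trans
  (subst₂ ℚ._<_ (ℚ.+-identityˡ (natℚ n)) (sym (natℚ-suc n)) (ℚ.+-monoˡ-< (natℚ n) (ℚ.positive⁻¹ 1ℚ)))
  (ℚ.≤-trans (natℚ-mono (ℕ.≰⇒> m≰n)) le)))

natℚ*1/suc : ∀ d m → d ℕ.≤ suc m → natℚ d ℚ.* 1/suc m ℚ.≤ 1ℚ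
natℚ*1/suc d m d≤ = ℚ.≤-trans (*-monoʳ (1/suc m) (1/suc-nonNeg m) (natℚ-mono d≤))
  (ℚ.≤-reflexive (natℚ-inverse m))

*1/suc≤ : ∀ {p q} m → p ℚ.≤ natℚ (suc m) ℚ.* q → p ℚ.* 1/suc m ℚ.≤ q
*1/suc≤ {p} {q} m le = ℚ.≤-trans (*-monoʳ (1/suc m) (1/suc-nonNeg m) le)
  (ℚ.≤-reflexive (trans
    (solve 3 (λ a q r → a :* q :* r := (a :* r) :* q) refl (natℚ (suc m)) q (1/suc m))
    (trans (cong (ℚ._* q) (natℚ-inverse m)) (ℚ.*-identityˡ q))))

≤*1/suc : ∀ {p q} m → natℚ (suc m) ℚ.* p ℚ.≤ q → p ℚ.≤ q ℚ.* 1/suc m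
≤*1/suc {p} {q} m le = subst (ℚ._≤ q ℚ.* 1/suc m)
  (trans
    (solve 3 (λ a q r → a :* q :* r := (a :* r) :* q) refl (natℚ (suc m)) p (1/suc m))
    (trans (cong (ℚ._* p) (natℚ-inverse m)) (ℚ.*-identityˡ p)))
  (*-monoʳ (1/suc m) (1/suc-nonNeg m) le)

∑-mono : ∀ n f g → (∀ i → i ℕ.< n → f i ℚ.≤ g i) → ∑ n f ℚ.≤ ∑ n g
∑-mono zero    f g h = ℚ.≤-refl
∑-mono (suc n) f g h = ℚ.+-mono-≤ (∑-mono n f g (λ i i<n → h i (ℕ.m<n⇒m<1+n i<n))) (h n ℕ.≤-refl)

∑-mono-length : ∀ {m n} f → (∀ i → 0ℚ ℚ.≤ f i) → m ℕ.≤ n → ∑ m f ℚ.≤ ∑ n f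
∑-mono-length {m} {n} f 0≤f m≤n = ≤-slack (∑ (n ℕ.∸ m) (λ l → f (l ℕ.+ m)))
  (∑-nonNeg (n ℕ.∸ m) _ (λ l → 0≤f (l ℕ.+ m)))
  (trans (sym (∑-split m (n ℕ.∸ m) f)) (cong (λ z → ∑ z f) (ℕ.m∸n+n≡m m≤n)))

∑-*ʳ : ∀ n f c → ∑ n (λ i → f i ℚ.* c) ≡ ∑ n f ℚ.* c
∑-*ʳ zero    f c = sym (ℚ.*-zeroˡ c)
∑-*ʳ (suc n) f c = trans (cong (ℚ._+ f n ℚ.* c) (∑-*ʳ n f c)) (sym (ℚ.*-distribʳ-+ c (∑ n f) (f n)))

∑-suc : ∀ n f → ∑ (suc n) f ≡ f 0 ℚ.+ ∑ n (f ∘ suc)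
∑-suc zero    f = ℚ.+-comm 0ℚ (f 0)
∑-suc (suc n) f = trans (cong (ℚ._+ f (suc n)) (∑-suc n f)) (ℚ.+-assoc (f 0) (∑ n (f ∘ suc)) (f (suc n)))

-- Riemann sums of the logarithm

module _ (m d n : ℕ) where
  private
    S = suc n
    f : ℕ → ℚ
    f l = 1/suc (suc n ℕ.+ l)

    split : lnSeq (suc m ℕ.+ d) n ≡ lnSeq (suc m) n ℚ.+ ∑ (d ℕ.* S) (λ l → f (l ℕ.+ m ℕ.* S))
    split = trans (cong (λ z → ∑ z f) (trans (ℕ.*-distribʳ-+ S m d) (ℕ.+-comm (m ℕ.* S) (d ℕ.* S))))
      (∑-split (m ℕ.* S) (d ℕ.* S) f)

    blocks : ∀ e → natℚ (d ℕ.* S) ℚ.* 1/suc (n ℕ.+ e ℕ.* S) ≡ natℚ d ℚ.* 1/suc e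
    blocks e = trans (cong (ℚ._* 1/suc (n ℕ.+ e ℕ.* S)) (natℚ-homo-* d S))
      (trans (ℚ.*-assoc (natℚ d) (natℚ S) (1/suc (n ℕ.+ e ℕ.* S))) (cong (natℚ d ℚ.*_) (natℚ-* n e)))

  -- The integral of 1/t over [m + 1, m + 1 + d] is at most its length times the value at the left
  -- end; every summand of the Riemann sum obeys the same bound, whatever the mesh.
  lnSeq-upper : lnSeq (suc m ℕ.+ d) n ℚ.≤ lnSeq (suc m) n ℚ.+ natℚ d ℚ.* 1/suc m
  lnSeq-upper = subst (ℚ._≤ lnSeq (suc m) n ℚ.+ natℚ d ℚ.* 1/suc m) (sym split)
    (ℚ.+-monoʳ-≤ (lnSeq (suc m) n) (ℚ.≤-trans
      (∑-upper (d ℕ.* S) _ (1/suc (n ℕ.+ m ℕ.* S)) (λ l → 1/suc-antimono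
        (ℕ.m≤n⇒m≤1+n (ℕ.+-monoʳ-≤ n (ℕ.m≤n+m (m ℕ.* S) l)))))
      (ℚ.≤-reflexive (blocks m))))

  -- The sums use right endpoints and the last one is exactly m + 1 + d, so the minimum of 1/t
  -- bounds every summand with no loss.
  lnSeq-lower : lnSeq (suc m) n ℚ.+ natℚ d ℚ.* 1/suc (m ℕ.+ d) ℚ.≤ lnSeq (suc m ℕ.+ d) n
  lnSeq-lower = subst (lnSeq (suc m) n ℚ.+ natℚ d ℚ.* 1/suc (m ℕ.+ d) ℚ.≤_) (sym split)
    (ℚ.+-monoʳ-≤ (lnSeq (suc m) n) (ℚ.≤-trans
      (ℚ.≤-reflexive (sym (blocks (m ℕ.+ d))))
      (∑-lower (d ℕ.* S) _ (1/suc (n ℕ.+ (m ℕ.+ d) ℕ.* S)) (λ l l<dS → 1/suc-antimono (bound l l<dS)))))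
    where
    bound : ∀ l → l ℕ.< d ℕ.* S → suc n ℕ.+ (l ℕ.+ m ℕ.* S) ℕ.≤ n ℕ.+ (m ℕ.+ d) ℕ.* S
    bound l l<dS = begin
      suc n ℕ.+ (l ℕ.+ m ℕ.* S)     ≡⟨ ℕ.+-suc n (l ℕ.+ m ℕ.* S) ⟨
      n ℕ.+ (suc l ℕ.+ m ℕ.* S)     ≤⟨ ℕ.+-monoʳ-≤ n (ℕ.+-monoˡ-≤ (m ℕ.* S) l<dS) ⟩
      n ℕ.+ (d ℕ.* S ℕ.+ m ℕ.* S)   ≡⟨ cong (n ℕ.+_) (sym (ℕ.*-distribʳ-+ S d m)) ⟩
      n ℕ.+ (d ℕ.+ m) ℕ.* S         ≡⟨ cong (λ z → n ℕ.+ z ℕ.* S) (ℕ.+-comm d m) ⟩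
      n ℕ.+ (m ℕ.+ d) ℕ.* S         ∎
      where open ℕ.≤-Reasoning

lnSeq-nonNeg : ∀ j n → 0ℚ ℚ.≤ lnSeq j n
lnSeq-nonNeg j n = ∑-nonNeg ((j ℕ.∸ 1) ℕ.* suc n) _ (λ l → 1/suc-nonNeg (suc n ℕ.+ l))

lnSeq-mono : ∀ {i j} n → i ℕ.≤ j → lnSeq i n ℚ.≤ lnSeq j n
lnSeq-mono n i≤j = ∑-mono-length _ (λ l → 1/suc-nonNeg (suc n ℕ.+ l))
  (ℕ.*-monoˡ-≤ (suc n) (ℕ.∸-monoˡ-≤ 1 i≤j))

lnSeq≤pred : ∀ m n → lnSeq (suc m) n ℚ.≤ natℚ m
lnSeq≤pred m n = ℚ.≤-trans (lnSeq-upper 0 m n) (ℚ.≤-reflexive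
  (trans (ℚ.+-identityˡ (natℚ m ℚ.* 1/suc 0)) (ℚ.*-identityʳ (natℚ m))))

private
  2^suc : ∀ a → 2 ℕ.^ suc a ≡ 2 ℕ.^ a ℕ.+ 2 ℕ.^ a
  2^suc a = cong (2 ℕ.^ a ℕ.+_) (ℕ.+-identityʳ (2 ℕ.^ a))

  -- Doubling the argument adds between 1/2 and 1 at every mesh. Hence binary lengths control ln
  -- from both sides and can replace it by natural numbers.
  double-upper : ∀ j n → 0 ℕ.< j → lnSeq (j ℕ.+ j) n ℚ.≤ lnSeq j n ℚ.+ 1ℚ
  double-upper (suc m) n _ = ℚ.≤-trans (lnSeq-upper m (suc m) n)
    (ℚ.≤-reflexive (cong (lnSeq (suc m) n ℚ.+_) (natℚ-inverse m)))

  double-lower : ∀ j n → 0 ℕ.< j → lnSeq j n ℚ.+ ½ ℚ.≤ lnSeq (j ℕ.+ j) n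
  double-lower (suc m) n _ = ℚ.≤-trans (ℚ.+-monoʳ-≤ (lnSeq (suc m) n) (ℚ.≤-reflexive half))
    (lnSeq-lower m (suc m) n)
    where
    half : ½ ≡ natℚ (suc m) ℚ.* 1/suc (m ℕ.+ suc m)
    half = sym (trans (cong (λ z → natℚ (suc m) ℚ.* 1/suc z) index)
      (natℚ-* m 1))
      where
      index : m ℕ.+ suc m ≡ m ℕ.+ 1 ℕ.* suc m
      index = cong (m ℕ.+_) (sym (ℕ.+-identityʳ (suc m)))

lnSeq-2^-upper : ∀ a n → lnSeq (2 ℕ.^ a) n ℚ.≤ natℚ a
lnSeq-2^-upper zero    n = ℚ.≤-refl
lnSeq-2^-upper (suc a) n = begin
  lnSeq (2 ℕ.^ suc a) n            ≡⟨ cong (λ z → lnSeq z n) (2^suc a) ⟩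
  lnSeq (2 ℕ.^ a ℕ.+ 2 ℕ.^ a) n    ≤⟨ double-upper (2 ℕ.^ a) n (ℕ.m^n>0 2 a) ⟩
  lnSeq (2 ℕ.^ a) n ℚ.+ 1ℚ         ≤⟨ ℚ.+-monoˡ-≤ 1ℚ (lnSeq-2^-upper a n) ⟩
  natℚ a ℚ.+ 1ℚ                    ≡⟨ trans (ℚ.+-comm (natℚ a) 1ℚ) (sym (natℚ-suc a)) ⟩
  natℚ (suc a)                     ∎
  where open ℚ.≤-Reasoning

lnSeq-2^-lower : ∀ a n → natℚ a ℚ.* ½ ℚ.≤ lnSeq (2 ℕ.^ a) n
lnSeq-2^-lower zero    n = ℚ.≤-refl
lnSeq-2^-lower (suc a) n = begin
  natℚ (suc a) ℚ.* ½               ≡⟨ cong (ℚ._* ½) (natℚ-suc a) ⟩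
  (1ℚ ℚ.+ natℚ a) ℚ.* ½            ≡⟨ solve 1 (λ a → (con 1ℚ :+ a) :* con ½ := a :* con ½ :+ con ½) refl (natℚ a) ⟩
  natℚ a ℚ.* ½ ℚ.+ ½               ≤⟨ ℚ.+-monoˡ-≤ ½ (lnSeq-2^-lower a n) ⟩
  lnSeq (2 ℕ.^ a) n ℚ.+ ½          ≤⟨ double-lower (2 ℕ.^ a) n (ℕ.m^n>0 2 a) ⟩
  lnSeq (2 ℕ.^ a ℕ.+ 2 ℕ.^ a) n    ≡⟨ cong (λ z → lnSeq z n) (sym (2^suc a)) ⟩
  lnSeq (2 ℕ.^ suc a) n            ∎
  where open ℚ.≤-Reasoning

binaryLog : ∀ k → 1 ℕ.≤ k → ∃ λ l → 2 ℕ.^ l ℕ.≤ k × k ℕ.< 2 ℕ.^ suc l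
binaryLog (suc zero)      _ = 0 , ℕ.≤-refl , ℕ.≤-refl
binaryLog (suc k@(suc _)) _ with binaryLog k (ℕ.s≤s ℕ.z≤n)
... | l , lo , hi with suc k ℕ.<? 2 ℕ.^ suc l
...   | yes k+1<  = l , ℕ.m≤n⇒m≤1+n lo , k+1<
...   | no  k+1≮  = suc l , ℕ.≮⇒≥ k+1≮ , ℕ.≤-<-trans hi (ℕ.^-monoʳ-< 2 (ℕ.s≤s (ℕ.s≤s ℕ.z≤n)) {suc l} {suc (suc l)} ℕ.≤-refl)

-- Partial sums of the exponential series

-- The coefficient of X^s in the product of the power series with coefficients `f` and `g`.
conv : (ℕ → ℚ) → (ℕ → ℚ) → ℕ → ℚ
conv f g zero    = f 0 ℚ.* g 0
conv f g (suc s) = f 0 ℚ.* g (suc s) ℚ.+ conv (f ∘ suc) g s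

conv-cong : ∀ {f f′ g g′} → f ≗ f′ → g ≗ g′ → conv f g ≗ conv f′ g′
conv-cong f≗ g≗ zero    = cong₂ ℚ._*_ (f≗ 0) (g≗ 0)
conv-cong f≗ g≗ (suc s) = cong₂ ℚ._+_ (cong₂ ℚ._*_ (f≗ 0) (g≗ (suc s))) (conv-cong (f≗ ∘ suc) g≗ s)

conv-suc : ∀ f g s → conv f g (suc s) ≡ conv f (g ∘ suc) s ℚ.+ f (suc s) ℚ.* g 0
conv-suc f g zero    = refl
conv-suc f g (suc s) = trans
  (cong (f 0 ℚ.* g (suc (suc s)) ℚ.+_) (conv-suc (f ∘ suc) g s))
  (sym (ℚ.+-assoc (f 0 ℚ.* g (suc (suc s))) (conv (f ∘ suc) (g ∘ suc) s) (f (suc (suc s)) ℚ.* g 0)))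

conv-+ʳ : ∀ f g h s → conv f (λ i → g i ℚ.+ h i) s ≡ conv f g s ℚ.+ conv f h s
conv-+ʳ f g h zero    = ℚ.*-distribˡ-+ (f 0) (g 0) (h 0)
conv-+ʳ f g h (suc s) = trans
  (cong (f 0 ℚ.* (g (suc s) ℚ.+ h (suc s)) ℚ.+_) (conv-+ʳ (f ∘ suc) g h s))
  (solve 5 (λ a b c x y → a :* (b :+ c) :+ (x :+ y) := (a :* b :+ x) :+ (a :* c :+ y)) refl
    (f 0) (g (suc s)) (h (suc s)) (conv (f ∘ suc) g s) (conv (f ∘ suc) h s))

conv-+ˡ : ∀ f g h s → conv (λ i → f i ℚ.+ g i) h s ≡ conv f h s ℚ.+ conv g h s
conv-+ˡ f g h zero    = ℚ.*-distribʳ-+ (h 0) (f 0) (g 0)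
conv-+ˡ f g h (suc s) = trans
  (cong ((f 0 ℚ.+ g 0) ℚ.* h (suc s) ℚ.+_) (conv-+ˡ (f ∘ suc) (g ∘ suc) h s))
  (solve 5 (λ a b c x y → (a :+ b) :* c :+ (x :+ y) := (a :* c :+ x) :+ (b :* c :+ y)) refl
    (f 0) (g 0) (h (suc s)) (conv (f ∘ suc) h s) (conv (g ∘ suc) h s))

conv-*ˡ : ∀ c f g s → conv (λ i → c ℚ.* f i) g s ≡ c ℚ.* conv f g s
conv-*ˡ c f g zero    = ℚ.*-assoc c (f 0) (g 0)
conv-*ˡ c f g (suc s) = trans
  (cong (c ℚ.* f 0 ℚ.* g (suc s) ℚ.+_) (conv-*ˡ c (f ∘ suc) g s))
  (solve 4 (λ c a b x → c :* a :* b :+ c :* x := c :* (a :* b :+ x)) refl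
    c (f 0) (g (suc s)) (conv (f ∘ suc) g s))

conv-*ʳ : ∀ c f g s → conv f (λ i → c ℚ.* g i) s ≡ c ℚ.* conv f g s
conv-*ʳ c f g zero    = solve 3 (λ c a b → a :* (c :* b) := c :* (a :* b)) refl c (f 0) (g 0)
conv-*ʳ c f g (suc s) = trans
  (cong (f 0 ℚ.* (c ℚ.* g (suc s)) ℚ.+_) (conv-*ʳ c (f ∘ suc) g s))
  (solve 4 (λ c a b x → a :* (c :* b) :+ c :* x := c :* (a :* b :+ x)) refl
    c (f 0) (g (suc s)) (conv (f ∘ suc) g s))

-- The coefficients of X F′(X) for F = ∑ f i Xⁱ.
euler : (ℕ → ℚ) → ℕ → ℚ
euler f i = natℚ i ℚ.* f i

-- X d/dX is a derivation: in each product of `f i` with `g (s - i)` the factor s splits as i + (s -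
-- i).
conv-leibniz : ∀ f g s → natℚ s ℚ.* conv f g s ≡ conv (euler f) g s ℚ.+ conv f (euler g) s
conv-leibniz f g zero = solve 2 (λ a b → con 0ℚ :* (a :* b) := con 0ℚ :* a :* b :+ a :* (con 0ℚ :* b)) refl (f 0) (g 0)
conv-leibniz f g (suc s) = begin
  natℚ (suc s) ℚ.* (f 0 ℚ.* g (suc s) ℚ.+ c)
    ≡⟨ ℚ.*-distribˡ-+ (natℚ (suc s)) (f 0 ℚ.* g (suc s)) c ⟩
  natℚ (suc s) ℚ.* (f 0 ℚ.* g (suc s)) ℚ.+ natℚ (suc s) ℚ.* c
    ≡⟨ cong (natℚ (suc s) ℚ.* (f 0 ℚ.* g (suc s)) ℚ.+_) (trans (cong (ℚ._* c) (natℚ-suc s))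
         (trans (solve 2 (λ n c → (con 1ℚ :+ n) :* c := n :* c :+ c) refl (natℚ s) c)
           (cong (ℚ._+ c) (conv-leibniz (f ∘ suc) g s)))) ⟩
  natℚ (suc s) ℚ.* (f 0 ℚ.* g (suc s)) ℚ.+ (conv (euler (f ∘ suc)) g s ℚ.+ conv (f ∘ suc) (euler g) s ℚ.+ c)
    ≡⟨ solve 6 (λ n a b x y c → n :* (a :* b) :+ (x :+ y :+ c)
         := (con 0ℚ :* a :* b :+ (x :+ c)) :+ (a :* (n :* b) :+ y)) refl
         (natℚ (suc s)) (f 0) (g (suc s)) (conv (euler (f ∘ suc)) g s) (conv (f ∘ suc) (euler g) s) c ⟩
  (0ℚ ℚ.* f 0 ℚ.* g (suc s) ℚ.+ (conv (euler (f ∘ suc)) g s ℚ.+ c))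
    ℚ.+ (f 0 ℚ.* (natℚ (suc s) ℚ.* g (suc s)) ℚ.+ conv (f ∘ suc) (euler g) s)
    ≡⟨ cong (λ z → (0ℚ ℚ.* f 0 ℚ.* g (suc s) ℚ.+ z) ℚ.+ conv f (euler g) (suc s))
         (trans (sym (conv-+ˡ (euler (f ∘ suc)) (f ∘ suc) g s))
           (conv-cong shift (λ _ → refl) s)) ⟩
  conv (euler f) g (suc s) ℚ.+ conv f (euler g) (suc s) ∎
  where
  open ≡-Reasoning
  c = conv (f ∘ suc) g s
  shift : ∀ i → natℚ i ℚ.* f (suc i) ℚ.+ f (suc i) ≡ natℚ (suc i) ℚ.* f (suc i)
  shift i = trans (solve 2 (λ n a → n :* a :+ a := (con 1ℚ :+ n) :* a) refl (natℚ i) (f (suc i)))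
    (cong (ℚ._* f (suc i)) (sym (natℚ-suc i)))

euler-expTerm : ∀ q i → euler (expTerm q) (suc i) ≡ q ℚ.* expTerm q i
euler-expTerm q i = trans
  (solve 4 (λ n t q r → n :* (t :* q :* r) := (n :* r) :* (q :* t)) refl
    (natℚ (suc i)) (expTerm q i) q (1/suc i))
  (trans (cong (ℚ._* (q ℚ.* expTerm q i)) (natℚ-inverse i)) (ℚ.*-identityˡ (q ℚ.* expTerm q i)))

-- Both sides solve X F′ = (a + b) X F with F(0) = 1. Comparing coefficients through the Leibniz
-- rule avoids binomial coefficients.
conv-expTerm : ∀ a b s → conv (expTerm a) (expTerm b) s ≡ expTerm (a ℚ.+ b) s
conv-expTerm a b zero    = refl
conv-expTerm a b (suc s) = begin
  c (suc s)
    ≡⟨ sym (trans (solve 3 (λ n c r → n :* c :* r := (n :* r) :* c) refl (natℚ (suc s)) (c (suc s)) (1/suc s))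
         (trans (cong (ℚ._* c (suc s)) (natℚ-inverse s)) (ℚ.*-identityˡ (c (suc s))))) ⟩
  natℚ (suc s) ℚ.* c (suc s) ℚ.* 1/suc s
    ≡⟨ cong (ℚ._* 1/suc s) (conv-leibniz t u (suc s)) ⟩
  (conv (euler t) u (suc s) ℚ.+ conv t (euler u) (suc s)) ℚ.* 1/suc s
    ≡⟨ cong (λ z → (conv (euler t) u (suc s) ℚ.+ z) ℚ.* 1/suc s) (conv-suc t (euler u) s) ⟩
  (0ℚ ℚ.* t 0 ℚ.* u (suc s) ℚ.+ conv (euler t ∘ suc) u s
    ℚ.+ (conv t (euler u ∘ suc) s ℚ.+ t (suc s) ℚ.* (0ℚ ℚ.* u 0))) ℚ.* 1/suc s
    ≡⟨ cong₂ (λ y z → (0ℚ ℚ.* t 0 ℚ.* u (suc s) ℚ.+ y ℚ.+ (z ℚ.+ t (suc s) ℚ.* (0ℚ ℚ.* u 0))) ℚ.* 1/suc s)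
         (trans (conv-cong (euler-expTerm a) (λ _ → refl) s) (conv-*ˡ a t u s))
         (trans (conv-cong (λ _ → refl) (euler-expTerm b) s) (conv-*ʳ b t u s)) ⟩
  (0ℚ ℚ.* t 0 ℚ.* u (suc s) ℚ.+ a ℚ.* c s ℚ.+ (b ℚ.* c s ℚ.+ t (suc s) ℚ.* (0ℚ ℚ.* u 0))) ℚ.* 1/suc s
    ≡⟨ solve 8 (λ x y z w a b c r → (con 0ℚ :* x :* y :+ a :* c :+ (b :* c :+ z :* (con 0ℚ :* w))) :* r
         := c :* (a :+ b) :* r) refl (t 0) (u (suc s)) (t (suc s)) (u 0) a b (c s) (1/suc s) ⟩
  c s ℚ.* (a ℚ.+ b) ℚ.* 1/suc s
    ≡⟨ cong (λ z → z ℚ.* (a ℚ.+ b) ℚ.* 1/suc s) (conv-expTerm a b s) ⟩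
  expTerm (a ℚ.+ b) (suc s) ∎
  where
  open ≡-Reasoning
  t = expTerm a
  u = expTerm b
  c = conv t u

-- Partial sums are the coefficients of the series divided by 1 - X, so multiplying by another
-- exponential series gives an exact identity between truncations, with no remainder.
conv-expSum : ∀ a b n → conv (expTerm a) (expSum b) n ≡ expSum (a ℚ.+ b) n
conv-expSum a b zero    = refl
conv-expSum a b (suc n) = begin
  conv t e (suc n)
    ≡⟨ conv-suc t e n ⟩
  conv t (λ i → e i ℚ.+ u (suc i)) n ℚ.+ t (suc n) ℚ.* 1ℚ
    ≡⟨ cong (ℚ._+ t (suc n) ℚ.* 1ℚ) (conv-+ʳ t e (u ∘ suc) n) ⟩
  conv t e n ℚ.+ conv t (u ∘ suc) n ℚ.+ t (suc n) ℚ.* 1ℚ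
    ≡⟨ ℚ.+-assoc (conv t e n) (conv t (u ∘ suc) n) (t (suc n) ℚ.* 1ℚ) ⟩
  conv t e n ℚ.+ (conv t (u ∘ suc) n ℚ.+ t (suc n) ℚ.* 1ℚ)
    ≡⟨ cong₂ ℚ._+_ (conv-expSum a b n) (trans (sym (conv-suc t u n)) (conv-expTerm a b (suc n))) ⟩
  expSum (a ℚ.+ b) (suc n) ∎
  where
  open ≡-Reasoning
  t = expTerm a
  u = expTerm b
  e = expSum b

expSum-0 : ∀ n → expSum 0ℚ n ≡ 1ℚ
expSum-0 zero    = refl
expSum-0 (suc n) = trans (cong₂ ℚ._+_ (expSum-0 n)
  (solve 2 (λ t r → t :* con 0ℚ :* r := con 0ℚ) refl (expTerm 0ℚ n) (1/suc n))) refl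

conv-upper : ∀ f g β s → (∀ i → 0ℚ ℚ.≤ f i) → (∀ i → g i ℚ.≤ β) →
  conv f g s ℚ.≤ ∑ (suc s) f ℚ.* β
conv-upper f g β zero    0≤f g≤β = ℚ.≤-trans (*-monoˡ (f 0) (0≤f 0) (g≤β 0))
  (ℚ.≤-reflexive (cong (ℚ._* β) (sym (ℚ.+-identityˡ (f 0)))))
conv-upper f g β (suc s) 0≤f g≤β = ℚ.≤-trans
  (ℚ.+-mono-≤ (*-monoˡ (f 0) (0≤f 0) (g≤β (suc s))) (conv-upper (f ∘ suc) g β s (0≤f ∘ suc) g≤β))
  (ℚ.≤-reflexive (trans (sym (ℚ.*-distribʳ-+ β (f 0) (∑ (suc s) (f ∘ suc))))
    (cong (ℚ._* β) (sym (∑-suc (suc s) f)))))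

-- The first `s` weights of `f` meet values of `g` at indices beyond `M`, where α applies; the last
-- `M + 1` weights meet the early values, where only the crude bound β is known.
conv-upper-tail : ∀ f g α β M s → (∀ i → 0ℚ ℚ.≤ f i) → (∀ i → g i ℚ.≤ β) →
  (∀ i → M ℕ.≤ i → i ℕ.≤ s ℕ.+ M → g i ℚ.≤ α) →
  conv f g (s ℕ.+ M) ℚ.≤ ∑ s f ℚ.* α ℚ.+ ∑ (suc M) (λ i → f (s ℕ.+ i)) ℚ.* β
conv-upper-tail f g α β M zero    0≤f g≤β g≤α = ℚ.≤-trans (conv-upper f g β M 0≤f g≤β)
  (ℚ.≤-reflexive (solve 2 (λ a x → x := con 0ℚ :* a :+ x) refl α (∑ (suc M) f ℚ.* β)))
conv-upper-tail f g α β M (suc s) 0≤f g≤β g≤α = ℚ.≤-trans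
  (ℚ.+-mono-≤ (*-monoˡ (f 0) (0≤f 0) (g≤α (suc s ℕ.+ M) (ℕ.m≤n+m M (suc s)) ℕ.≤-refl))
    (conv-upper-tail (f ∘ suc) g α β M s (0≤f ∘ suc) g≤β
      (λ i M≤i i≤ → g≤α i M≤i (ℕ.m≤n⇒m≤1+n i≤))))
  (ℚ.≤-reflexive (trans
    (solve 4 (λ x y a z → x :* a :+ (y :* a :+ z) := (x :+ y) :* a :+ z) refl
      (f 0) (∑ s (f ∘ suc)) α (∑ (suc M) (λ i → f (suc s ℕ.+ i)) ℚ.* β))
    (cong (λ z → z ℚ.* α ℚ.+ ∑ (suc M) (λ i → f (suc s ℕ.+ i)) ℚ.* β) (sym (∑-suc s f)))))

expTerm-nonNeg : ∀ {q} → 0ℚ ℚ.≤ q → ∀ i → 0ℚ ℚ.≤ expTerm q i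
expTerm-nonNeg {q} 0≤q = ExpBounds.T-nonNeg q 0≤q

expSum-1 : ∀ n → expSum 1ℚ n ℚ.≤ natℚ 4
-- Terms halve from index 2 on, which gives 1 + 1 + 2 * 1/2 = 3; rounding up to 4 keeps later bounds
-- powers of two.
expSum-1 n = ℚ.≤-trans (ExpBounds.sum-bounded 1ℚ 1ℚ-nonNeg 2 ℚ.≤-refl (suc n)) (natℚ-mono {3} {4} (ℕ.n≤1+n 3))

expSum-upper : ∀ B n → expSum (natℚ B) n ℚ.≤ natℚ (4 ℕ.^ B)
expSum-upper zero    n = ℚ.≤-reflexive (expSum-0 n)
expSum-upper (suc B) n = begin
  expSum (natℚ (suc B)) n                    ≡⟨ cong (λ z → expSum z n) (trans (natℚ-suc B) (ℚ.+-comm 1ℚ (natℚ B))) ⟩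
  expSum (natℚ B ℚ.+ 1ℚ) n                   ≡⟨ sym (conv-expSum (natℚ B) 1ℚ n) ⟩
  conv (expTerm (natℚ B)) (expSum 1ℚ) n      ≤⟨ conv-upper _ _ (natℚ 4) n (expTerm-nonNeg (natℚ-nonNeg B)) expSum-1 ⟩
  expSum (natℚ B) n ℚ.* natℚ 4               ≤⟨ *-monoʳ (natℚ 4) (natℚ-nonNeg 4) (expSum-upper B n) ⟩
  natℚ (4 ℕ.^ B) ℚ.* natℚ 4                  ≡⟨ trans (ℚ.*-comm (natℚ (4 ℕ.^ B)) (natℚ 4)) (sym (natℚ-homo-* 4 (4 ℕ.^ B))) ⟩
  natℚ (4 ℕ.^ suc B)                         ∎
  where open ℚ.≤-Reasoning

∣-∣≤⇒≤+ : ∀ p q {d} → ∣ p ℚ.- q ∣ ℚ.≤ d → q ℚ.≤ p ℚ.+ d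
∣-∣≤⇒≤+ p q {d} le = subst (ℚ._≤ p ℚ.+ d)
  (solve 2 (λ p q → p :+ (q :- p) := q) refl p q)
  (ℚ.+-monoʳ-≤ p (ℚ.≤-trans (≤∣∣ (q ℚ.- p)) (subst (ℚ._≤ d) (∣-∣-sym p q) le)))

-- Multiplying by the exponential of x ≥ 0 turns the partial sums at - x into 1;
-- the early ones, which are not close to the limit yet, meet only small weights.
expSum-neg-lower : ∀ B ε → 0ℚ ℚ.< ε → ∃ λ N → ∀ n → N ℕ.≤ n → ∀ x → 0ℚ ℚ.≤ x → x ℚ.≤ natℚ B →
  1ℚ ℚ.≤ natℚ (4 ℕ.^ B) ℚ.* (expSum (ℚ.- x) n ℚ.+ ε)
expSum-neg-lower B ε 0<ε = N ℕ.+ N , lower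
  where
  U = natℚ (4 ℕ.^ B)
  -- From index 2 B on, each term at B is at most half its predecessor.
  M = B ℕ.+ B
  open ExpBounds (natℚ B) (natℚ-nonNeg B) using (T; T-nonNeg; term-bound)
  2B≤M = ℚ.≤-reflexive (sym (natℚ-+ B B))

  0<½⊓ε : 0ℚ ℚ.< ½ ℚ.⊓ ε
  0<½⊓ε with ℚ.⊓-sel ½ ε
  ... | inj₁ eq = subst (0ℚ ℚ.<_) (sym eq) (ℚ.positive⁻¹ ½)
  ... | inj₂ eq = subst (0ℚ ℚ.<_) (sym eq) 0<ε

  -- The factor 2 + U serves both demands on δ: 2 δ ≤ ε and U δ ≤ 1/2.
  scaled = rescale (½ ℚ.⊓ ε) (2 ℕ.+ 4 ℕ.^ B) 0<½⊓ε
  δ  = proj₁ scaled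
  0<δ = proj₁ (proj₂ scaled)

  2δ≤ε : δ ℚ.+ δ ℚ.≤ ε
  2δ≤ε = ℚ.≤-trans (ℚ.≤-reflexive (double δ)) (ℚ.≤-trans
    (*-monoʳ δ (ℚ.<⇒≤ 0<δ) (natℚ-mono (ℕ.m≤m+n 2 (4 ℕ.^ B))))
    (ℚ.≤-trans (proj₂ (proj₂ scaled)) (ℚ.p⊓q≤q ½ ε)))

  Uδ≤½ : U ℚ.* δ ℚ.≤ ½
  Uδ≤½ = ℚ.≤-trans (*-monoʳ δ (ℚ.<⇒≤ 0<δ) (natℚ-mono (ℕ.m≤n+m (4 ℕ.^ B) 2)))
    (ℚ.≤-trans (proj₂ (proj₂ scaled)) (ℚ.p⊓q≤p ½ ε))

  K = proj₁ (natBound (T M ℚ.* natℚ B))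
  scaled′ = rescale δ (K ℕ.+ K) 0<δ
  arch = archimedean (proj₁ scaled′) (proj₁ (proj₂ scaled′))
  N₁ = M ℕ.⊔ proj₁ arch
  N = suc N₁

  T-small : ∀ m → N ℕ.≤ m → T m ℚ.+ T m ℚ.≤ δ
  T-small (suc m) (ℕ.s≤s N₁≤m) = begin
    T (suc m) ℚ.+ T (suc m)        ≤⟨ ℚ.+-mono-≤ Tm Tm ⟩
    natℚ K ℚ.* δ′ ℚ.+ natℚ K ℚ.* δ′ ≡⟨ sym (ℚ.*-distribʳ-+ δ′ (natℚ K) (natℚ K)) ⟩
    (natℚ K ℚ.+ natℚ K) ℚ.* δ′     ≡⟨ cong (ℚ._* δ′) (sym (natℚ-+ K K)) ⟩
    natℚ (K ℕ.+ K) ℚ.* δ′          ≤⟨ proj₂ (proj₂ scaled′) ⟩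
    δ                              ∎
    where
    open ℚ.≤-Reasoning
    δ′ = proj₁ scaled′
    Tm : T (suc m) ℚ.≤ natℚ K ℚ.* δ′
    Tm = ℚ.≤-trans (ExpBounds.tail-term (natℚ B) (natℚ-nonNeg B) M 2B≤M m
           (ℕ.m⊔n≤o⇒m≤o M (proj₁ arch) N₁≤m))
         (*-mono (*-nonNeg (T-nonNeg M) (natℚ-nonNeg B)) (ℚ.<⇒≤ (proj₁ (proj₂ scaled′)))
           (ℚ.≤-trans (≤∣∣ _) (proj₂ (natBound (T M ℚ.* natℚ B))))
           (ℚ.≤-trans (1/suc-antimono (ℕ.m⊔n≤o⇒n≤o M (proj₁ arch) N₁≤m)) (proj₂ arch)))

  M≤N : M ℕ.≤ N
  M≤N = ℕ.m≤n⇒m≤1+n (ℕ.m≤m⊔n M (proj₁ arch))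

  lower : ∀ n → N ℕ.+ N ℕ.≤ n → ∀ x → 0ℚ ℚ.≤ x → x ℚ.≤ natℚ B → 1ℚ ℚ.≤ U ℚ.* (expSum (ℚ.- x) n ℚ.+ ε)
  lower n 2N≤n x 0≤x x≤B = conclude (ℚ.≤-total y 0ℚ)
    where
    -- Terms of `t` before `s` meet partial sums of index at least N, all within δ of `e n`; terms
    -- from `s` on sum to at most δ since s ≥ N. This is why n ≥ 2 N is required.
    s = n ℕ.∸ N
    s+N≡n : s ℕ.+ N ≡ n
    s+N≡n = ℕ.m∸n+n≡m (ℕ.m+n≤o⇒m≤o N 2N≤n)
    N≤s : N ℕ.≤ s
    N≤s = subst (ℕ._≤ s) (ℕ.m+n∸n≡m N N) (ℕ.∸-monoˡ-≤ N 2N≤n)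

    ∣x∣≤B : ∣ x ∣ ℚ.≤ natℚ B
    ∣x∣≤B = subst (ℚ._≤ natℚ B) (sym (ℚ.0≤p⇒∣p∣≡p 0≤x)) x≤B
    ∣-x∣≤B : ∣ ℚ.- x ∣ ℚ.≤ natℚ B
    ∣-x∣≤B = subst (ℚ._≤ natℚ B) (sym (ℚ.∣-p∣≡∣p∣ x)) ∣x∣≤B

    t e : ℕ → ℚ
    t = expTerm x
    e = expSum (ℚ.- x)
    y = e n ℚ.+ δ
    S = ∑ s t

    e≤U : ∀ m → e m ℚ.≤ U
    e≤U m = ℚ.≤-trans (∑-mono (suc m) (expTerm (ℚ.- x)) T
      (λ i _ → ℚ.≤-trans (≤∣∣ _) (term-bound ∣-x∣≤B i))) (expSum-upper B m)

    e≤y : ∀ m → N ℕ.≤ m → m ℕ.≤ s ℕ.+ N → e m ℚ.≤ y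
    e≤y m N≤m m≤ = ∣-∣≤⇒≤+ (e n) (e m) (ℚ.≤-trans
      (ExpBounds.tail (natℚ B) (natℚ-nonNeg B) M 2B≤M ∣-x∣≤B (suc m)
        (ℕ.≤-trans M≤N (ℕ.m≤n⇒m≤1+n N≤m)) (suc n) (ℕ.s≤s (subst (m ℕ.≤_) s+N≡n m≤)))
      (T-small (suc m) (ℕ.m≤n⇒m≤1+n N≤m)))

    S≤U : S ℚ.≤ U
    S≤U = ℚ.≤-trans (∑-mono s t T (λ i _ → ℚ.≤-trans (≤∣∣ _) (term-bound ∣x∣≤B i)))
      (ℚ.≤-trans (∑-mono-length T T-nonNeg (ℕ.n≤1+n s)) (expSum-upper B s))

    late≤δ : ∑ (suc N) (λ i → t (s ℕ.+ i)) ℚ.≤ δ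
    late≤δ = ℚ.≤-trans (∑-mono (suc N) _ (λ i → T (i ℕ.+ s))
        (λ i _ → subst (λ z → t (s ℕ.+ i) ℚ.≤ T z) (ℕ.+-comm s i)
          (ℚ.≤-trans (≤∣∣ _) (term-bound ∣x∣≤B (s ℕ.+ i)))))
      (ℚ.≤-trans (ExpBounds.tail-sum (natℚ B) (natℚ-nonNeg B) M 2B≤M s (ℕ.≤-trans M≤N N≤s) (suc N))
        (T-small s N≤s))

    1≤ : 1ℚ ℚ.≤ S ℚ.* y ℚ.+ U ℚ.* δ
    1≤ = begin
      1ℚ                        ≡⟨ sym (expSum-0 n) ⟩
      expSum 0ℚ n               ≡⟨ cong (λ z → expSum z n) (sym (ℚ.+-inverseʳ x)) ⟩
      expSum (x ℚ.+ ℚ.- x) n    ≡⟨ sym (conv-expSum x (ℚ.- x) n) ⟩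
      conv t e n                ≡⟨ cong (conv t e) (sym s+N≡n) ⟩
      conv t e (s ℕ.+ N)        ≤⟨ conv-upper-tail t e y U N s (expTerm-nonNeg 0≤x) e≤U e≤y ⟩
      S ℚ.* y ℚ.+ ∑ (suc N) (λ i → t (s ℕ.+ i)) ℚ.* U
                                ≤⟨ ℚ.+-monoʳ-≤ (S ℚ.* y) (*-monoʳ U (natℚ-nonNeg (4 ℕ.^ B)) late≤δ) ⟩
      S ℚ.* y ℚ.+ δ ℚ.* U       ≡⟨ cong (S ℚ.* y ℚ.+_) (ℚ.*-comm δ U) ⟩
      S ℚ.* y ℚ.+ U ℚ.* δ       ∎
      where open ℚ.≤-Reasoning

    -- Enlarging `S` to `U` needs y ≥ 0. A nonpositive `y` would leave 1 ≤ 1/2.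
    conclude : y ℚ.≤ 0ℚ ⊎ 0ℚ ℚ.≤ y → 1ℚ ℚ.≤ U ℚ.* (e n ℚ.+ ε)
    conclude (inj₁ y≤0) = ⊥-elim (ℚ.<-irrefl {½} refl (ℚ.<-≤-trans (ℚ.*<* (ℤ.+<+ ℕ.≤-refl)) (begin
      1ℚ                        ≤⟨ 1≤ ⟩
      S ℚ.* y ℚ.+ U ℚ.* δ       ≤⟨ ℚ.+-mono-≤ (*-monoˡ S (∑-nonNeg s t (expTerm-nonNeg 0≤x)) y≤0) Uδ≤½ ⟩
      S ℚ.* 0ℚ ℚ.+ ½            ≡⟨ cong (ℚ._+ ½) (ℚ.*-zeroʳ S) ⟩
      ½                         ∎)))
      where open ℚ.≤-Reasoning
    conclude (inj₂ 0≤y) = begin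
      1ℚ                        ≤⟨ 1≤ ⟩
      S ℚ.* y ℚ.+ U ℚ.* δ       ≤⟨ ℚ.+-monoˡ-≤ (U ℚ.* δ) (*-monoʳ y 0≤y S≤U) ⟩
      U ℚ.* y ℚ.+ U ℚ.* δ       ≡⟨ solve 3 (λ u e d → u :* (e :+ d) :+ u :* d := u :* (e :+ (d :+ d))) refl U (e n) δ ⟩
      U ℚ.* (e n ℚ.+ (δ ℚ.+ δ)) ≤⟨ *-monoˡ U (natℚ-nonNeg (4 ℕ.^ B)) (ℚ.+-monoʳ-≤ (e n) 2δ≤ε) ⟩
      U ℚ.* (e n ℚ.+ ε)         ∎
      where open ℚ.≤-Reasoning

-- Real numbers are added and multiplied termwise, so the n-th terms of the
-- probabilities form a rational model of the channel.

𝔼 : ∀ {A : Set} → ℕ → Dist A → (A → ℚ) → ℚ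
𝔼 n d f = foldr (λ (p , a) s → seq p n ℚ.* f a ℚ.+ s) 0ℚ d

indicator : ∀ {S : Set} → Dec S → ℚ
indicator S? = if does S? then 1ℚ else 0ℚ

Pr-𝔼 : ∀ {A : Set} n (d : Dist A) {P : A → Set} (P? : Decidable P) →
  seq (Pr d P?) n ≡ 𝔼 n d (λ a → indicator (P? a))
Pr-𝔼 n []            P? = refl
Pr-𝔼 n ((p , a) ∷ d) P? = cong₂ ℚ._+_ (term (does (P? a))) (Pr-𝔼 n d P?)
  where
  term : ∀ c → seq (if c then p else fromℕ 0) n ≡ seq p n ℚ.* (if c then 1ℚ else 0ℚ)
  term true  = sym (ℚ.*-identityʳ (seq p n))
  term false = sym (ℚ.*-zeroʳ (seq p n))

module _ {A : Set} (n : ℕ) where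

  𝔼-cong : ∀ (d : Dist A) {f g} → f ≗ g → 𝔼 n d f ≡ 𝔼 n d g
  𝔼-cong []            f≗g = refl
  𝔼-cong ((p , a) ∷ d) f≗g = cong₂ ℚ._+_ (cong (seq p n ℚ.*_) (f≗g a)) (𝔼-cong d f≗g)

  𝔼-+ : ∀ (d : Dist A) f g → 𝔼 n d (λ a → f a ℚ.+ g a) ≡ 𝔼 n d f ℚ.+ 𝔼 n d g
  𝔼-+ []            f g = refl
  𝔼-+ ((p , a) ∷ d) f g = trans (cong (seq p n ℚ.* (f a ℚ.+ g a) ℚ.+_) (𝔼-+ d f g))
    (solve 5 (λ p x y s t → p :* (x :+ y) :+ (s :+ t) := (p :* x :+ s) :+ (p :* y :+ t)) refl
      (seq p n) (f a) (g a) (𝔼 n d f) (𝔼 n d g))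

  𝔼-0 : ∀ (d : Dist A) → 𝔼 n d (λ _ → 0ℚ) ≡ 0ℚ
  𝔼-0 []            = refl
  𝔼-0 ((p , a) ∷ d) = trans (cong₂ ℚ._+_ (ℚ.*-zeroʳ (seq p n)) (𝔼-0 d)) refl

  𝔼-sum : ∀ (d : Dist A) {k} (f : Fin k → A → ℚ) →
    𝔼 n d (λ a → sum (λ i → f i a)) ≡ sum (λ i → 𝔼 n d (f i))
  𝔼-sum d {zero}  f = 𝔼-0 d
  𝔼-sum d {suc k} f = trans (𝔼-+ d (f zero) (λ a → sum (λ i → f (suc i) a)))
    (cong (𝔼 n d (f zero) ℚ.+_) (𝔼-sum d (f ∘ suc)))

  𝔼-++ : ∀ (d e : Dist A) f → 𝔼 n (d ++ e) f ≡ 𝔼 n d f ℚ.+ 𝔼 n e f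
  𝔼-++ []            e f = sym (ℚ.+-identityˡ (𝔼 n e f))
  𝔼-++ ((p , a) ∷ d) e f = trans (cong (seq p n ℚ.* f a ℚ.+_) (𝔼-++ d e f))
    (sym (ℚ.+-assoc (seq p n ℚ.* f a) (𝔼 n d f) (𝔼 n e f)))

  𝔼-scale : ∀ p (d : Dist A) f → 𝔼 n (map (λ (q , a) → p * q , a) d) f ≡ seq p n ℚ.* 𝔼 n d f
  𝔼-scale p []            f = sym (ℚ.*-zeroʳ (seq p n))
  𝔼-scale p ((q , a) ∷ d) f = trans (cong (seq p n ℚ.* seq q n ℚ.* f a ℚ.+_) (𝔼-scale p d f))
    (solve 4 (λ p q x s → p :* q :* x :+ p :* s := p :* (q :* x :+ s)) refl
      (seq p n) (seq q n) (f a) (𝔼 n d f))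

  𝔼-return : ∀ (a : A) f → 𝔼 n (return a) f ≡ f a
  𝔼-return a f = solve 1 (λ x → con 1ℚ :* x :+ con 0ℚ := x) refl (f a)

𝔼-bind : ∀ {A B : Set} n (d : Dist A) (f : A → Dist B) φ →
  𝔼 n (d >>= f) φ ≡ 𝔼 n d (λ a → 𝔼 n (f a) φ)
𝔼-bind n []            f φ = refl
𝔼-bind n ((p , a) ∷ d) f φ = trans (𝔼-++ n (map (λ (q , b) → p * q , b) (f a)) (d >>= f) φ)
  (cong₂ ℚ._+_ (𝔼-scale n p (f a) φ) (𝔼-bind n d f φ))

-- Sums over the stations and the independent coins of one round

sum-mono : ∀ {k} {f g : Fin k → ℚ} → (∀ i → f i ℚ.≤ g i) → sum f ℚ.≤ sum g
sum-mono {zero}  f≤g = ℚ.≤-refl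
sum-mono {suc k} f≤g = ℚ.+-mono-≤ (f≤g zero) (sum-mono (f≤g ∘ suc))

sum-const : ∀ k c → sum {k} (const c) ≡ natℚ k ℚ.* c
sum-const zero    c = sym (ℚ.*-zeroˡ c)
sum-const (suc k) c = trans (cong (c ℚ.+_) (sum-const k c))
  (trans (solve 2 (λ a c → c :+ a :* c := (con 1ℚ :+ a) :* c) refl (natℚ k) c)
    (cong (ℚ._* c) (sym (natℚ-suc k))))

sum-nonNeg : ∀ {k} (f : Fin k → ℚ) → (∀ i → 0ℚ ℚ.≤ f i) → 0ℚ ℚ.≤ sum f
sum-nonNeg {k} f 0≤f = subst (ℚ._≤ sum f) (trans (sum-const k 0ℚ) (ℚ.*-zeroʳ (natℚ k))) (sum-mono 0≤f)

term≤sum : ∀ {k} (f : Fin k → ℚ) → (∀ i → 0ℚ ℚ.≤ f i) → ∀ i → f i ℚ.≤ sum f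
term≤sum {suc k} f 0≤f zero    = p≤p+q (f zero) (sum-nonNeg (f ∘ suc) (0≤f ∘ suc))
term≤sum {suc k} f 0≤f (suc i) = ℚ.≤-trans (term≤sum (f ∘ suc) (0≤f ∘ suc) i)
  (≤-slack (f zero) (0≤f zero) (ℚ.+-comm (sum (f ∘ suc)) (f zero)))

coins : ∀ {k} → (Fin k → ℚ) → (Subset k → ℚ) → ℚ
coins {zero}  x φ = φ []
coins {suc k} x φ = x zero ℚ.* coins (x ∘ suc) (φ ∘ (true ∷_))
  ℚ.+ (1ℚ ℚ.- x zero) ℚ.* coins (x ∘ suc) (φ ∘ (false ∷_))

𝔼-bernoulli : ∀ n p f → 𝔼 n (bernoulli p) f ≡ seq p n ℚ.* f true ℚ.+ (1ℚ ℚ.- seq p n) ℚ.* f false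
𝔼-bernoulli n p f = cong (seq p n ℚ.* f true ℚ.+_) (ℚ.+-identityʳ ((1ℚ ℚ.- seq p n) ℚ.* f false))

𝔼-coins : ∀ n {k} (p : Fin k → ℝ) φ → 𝔼 n (independentCoins p) φ ≡ coins (λ i → seq (p i) n) φ
𝔼-coins n {zero}  p φ = 𝔼-return n [] φ
𝔼-coins n {suc k} p φ = begin
  𝔼 n (bernoulli (p zero) >>= others) φ
    ≡⟨ 𝔼-bind n (bernoulli (p zero)) others φ ⟩
  𝔼 n (bernoulli (p zero)) (λ c → 𝔼 n (others c) φ)
    ≡⟨ 𝔼-cong n (bernoulli (p zero)) 𝔼-others ⟩
  𝔼 n (bernoulli (p zero)) (λ c → coins (λ i → seq (p (suc i)) n) (φ ∘ (c ∷_)))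
    ≡⟨ 𝔼-bernoulli n (p zero) (λ c → coins (λ i → seq (p (suc i)) n) (φ ∘ (c ∷_))) ⟩
  coins (λ i → seq (p i) n) φ ∎
  where
  open ≡-Reasoning
  others : Bool → Dist (Subset (suc k))
  others c = independentCoins (p ∘ suc) >>= λ cs → return (c ∷ cs)
  𝔼-others : ∀ c → 𝔼 n (others c) φ ≡ coins (λ i → seq (p (suc i)) n) (φ ∘ (c ∷_))
  𝔼-others c = trans (𝔼-bind n (independentCoins (p ∘ suc)) (λ cs → return (c ∷ cs)) φ)
    (trans (𝔼-cong n (independentCoins (p ∘ suc)) (λ cs → 𝔼-return n (c ∷ cs) φ))
      (𝔼-coins n (p ∘ suc) (φ ∘ (c ∷_))))

IsProb : ℚ → Set
IsProb x = 0ℚ ℚ.≤ x × x ℚ.≤ 1ℚ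

0≤1- : ∀ {x} → x ℚ.≤ 1ℚ → 0ℚ ℚ.≤ 1ℚ ℚ.- x
0≤1- {x} x≤1 = subst (ℚ._≤ 1ℚ ℚ.- x) (ℚ.+-inverseʳ x) (ℚ.+-monoˡ-≤ (ℚ.- x) x≤1)

coins-mono : ∀ {k} {x : Fin k → ℚ} → (∀ i → IsProb (x i)) → ∀ {φ ψ} → (∀ v → φ v ℚ.≤ ψ v) →
  coins x φ ℚ.≤ coins x ψ
coins-mono {zero}  px φ≤ψ = φ≤ψ []
coins-mono {suc k} {x} px φ≤ψ = ℚ.+-mono-≤
  (*-monoˡ (x zero) (proj₁ (px zero)) (coins-mono (px ∘ suc) (φ≤ψ ∘ (true ∷_))))
  (*-monoˡ (1ℚ ℚ.- x zero) (0≤1- (proj₂ (px zero))) (coins-mono (px ∘ suc) (φ≤ψ ∘ (false ∷_))))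

coins-const : ∀ {k} (x : Fin k → ℚ) c → coins x (const c) ≡ c
coins-const {zero}  x c = refl
coins-const {suc k} x c = trans
  (cong (λ z → x zero ℚ.* z ℚ.+ (1ℚ ℚ.- x zero) ℚ.* z) (coins-const (x ∘ suc) c))
  (solve 2 (λ x c → x :* c :+ (con 1ℚ :- x) :* c := c) refl (x zero) c)

coins≤ : ∀ {k} {x : Fin k → ℚ} → (∀ i → IsProb (x i)) → ∀ {φ w} → (∀ v → φ v ℚ.≤ w) → coins x φ ℚ.≤ w
coins≤ {x = x} px {w = w} φ≤w = ℚ.≤-trans (coins-mono px φ≤w) (ℚ.≤-reflexive (coins-const x w))

-- Union bound: `φ` can be positive only if some coin shows true, which has probability at most
-- `sum x`. It treats the other stations once station `i` is known to transmit.
coins-∅ : ∀ {k} {x : Fin k → ℚ} → (∀ i → IsProb (x i)) → ∀ {φ w} → 0ℚ ℚ.≤ w →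
  (∀ v → φ v ℚ.≤ w) → φ ⊥ ℚ.≤ 0ℚ → coins x φ ℚ.≤ sum x ℚ.* w
coins-∅ {zero}      px {w = w} 0≤w φ≤w φ⊥≤0 = ℚ.≤-trans φ⊥≤0 (ℚ.≤-reflexive (sym (ℚ.*-zeroˡ w)))
coins-∅ {suc k} {x} px {φ} {w} 0≤w φ≤w φ⊥≤0 = begin
  x₀ ℚ.* coins (x ∘ suc) (φ ∘ (true ∷_)) ℚ.+ (1ℚ ℚ.- x₀) ℚ.* coins (x ∘ suc) (φ ∘ (false ∷_))
    ≤⟨ ℚ.+-mono-≤ (*-monoˡ x₀ 0≤x₀ (coins≤ (px ∘ suc) (φ≤w ∘ (true ∷_))))
         (*-monoˡ (1ℚ ℚ.- x₀) (0≤1- x₀≤1) (coins-∅ (px ∘ suc) 0≤w (φ≤w ∘ (false ∷_)) φ⊥≤0)) ⟩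
  x₀ ℚ.* w ℚ.+ (1ℚ ℚ.- x₀) ℚ.* (Σx ℚ.* w)
    ≤⟨ ≤-slack (x₀ ℚ.* (Σx ℚ.* w)) (*-nonNeg 0≤x₀ (*-nonNeg (sum-nonNeg (x ∘ suc) (proj₁ ∘ px ∘ suc)) 0≤w))
         (solve 3 (λ x s w → x :* w :+ (con 1ℚ :- x) :* (s :* w) :+ x :* (s :* w) := (x :+ s) :* w) refl x₀ Σx w) ⟩
  (x₀ ℚ.+ Σx) ℚ.* w ∎
  where
  open ℚ.≤-Reasoning
  x₀ = x zero
  0≤x₀ = proj₁ (px zero)
  x₀≤1 = proj₂ (px zero)
  Σx = sum (x ∘ suc)

-- Station i transmits alone with probability x i ∏ (1 - x j) ≥ x i (1 - ∑ x j).
coins-⁅⁆ : ∀ {k} {x : Fin k → ℚ} → (∀ i → IsProb (x i)) → ∀ i {φ w} → 0ℚ ℚ.≤ w →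
  (∀ v → φ v ℚ.≤ w) → φ ⁅ i ⁆ ℚ.≤ 0ℚ → coins x φ ℚ.≤ (1ℚ ℚ.- x i ℚ.* (1ℚ ℚ.- sum x)) ℚ.* w
coins-⁅⁆ {suc k} {x} px zero {φ} {w} 0≤w φ≤w φ⁅i⁆≤0 = begin
  x₀ ℚ.* coins (x ∘ suc) (φ ∘ (true ∷_)) ℚ.+ (1ℚ ℚ.- x₀) ℚ.* coins (x ∘ suc) (φ ∘ (false ∷_))
    ≤⟨ ℚ.+-mono-≤ (*-monoˡ x₀ 0≤x₀ (coins-∅ (px ∘ suc) 0≤w (φ≤w ∘ (true ∷_)) φ⁅i⁆≤0))
         (*-monoˡ (1ℚ ℚ.- x₀) (0≤1- x₀≤1) (coins≤ (px ∘ suc) (φ≤w ∘ (false ∷_)))) ⟩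
  x₀ ℚ.* (Σx ℚ.* w) ℚ.+ (1ℚ ℚ.- x₀) ℚ.* w
    -- Giving up x₀² w lets the contention sum run over all stations, the successful one included.
    ≤⟨ ≤-slack (x₀ ℚ.* x₀ ℚ.* w) (*-nonNeg (*-nonNeg 0≤x₀ 0≤x₀) 0≤w)
         (solve 3 (λ x s w → x :* (s :* w) :+ (con 1ℚ :- x) :* w :+ x :* x :* w
           := (con 1ℚ :- x :* (con 1ℚ :- (x :+ s))) :* w) refl x₀ Σx w) ⟩
  (1ℚ ℚ.- x₀ ℚ.* (1ℚ ℚ.- (x₀ ℚ.+ Σx))) ℚ.* w ∎
  where
  open ℚ.≤-Reasoning
  x₀ = x zero
  0≤x₀ = proj₁ (px zero)
  x₀≤1 = proj₂ (px zero)
  Σx = sum (x ∘ suc)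
coins-⁅⁆ {suc k} {x} px (suc i) {φ} {w} 0≤w φ≤w φ⁅i⁆≤0 = begin
  x₀ ℚ.* coins (x ∘ suc) (φ ∘ (true ∷_)) ℚ.+ (1ℚ ℚ.- x₀) ℚ.* coins (x ∘ suc) (φ ∘ (false ∷_))
    ≤⟨ ℚ.+-mono-≤ (*-monoˡ x₀ 0≤x₀ (coins≤ (px ∘ suc) (φ≤w ∘ (true ∷_))))
         (*-monoˡ (1ℚ ℚ.- x₀) (0≤1- x₀≤1) (coins-⁅⁆ (px ∘ suc) i 0≤w (φ≤w ∘ (false ∷_)) φ⁅i⁆≤0)) ⟩
  x₀ ℚ.* w ℚ.+ (1ℚ ℚ.- x₀) ℚ.* ((1ℚ ℚ.- xᵢ ℚ.* (1ℚ ℚ.- Σx)) ℚ.* w)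
    ≤⟨ ≤-slack (xᵢ ℚ.* (x₀ ℚ.* Σx) ℚ.* w)
         (*-nonNeg (*-nonNeg (proj₁ (px (suc i))) (*-nonNeg 0≤x₀ (sum-nonNeg (x ∘ suc) (proj₁ ∘ px ∘ suc)))) 0≤w)
         (solve 4 (λ x y s w → x :* w :+ (con 1ℚ :- x) :* ((con 1ℚ :- y :* (con 1ℚ :- s)) :* w) :+ y :* (x :* s) :* w
           := (con 1ℚ :- y :* (con 1ℚ :- (x :+ s))) :* w) refl x₀ xᵢ Σx w) ⟩
  (1ℚ ℚ.- xᵢ ℚ.* (1ℚ ℚ.- (x₀ ℚ.+ Σx))) ℚ.* w ∎
  where
  open ℚ.≤-Reasoning
  x₀ = x zero
  xᵢ = x (suc i)
  0≤x₀ = proj₁ (px zero)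
  x₀≤1 = proj₂ (px zero)
  Σx = sum (x ∘ suc)

-- The execution as iterated conditional expectation

prob : ℕ → (b : ℕ) .{{_ : NonZero b}} → Maybe ℕ → ℚ
prob n b c = seq (transmitProb b c) n

module Run (n : ℕ) {k} (b : ℕ) .{{_ : NonZero b}} (adv : Adversary k) where

  -- The conditional expectation of `φ` one round later, given the history: `adv` has already fixed
  -- all clocks when the coins are tossed.
  nextRound : (History k → ℚ) → History k → ℚ
  nextRound φ h = coins (λ i → prob n b (clock adv i h)) (λ v → φ (v ∷ h))

  𝔼-run-suc : ∀ N φ → 𝔼 n (run b adv (suc N)) φ ≡ 𝔼 n (run b adv N) (nextRound φ)
  𝔼-run-suc N φ = trans (𝔼-bind n (run b adv N) extend φ) (𝔼-cong n (run b adv N) 𝔼-extend)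
    where
    choices : ∀ h → Dist (Subset k)
    choices h = independentCoins (λ i → transmitProb b (clock adv i h))
    extend : History k → Dist (History k)
    extend h = choices h >>= λ v → return (v ∷ h)
    𝔼-extend : ∀ h → 𝔼 n (extend h) φ ≡ nextRound φ h
    𝔼-extend h = trans (𝔼-bind n (choices h) (λ v → return (v ∷ h)) φ)
      (trans (𝔼-cong n (choices h) (λ v → 𝔼-return n (v ∷ h) φ))
        (𝔼-coins n (λ i → transmitProb b (clock adv i h)) (λ v → φ (v ∷ h))))

  module _ (isProb : ∀ c → IsProb (prob n b c)) where

    𝔼-run-mono : ∀ N {φ ψ} → (∀ h → φ h ℚ.≤ ψ h) → 𝔼 n (run b adv N) φ ℚ.≤ 𝔼 n (run b adv N) ψ
    𝔼-run-mono zero    {φ} {ψ} φ≤ψ =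
      subst₂ ℚ._≤_ (sym (𝔼-return n [] φ)) (sym (𝔼-return n [] ψ)) (φ≤ψ [])
    𝔼-run-mono (suc N) {φ} {ψ} φ≤ψ =
      subst₂ ℚ._≤_ (sym (𝔼-run-suc N φ)) (sym (𝔼-run-suc N ψ))
        (𝔼-run-mono N λ h → coins-mono (λ i → isProb (clock adv i h)) (λ v → φ≤ψ (v ∷ h)))

    𝔼-run-1 : ∀ N → 𝔼 n (run b adv N) (λ _ → 1ℚ) ≡ 1ℚ
    𝔼-run-1 zero    = 𝔼-return {History k} n [] (λ _ → 1ℚ)
    𝔼-run-1 (suc N) = trans (𝔼-run-suc N (λ _ → 1ℚ)) (trans
      (𝔼-cong n (run b adv N) (λ h → coins-const (λ i → prob n b (clock adv i h)) 1ℚ)) (𝔼-run-1 N))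

    supermartingale : ∀ φ → (∀ h → nextRound φ h ℚ.≤ φ h) → ∀ N → 𝔼 n (run b adv N) φ ℚ.≤ φ []
    supermartingale φ step zero    = ℚ.≤-reflexive (𝔼-return n [] φ)
    supermartingale φ step (suc N) = ℚ.≤-trans (ℚ.≤-reflexive (𝔼-run-suc N φ))
      (ℚ.≤-trans (𝔼-run-mono N step) (supermartingale φ step N))

^-nonNeg : ∀ {x} → 0ℚ ℚ.≤ x → ∀ m → 0ℚ ℚ.≤ x ^ℚ m
^-nonNeg 0≤x zero    = 1ℚ-nonNeg
^-nonNeg 0≤x (suc m) = *-nonNeg 0≤x (^-nonNeg 0≤x m)

-- Opaque, because comparing unfolded distributions is prohibitively slow.
opaque
  onTimeProb : ℕ → ∀ {k} (b : ℕ) .{{_ : NonZero b}} → Adversary k → ℕ → ℕ → ℚ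
  onTimeProb n b adv T N = seq (Pr (run b adv N) (allOnTime? adv T)) n

  seq-Pr : ∀ n {k} b .{{_ : NonZero b}} (adv : Adversary k) T N →
    seq (Pr (run b adv N) (allOnTime? adv T)) n ≡ onTimeProb n b adv T N
  seq-Pr n b adv T N = refl

¼ : ℚ
¼ = 1/suc 3

-- The contribution of a station to the contention is at most a young part, whose
-- sum over the whole life of the station is bounded, plus a negligible remainder o.
-- Hence all but 4 k Y rounds are calm.
module Deadline (n : ℕ) {k : ℕ} (b : ℕ) .{{_ : NonZero b}} (adv : Adversary k)
  (isProb : ∀ c → IsProb (prob n b c))
  (young : Maybe ℕ → ℚ) (0≤young : ∀ c → 0ℚ ℚ.≤ young c) (young-asleep : young nothing ≡ 0ℚ)
  (Y : ℕ) (young-total : ∀ m → ∑ m (young ∘ just) ℚ.≤ natℚ Y)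
  (o : ℚ) (prob≤young+o : ∀ c → prob n b c ℚ.≤ young c ℚ.+ o) (ko≤¼ : natℚ k ℚ.* o ℚ.≤ ¼)
  (W G : ℕ) (G+4kY≡W : G ℕ.+ 4 ℕ.* (k ℕ.* Y) ≡ W)
  (s : ℚ) (s-isProb : IsProb s)
  (prob≥2s : ∀ r → W ℕ.< r → r ℕ.≤ W ℕ.+ W → s ℚ.+ s ℚ.≤ prob n b (just r))
  where

  open Run n b adv

  T : ℕ
  T = W ℕ.+ W

  Calm : History k → Set
  Calm h = sum (λ i → young (clock adv i h)) ℚ.≤ ¼

  calm? : Decidable Calm
  calm? h = sum (λ i → young (clock adv i h)) ℚ.≤? ¼

  InWindow : Maybe ℕ → Set
  InWindow c = ∃ λ r → c ≡ just r × W ℕ.< r × r ℕ.≤ T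

  inWindow? : Decidable InWindow
  inWindow? nothing  = no λ { (_ , () , _) }
  inWindow? (just r) = map′ (λ p → r , refl , p) (λ { (_ , refl , p) → p }) (W ℕ.<? r ×-dec r ℕ.≤? T)

  fruitful? : ∀ i (h : History k) → Dec (InWindow (clock adv i h) × Calm h)
  fruitful? i h = inWindow? (clock adv i h) ×-dec calm? h

  crowded : History k → ℕ
  crowded []      = 0
  crowded (v ∷ h) = (if does (calm? h) then 0 else 1) ℕ.+ crowded h

  fruitful : Fin k → History k → ℕ
  fruitful i []      = 0
  fruitful i (v ∷ h) = (if does (fruitful? i h) then 1 else 0) ℕ.+ fruitful i h

  spent : Fin k → History k → ℚ
  spent i []      = 0ℚ
  spent i (v ∷ h) = young (clock adv i h) ℚ.+ spent i h

  youngUpTo : Maybe ℕ → ℚ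
  youngUpTo nothing  = 0ℚ
  youngUpTo (just r) = ∑ (suc r) (young ∘ just)

  -- An awake clock visits each local round once, so the amounts spent so far and the current one
  -- are distinct terms of the sum over the station's life. Including the current one makes the
  -- induction on the history work.
  spent-youngUpTo : ∀ i h → spent i h ℚ.+ young (clock adv i h) ℚ.≤ youngUpTo (clock adv i h)
  spent-youngUpTo i [] = start (lookup (adv []) i)
    where
    start : ∀ w → 0ℚ ℚ.+ young (tick w nothing) ℚ.≤ youngUpTo (tick w nothing)
    start true  = ℚ.≤-refl
    start false = ℚ.≤-reflexive (trans (ℚ.+-identityˡ (young nothing)) young-asleep)
  spent-youngUpTo i (v ∷ h) =
    step (lookup (adv (v ∷ h)) i) (clock adv i h) (spent i h) (spent-youngUpTo i h)
    where
    step : ∀ w c e → e ℚ.+ young c ℚ.≤ youngUpTo c →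
      young c ℚ.+ e ℚ.+ young (tick w c) ℚ.≤ youngUpTo (tick w c)
    step w     (just r) e le = ℚ.+-monoˡ-≤ (young (just (suc r)))
      (subst (ℚ._≤ youngUpTo (just r)) (ℚ.+-comm e (young (just r))) le)
    step true  nothing  e le = ℚ.+-monoˡ-≤ (young (just 0))
      (subst (ℚ._≤ 0ℚ) (ℚ.+-comm e (young nothing)) le)
    step false nothing  e le = ℚ.≤-trans
      (ℚ.≤-reflexive (trans (cong (young nothing ℚ.+ e ℚ.+_) young-asleep) (ℚ.+-identityʳ (young nothing ℚ.+ e))))
      (subst (ℚ._≤ 0ℚ) (ℚ.+-comm e (young nothing)) le)

  spent≤Y : ∀ i h → spent i h ℚ.≤ natℚ Y
  spent≤Y i h = ℚ.≤-trans (p≤p+q (spent i h) (0≤young (clock adv i h)))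
    (ℚ.≤-trans (spent-youngUpTo i h) (upTo≤Y (clock adv i h)))
    where
    upTo≤Y : ∀ c → youngUpTo c ℚ.≤ natℚ Y
    upTo≤Y nothing  = natℚ-nonNeg Y
    upTo≤Y (just r) = young-total (suc r)

  -- Charging argument: a round that is not calm consumes more than 1/4 of what all stations
  -- together can ever spend.
  crowded-spent : ∀ h → natℚ (crowded h) ℚ.* ¼ ℚ.≤ sum (λ i → spent i h)
  crowded-spent []      = sum-nonNeg (λ i → spent i []) (λ i → ℚ.≤-refl)
  crowded-spent (v ∷ h) = ℚ.≤-trans (step (calm? h))
    (ℚ.≤-reflexive (sym (∑-distrib-+ (λ i → young (clock adv i h)) (λ i → spent i h))))
    where
    contention = sum (λ i → young (clock adv i h))
    step : (d : Dec (Calm h)) → natℚ ((if does d then 0 else 1) ℕ.+ crowded h) ℚ.* ¼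
      ℚ.≤ contention ℚ.+ sum (λ i → spent i h)
    step (yes _)  = ℚ.≤-trans (crowded-spent h)
      (≤-slack contention (sum-nonNeg _ (λ i → 0≤young (clock adv i h)))
        (ℚ.+-comm (sum (λ i → spent i h)) contention))
    step (no ¬calm) = ℚ.≤-trans
      (ℚ.≤-reflexive (trans (cong (ℚ._* ¼) (natℚ-suc (crowded h)))
        (solve 2 (λ a q → (con 1ℚ :+ a) :* q := q :+ a :* q) refl (natℚ (crowded h)) ¼)))
      (ℚ.+-mono-≤ (ℚ.<⇒≤ (ℚ.≰⇒> ¬calm)) (crowded-spent h))

  crowded≤ : ∀ h → crowded h ℕ.≤ 4 ℕ.* (k ℕ.* Y)
  crowded≤ h = natℚ-cancel-≤ (begin
    natℚ (crowded h)
      ≡⟨ sym (trans (solve 3 (λ a c q → a :* (c :* q) := c :* q :* a) refl (natℚ 4) (natℚ (crowded h)) ¼)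
           (trans (ℚ.*-assoc (natℚ (crowded h)) ¼ (natℚ 4)) (ℚ.*-identityʳ (natℚ (crowded h))))) ⟩
    natℚ 4 ℚ.* (natℚ (crowded h) ℚ.* ¼)
      ≤⟨ *-monoˡ (natℚ 4) (natℚ-nonNeg 4) (ℚ.≤-trans (crowded-spent h)
           (ℚ.≤-trans (sum-mono (λ i → spent≤Y i h)) (ℚ.≤-reflexive (sum-const k (natℚ Y))))) ⟩
    natℚ 4 ℚ.* (natℚ k ℚ.* natℚ Y)
      ≡⟨ sym (trans (natℚ-homo-* 4 (k ℕ.* Y)) (cong (natℚ 4 ℚ.*_) (natℚ-homo-* k Y))) ⟩
    natℚ (4 ℕ.* (k ℕ.* Y)) ∎)
    where open ℚ.≤-Reasoning

  just-woken : ∀ w {c} → tick w nothing ≡ just c → c ≡ 0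
  just-woken true refl = refl

  -- Local rounds 0 to W are counted as free; each later one up to T was either crowded or fruitful.
  -- The auxiliary `m` caps the clock at T + 1, as rounds past the window cannot be fruitful.
  progress : ∀ i h {c} → clock adv i h ≡ just c → ∀ m → m ℕ.≤ c → m ℕ.≤ suc T →
    m ℕ.≤ suc W ℕ.+ (crowded h ℕ.+ fruitful i h)
  progress i []      eq m m≤c _ with just-woken (lookup (adv []) i) eq
  progress i []      eq .0 ℕ.z≤n _ | refl = ℕ.z≤n
  progress i (v ∷ h) eq = step (clock adv i h) refl eq
    where
    x = if does (calm? h) then 0 else 1
    y = if does (fruitful? i h) then 1 else 0

    regroup : crowded (v ∷ h) ℕ.+ fruitful i (v ∷ h) ≡ (x ℕ.+ y) ℕ.+ (crowded h ℕ.+ fruitful i h)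
    regroup = ℕ-Solver.solve 4 (λ x c y f → (x ℕ-Solver.:+ c) ℕ-Solver.:+ (y ℕ-Solver.:+ f)
      ℕ-Solver.:= (x ℕ-Solver.:+ y) ℕ-Solver.:+ (c ℕ-Solver.:+ f)) refl x (crowded h) y (fruitful i h)

    grows : ∀ {A B : Set} (a? : Dec A) (b? : Dec B) → A →
      1 ℕ.≤ (if does b? then 0 else 1) ℕ.+ (if does (a? ×-dec b?) then 1 else 0)
    grows (yes _) (yes _) _ = ℕ.≤-refl
    grows (yes _) (no _)  _ = ℕ.≤-refl
    grows (no ¬a) b?      a = contradiction a ¬a

    step : ∀ d {c} → clock adv i h ≡ d → tick (lookup (adv (v ∷ h)) i) d ≡ just c →
      ∀ m → m ℕ.≤ c → m ℕ.≤ suc T → m ℕ.≤ suc W ℕ.+ (crowded (v ∷ h) ℕ.+ fruitful i (v ∷ h))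
    step nothing  past now m m≤c m≤ with just-woken (lookup (adv (v ∷ h)) i) now
    step nothing  past now .0 ℕ.z≤n m≤ | refl = ℕ.z≤n
    step (just c) past refl m m≤ m≤T+1 with ℕ.m≤n⇒m<n∨m≡n m≤
    ... | inj₁ (ℕ.s≤s m≤c) = ℕ.≤-trans (progress i h past m m≤c m≤T+1) (ℕ.+-monoʳ-≤ (suc W)
            (subst (crowded h ℕ.+ fruitful i h ℕ.≤_) (sym regroup) (ℕ.m≤n+m _ (x ℕ.+ y))))
    ... | inj₂ refl with W ℕ.<? c
    ...   | no  W≮c = ℕ.≤-trans (ℕ.s≤s (ℕ.≮⇒≥ W≮c)) (ℕ.m≤m+n (suc W) _)
    ...   | yes W<c = begin
      suc c                                                     ≤⟨ ℕ.s≤s (progress i h past c ℕ.≤-refl (ℕ.m≤n⇒m≤1+n (ℕ.≤-pred m≤T+1))) ⟩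
      suc (suc W ℕ.+ (crowded h ℕ.+ fruitful i h))              ≡⟨ ℕ.+-suc (suc W) _ ⟨
      suc W ℕ.+ (1 ℕ.+ (crowded h ℕ.+ fruitful i h))            ≤⟨ ℕ.+-monoʳ-≤ (suc W) (ℕ.+-monoˡ-≤ _
        (grows (inWindow? (clock adv i h)) (calm? h) (c , past , W<c , ℕ.≤-pred m≤T+1))) ⟩
      suc W ℕ.+ ((x ℕ.+ y) ℕ.+ (crowded h ℕ.+ fruitful i h))    ≡⟨ cong (suc W ℕ.+_) (sym regroup) ⟩
      suc W ℕ.+ (crowded (v ∷ h) ℕ.+ fruitful i (v ∷ h))        ∎
      where open ℕ.≤-Reasoning

  fruitful-after-deadline : ∀ i h {r} → clock adv i h ≡ just r → T ℕ.< r → G ℕ.≤ fruitful i h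
  fruitful-after-deadline i h eq T<r = ℕ.+-cancelˡ-≤ (crowded h) G (fruitful i h) (begin
    crowded h ℕ.+ G              ≤⟨ ℕ.+-monoˡ-≤ G (crowded≤ h) ⟩
    4 ℕ.* (k ℕ.* Y) ℕ.+ G        ≡⟨ trans (ℕ.+-comm (4 ℕ.* (k ℕ.* Y)) G) G+4kY≡W ⟩
    -- `suc T` computes to `suc W + W`, so the free rounds cancel and W rounds remain.
    W                            ≤⟨ ℕ.+-cancelˡ-≤ (suc W) W _ (progress i h eq (suc T) T<r ℕ.≤-refl) ⟩
    crowded h ℕ.+ fruitful i h   ∎)
    where open ℕ.≤-Reasoning

  β : ℚ
  β = 1ℚ ℚ.- s

  0≤β : 0ℚ ℚ.≤ β
  0≤β = 0≤1- (proj₂ s-isProb)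

  β≤1 : β ℚ.≤ 1ℚ
  β≤1 = ≤-slack s (proj₁ s-isProb) (solve 1 (λ s → con 1ℚ :- s :+ s := con 1ℚ) refl s)

  weight : Fin k → History k → ℚ
  weight i h = β ^ℚ (G ℕ.∸ fruitful i h)

  -- Bounds the conditional probability that station `i` misses its deadline: it starts at most at β
  -- ^ G, vanishes upon success, and equals 1 at a missed deadline.
  potential : Fin k → History k → ℚ
  potential i h = if does (succeedsWithin? adv T i h) then 0ℚ else weight i h

  weight-nonNeg : ∀ i h → 0ℚ ℚ.≤ weight i h
  weight-nonNeg i h = ^-nonNeg 0≤β (G ℕ.∸ fruitful i h)

  potential-success : ∀ i h → SucceedsWithin adv T i h → potential i h ≡ 0ℚ
  potential-success i h S = cong (λ c → if c then 0ℚ else weight i h) (dec-true (succeedsWithin? adv T i h) S)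

  potential-failure : ∀ i h → ¬ SucceedsWithin adv T i h → potential i h ≡ weight i h
  potential-failure i h ¬S = cong (λ c → if c then 0ℚ else weight i h) (dec-false (succeedsWithin? adv T i h) ¬S)

  potential≤weight : ∀ i h → potential i h ℚ.≤ weight i h
  potential≤weight i h with succeedsWithin? adv T i h
  ... | yes _ = weight-nonNeg i h
  ... | no  _ = ℚ.≤-refl

  potential-nonNeg : ∀ i h → 0ℚ ℚ.≤ potential i h
  potential-nonNeg i h with succeedsWithin? adv T i h
  ... | yes _ = ℚ.≤-refl
  ... | no  _ = weight-nonNeg i h

  -- Below `G` this is an equality. After `G` fruitful rounds the truncated subtraction freezes the
  -- exponent at 0, and β ≤ 1 suffices.
  β-step : ∀ g → β ℚ.* β ^ℚ (G ℕ.∸ suc g) ℚ.≤ β ^ℚ (G ℕ.∸ g)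
  β-step g with g ℕ.<? G
  ... | yes g<G = ℚ.≤-reflexive (cong (β ^ℚ_) (sym (ℕ.+-∸-assoc 1 g<G)))
  ... | no  g≮G = ℚ.≤-trans
    (ℚ.≤-reflexive (trans (cong (λ m → β ℚ.* β ^ℚ m) (ℕ.m≤n⇒m∸n≡0 (ℕ.m≤n⇒m≤1+n (ℕ.≮⇒≥ g≮G)))) (ℚ.*-identityʳ β)))
    (ℚ.≤-trans β≤1 (ℚ.≤-reflexive (cong (β ^ℚ_) (sym (ℕ.m≤n⇒m∸n≡0 (ℕ.≮⇒≥ g≮G))))))

  contention≤½ : ∀ h → Calm h → sum (λ i → prob n b (clock adv i h)) ℚ.≤ ½
  contention≤½ h calm = begin
    sum (λ i → prob n b (clock adv i h))                 ≤⟨ sum-mono (λ i → prob≤young+o (clock adv i h)) ⟩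
    sum (λ i → young (clock adv i h) ℚ.+ o)              ≡⟨ ∑-distrib-+ (λ i → young (clock adv i h)) (const o) ⟩
    sum (λ i → young (clock adv i h)) ℚ.+ sum {k} (const o) ≡⟨ cong (sum (λ i → young (clock adv i h)) ℚ.+_) (sum-const k o) ⟩
    sum (λ i → young (clock adv i h)) ℚ.+ natℚ k ℚ.* o   ≤⟨ ℚ.+-mono-≤ calm ko≤¼ ⟩
    ½                                                    ∎
    where open ℚ.≤-Reasoning

  module _ (i : Fin k) (h : History k) where
    private
      x : Fin k → ℚ
      x j = prob n b (clock adv j h)
      isProb-x : ∀ j → IsProb (x j)
      isProb-x j = isProb (clock adv j h)

    potential-fruitful : InWindow (clock adv i h) → Calm h → nextRound (potential i) h ℚ.≤ weight i h
    potential-fruitful inWindow@(r , eq , W<r , r≤T) calm = begin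
      nextRound (potential i) h
        ≤⟨ coins-⁅⁆ isProb-x i {λ v → potential i (v ∷ h)} (^-nonNeg 0≤β (G ℕ.∸ suc (fruitful i h))) below
             (ℚ.≤-reflexive (potential-success i (⁅ i ⁆ ∷ h)
               (inj₁ (refl , r , eq , ℕ.≤-trans (ℕ.s≤s ℕ.z≤n) W<r , r≤T)))) ⟩
      (1ℚ ℚ.- x i ℚ.* (1ℚ ℚ.- sum x)) ℚ.* β ^ℚ (G ℕ.∸ suc (fruitful i h))
        ≤⟨ *-monoʳ _ (^-nonNeg 0≤β (G ℕ.∸ suc (fruitful i h)))
             (ℚ.+-monoʳ-≤ 1ℚ (ℚ.neg-antimono-≤ s≤)) ⟩
      β ℚ.* β ^ℚ (G ℕ.∸ suc (fruitful i h))
        ≤⟨ β-step (fruitful i h) ⟩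
      weight i h ∎
      where
      open ℚ.≤-Reasoning
      below : ∀ v → potential i (v ∷ h) ℚ.≤ β ^ℚ (G ℕ.∸ suc (fruitful i h))
      below v = subst (λ c → potential i (v ∷ h) ℚ.≤ β ^ℚ (G ℕ.∸ ((if c then 1 else 0) ℕ.+ fruitful i h)))
        (dec-true (fruitful? i h) (inWindow , calm)) (potential≤weight i (v ∷ h))
      -- The bias is at least 2 s, and silence of the others costs at most the factor 1/2.
      s≤ : s ℚ.≤ x i ℚ.* (1ℚ ℚ.- sum x)
      s≤ = begin
        s                        ≡⟨ solve 1 (λ s → s := (s :+ s) :* con ½) refl s ⟩
        (s ℚ.+ s) ℚ.* ½          ≤⟨ *-monoʳ ½ (ℚ.nonNegative⁻¹ ½)
          (subst (λ c → s ℚ.+ s ℚ.≤ prob n b c) (sym eq) (prob≥2s r W<r r≤T)) ⟩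
        x i ℚ.* ½                ≤⟨ *-monoˡ (x i) (proj₁ (isProb-x i))
          (ℚ.+-monoʳ-≤ 1ℚ (ℚ.neg-antimono-≤ (contention≤½ h calm))) ⟩
        x i ℚ.* (1ℚ ℚ.- sum x)   ∎

    potential-step : nextRound (potential i) h ℚ.≤ potential i h
    potential-step = step (succeedsWithin? adv T i h) (fruitful? i h)
      where
      step : Dec (SucceedsWithin adv T i h) → Dec (InWindow (clock adv i h) × Calm h) →
        nextRound (potential i) h ℚ.≤ potential i h
      step (yes S) _ = ℚ.≤-trans
        (coins≤ isProb-x (λ v → ℚ.≤-reflexive (potential-success i (v ∷ h) (inj₂ S))))
        (potential-nonNeg i h)
      step (no ¬S) (yes (inWindow , calm)) = subst (nextRound (potential i) h ℚ.≤_)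
        (sym (potential-failure i h ¬S)) (potential-fruitful inWindow calm)
      step (no ¬S) (no ¬fruitful) = subst (nextRound (potential i) h ℚ.≤_)
        (sym (potential-failure i h ¬S)) (coins≤ isProb-x λ v →
          subst (λ c → potential i (v ∷ h) ℚ.≤ β ^ℚ (G ℕ.∸ ((if c then 1 else 0) ℕ.+ fruitful i h)))
            (dec-false (fruitful? i h) ¬fruitful) (potential≤weight i (v ∷ h)))

  -- Past the deadline at least `G` fruitful rounds have occurred, so the exponent of the weight has
  -- reached 0.
  potential-late-failure : ∀ i h → ¬ (∀ r → clock adv i h ≡ just r → T ℕ.< r → SucceedsWithin adv T i h) →
    1ℚ ℚ.≤ potential i h
  potential-late-failure i h failure = late (clock adv i h) refl
    where
    late : ∀ c → clock adv i h ≡ c → 1ℚ ℚ.≤ potential i h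
    late nothing  eq = contradiction (λ r eq′ _ → case trans (sym eq) eq′ of λ ()) failure
    late (just r) eq with T ℕ.<? r
    ... | no  T≮r = contradiction (λ r′ eq′ T<r′ → contradiction
      (subst (T ℕ.<_) (just-injective (trans (sym eq′) eq)) T<r′) T≮r) failure
    ... | yes T<r = ℚ.≤-reflexive (sym (trans (potential-failure i h λ S → failure (λ _ _ _ → S))
      (cong (β ^ℚ_) (ℕ.m≤n⇒m∸n≡0 (fruitful-after-deadline i h eq T<r)))))

  -- The union bound in pointwise form: if some station is late, its potential alone contributes 1.
  -- Taking expectations then bounds the failure probability by the initial potentials.
  onTime-or-potential : ∀ h → 1ℚ ℚ.≤ indicator (allOnTime? adv T h) ℚ.+ sum (λ i → potential i h)
  onTime-or-potential h = step (allOnTime? adv T h)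
    where
    Φ = sum (λ i → potential i h)
    Φ-nonNeg : 0ℚ ℚ.≤ Φ
    Φ-nonNeg = sum-nonNeg (λ i → potential i h) (λ i → potential-nonNeg i h)
    step : (d : Dec (AllOnTime adv T h)) → 1ℚ ℚ.≤ indicator d ℚ.+ Φ
    step (yes _)       = p≤p+q 1ℚ Φ-nonNeg
    step (no ¬onTime)
      with i , failure ← ¬∀⟶∃¬ k _ (λ i → afterDeadline? T (clock adv i h) (succeedsWithin? adv T i h)) ¬onTime
      = ℚ.≤-trans (potential-late-failure i h failure)
        (ℚ.≤-trans (term≤sum (λ j → potential j h) (λ j → potential-nonNeg j h) i)
          (ℚ.≤-reflexive (sym (ℚ.+-identityˡ Φ))))

  onTime-lower : ∀ N → 1ℚ ℚ.≤ onTimeProb n b adv T N ℚ.+ natℚ k ℚ.* β ^ℚ G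
  onTime-lower N = begin
    1ℚ
      ≡⟨ sym (𝔼-run-1 isProb N) ⟩
    𝔼 n R (λ _ → 1ℚ)
      ≤⟨ 𝔼-run-mono isProb N onTime-or-potential ⟩
    𝔼 n R (λ h → indicator (allOnTime? adv T h) ℚ.+ sum (λ i → potential i h))
      ≡⟨ 𝔼-+ n R (λ h → indicator (allOnTime? adv T h)) (λ h → sum (λ i → potential i h)) ⟩
    𝔼 n R (λ h → indicator (allOnTime? adv T h)) ℚ.+ 𝔼 n R (λ h → sum (λ i → potential i h))
      ≡⟨ cong₂ ℚ._+_ (trans (sym (Pr-𝔼 n R (allOnTime? adv T))) (seq-Pr n b adv T N)) (𝔼-sum n R potential) ⟩
    onTimeProb n b adv T N ℚ.+ sum (λ i → 𝔼 n R (potential i))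
      ≤⟨ ℚ.+-monoʳ-≤ (onTimeProb n b adv T N)
           (sum-mono (λ i → supermartingale isProb (potential i) (potential-step i) N)) ⟩
    onTimeProb n b adv T N ℚ.+ sum {k} (const (β ^ℚ G))
      ≡⟨ cong (onTimeProb n b adv T N ℚ.+_) (sum-const k (β ^ℚ G)) ⟩
    onTimeProb n b adv T N ℚ.+ natℚ k ℚ.* β ^ℚ G ∎
    where
    open ℚ.≤-Reasoning
    R = run b adv N

-- Bounds for the transmission probabilities

phaseProb : ℕ → ℕ → ℚ
phaseProb n i = lnSeq (3 ℕ.+ i) n ℚ.* 1/suc (2 ℕ.+ i)

phaseProb-isProb : ∀ n i → IsProb (phaseProb n i)
phaseProb-isProb n i = *-nonNeg (lnSeq-nonNeg (3 ℕ.+ i) n) (1/suc-nonNeg (2 ℕ.+ i)) ,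
  ℚ.≤-trans (*-monoʳ (1/suc (2 ℕ.+ i)) (1/suc-nonNeg (2 ℕ.+ i)) (lnSeq≤pred (2 ℕ.+ i) n))
    (natℚ*1/suc (2 ℕ.+ i) (2 ℕ.+ i) (ℕ.n≤1+n (2 ℕ.+ i)))

prob-isProb : ∀ n b .{{_ : NonZero b}} c → IsProb (prob n b c)
prob-isProb n b nothing        = ℚ.≤-refl , 1ℚ-nonNeg
prob-isProb n b (just zero)    = ℚ.≤-refl , 1ℚ-nonNeg
prob-isProb n b (just (suc r)) = phaseProb-isProb n (r / b)

-- The Riemann sum of mesh 1 is 1/2 + 1/3 + ... + 1/(Q + 2), so bounds on `lnSeq` also bound
-- harmonic sums.
∑-harmonic : ∀ Q → ∑ Q (λ i → 1/suc (2 ℕ.+ i)) ℚ.≤ lnSeq (2 ℕ.+ Q) 0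
∑-harmonic zero    = lnSeq-nonNeg 2 0
∑-harmonic (suc Q) = begin
  ∑ Q (λ i → 1/suc (2 ℕ.+ i)) ℚ.+ 1/suc (2 ℕ.+ Q)
    ≤⟨ ℚ.+-mono-≤ (∑-harmonic Q) (ℚ.≤-reflexive (sym
         (trans (cong (λ z → 1ℚ ℚ.* 1/suc (1 ℕ.+ z)) (ℕ.+-comm Q 1)) (ℚ.*-identityˡ (1/suc (2 ℕ.+ Q)))))) ⟩
  lnSeq (2 ℕ.+ Q) 0 ℚ.+ natℚ 1 ℚ.* 1/suc (1 ℕ.+ Q ℕ.+ 1)
    ≤⟨ lnSeq-lower (1 ℕ.+ Q) 1 0 ⟩
  lnSeq (2 ℕ.+ Q ℕ.+ 1) 0
    ≡⟨ cong (λ z → lnSeq (2 ℕ.+ z) 0) (ℕ.+-comm Q 1) ⟩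
  lnSeq (2 ℕ.+ suc Q) 0 ∎
  where open ℚ.≤-Reasoning

∑-phases : ∀ b .{{_ : NonZero b}} f → (∀ i → 0ℚ ℚ.≤ f i) → ∀ m →
  ∑ m (λ r → f (r / b)) ℚ.≤ natℚ b ℚ.* ∑ m f
∑-phases b f 0≤f m = ℚ.≤-trans (∑-mono-length _ (λ r → 0≤f (r / b)) (ℕ.m≤m*n m b)) (blocks m)
  where
  phase : ∀ c l → l ℕ.< b → (l ℕ.+ c ℕ.* b) / b ≡ c
  phase c l l<b = trans (+-distrib-/-∣ʳ l (divides-refl c)) (cong₂ ℕ._+_ (m<n⇒m/n≡0 l<b) (m*n/n≡m c b))

  blocks : ∀ c → ∑ (c ℕ.* b) (λ r → f (r / b)) ℚ.≤ natℚ b ℚ.* ∑ c f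
  blocks zero    = ℚ.≤-reflexive (sym (ℚ.*-zeroʳ (natℚ b)))
  blocks (suc c) = begin
    ∑ (b ℕ.+ c ℕ.* b) (λ r → f (r / b))
      ≡⟨ ∑-split (c ℕ.* b) b (λ r → f (r / b)) ⟩
    ∑ (c ℕ.* b) (λ r → f (r / b)) ℚ.+ ∑ b (λ l → f ((l ℕ.+ c ℕ.* b) / b))
      ≤⟨ ℚ.+-mono-≤ (blocks c) (ℚ.≤-trans
           (∑-mono b _ (λ _ → f c) (λ l l<b → ℚ.≤-reflexive (cong f (phase c l l<b))))
           (∑-upper b (λ _ → f c) (f c) (λ _ → ℚ.≤-refl))) ⟩
    natℚ b ℚ.* ∑ c f ℚ.+ natℚ b ℚ.* f c
      ≡⟨ sym (ℚ.*-distribˡ-+ (natℚ b) (∑ c f) (f c)) ⟩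
    natℚ b ℚ.* ∑ (suc c) f ∎
    where open ℚ.≤-Reasoning

module Young (n b : ℕ) .{{_ : NonZero b}} (P m : ℕ) (1≤P : 1 ℕ.≤ P) (3+m≤2^P : 3 ℕ.+ m ℕ.≤ 2 ℕ.^ P) where

  lnSeq≤P : ∀ {j} n → j ℕ.≤ 3 ℕ.+ m → lnSeq j n ℚ.≤ natℚ P
  lnSeq≤P n j≤ = ℚ.≤-trans (lnSeq-mono n (ℕ.≤-trans j≤ 3+m≤2^P)) (lnSeq-2^-upper P n)

  youngPhase : ℕ → ℚ
  youngPhase i = if does (i ℕ.<? suc m) then phaseProb n i else 0ℚ

  young : Maybe ℕ → ℚ
  young (just (suc r)) = youngPhase (r / b)
  young (just zero)    = 0ℚ
  young nothing        = 0ℚ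

  remainder : ℚ
  remainder = natℚ P ℚ.* 1/suc m

  remainder-nonNeg : 0ℚ ℚ.≤ remainder
  remainder-nonNeg = *-nonNeg (natℚ-nonNeg P) (1/suc-nonNeg m)

  youngPhase-nonNeg : ∀ i → 0ℚ ℚ.≤ youngPhase i
  youngPhase-nonNeg i with does (i ℕ.<? suc m)
  ... | true  = proj₁ (phaseProb-isProb n i)
  ... | false = ℚ.≤-refl

  youngPhase≤ : ∀ i → youngPhase i ℚ.≤ phaseProb n i
  youngPhase≤ i with does (i ℕ.<? suc m)
  ... | true  = ℚ.≤-refl
  ... | false = proj₁ (phaseProb-isProb n i)

  young-nonNeg : ∀ c → 0ℚ ℚ.≤ young c
  young-nonNeg (just (suc r)) = youngPhase-nonNeg (r / b)
  young-nonNeg (just zero)    = ℚ.≤-refl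
  young-nonNeg nothing        = ℚ.≤-refl

  -- With 3 + i = m + 1 + d, the logarithm is at most P + d / (m + 1), and since P ≥ 1 this is at
  -- most (m + 1 + d) P / (m + 1). This linear bound replaces monotonicity of ln j / j.
  oldPhase : ∀ i → suc m ℕ.≤ i → phaseProb n i ℚ.≤ remainder
  oldPhase i m<i = subst (λ z → lnSeq (suc z) n ℚ.* 1/suc z ℚ.≤ remainder) (ℕ.m+[n∸m]≡n m≤2+i) (*1/suc≤ (m ℕ.+ d) (begin
    lnSeq (suc m ℕ.+ d) n
      ≤⟨ lnSeq-upper m d n ⟩
    lnSeq (suc m) n ℚ.+ natℚ d ℚ.* 1/suc m
      ≤⟨ ℚ.+-mono-≤ (lnSeq≤P n (ℕ.m≤n+m (suc m) 2)) (*-monoˡ (natℚ d) (natℚ-nonNeg d)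
           (ℚ.≤-trans (ℚ.≤-reflexive (sym (ℚ.*-identityˡ (1/suc m))))
             (*-monoʳ (1/suc m) (1/suc-nonNeg m) (natℚ-mono 1≤P)))) ⟩
    natℚ P ℚ.+ natℚ d ℚ.* remainder
      ≡⟨ cong (ℚ._+ natℚ d ℚ.* remainder) (sym (trans
           (solve 3 (λ a p r → a :* (p :* r) := (a :* r) :* p) refl (natℚ (suc m)) (natℚ P) (1/suc m))
           (trans (cong (ℚ._* natℚ P) (natℚ-inverse m)) (ℚ.*-identityˡ (natℚ P))))) ⟩
    natℚ (suc m) ℚ.* remainder ℚ.+ natℚ d ℚ.* remainder
      ≡⟨ trans (sym (ℚ.*-distribʳ-+ remainder (natℚ (suc m)) (natℚ d)))
           (cong (ℚ._* remainder) (sym (natℚ-+ (suc m) d))) ⟩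
    natℚ (suc m ℕ.+ d) ℚ.* remainder ∎))
    where
    open ℚ.≤-Reasoning
    m≤2+i : m ℕ.≤ 2 ℕ.+ i
    m≤2+i = ℕ.≤-trans (ℕ.<⇒≤ m<i) (ℕ.m≤n+m i 2)
    d = 2 ℕ.+ i ℕ.∸ m

  phaseProb≤ : ∀ i → phaseProb n i ℚ.≤ youngPhase i ℚ.+ remainder
  phaseProb≤ i = bound (i ℕ.<? suc m)
    where
    bound : (d : Dec (i ℕ.< suc m)) →
      phaseProb n i ℚ.≤ (if does d then phaseProb n i else 0ℚ) ℚ.+ remainder
    bound (yes _)   = p≤p+q (phaseProb n i) remainder-nonNeg
    bound (no i≮sm) = ℚ.≤-trans (oldPhase i (ℕ.≮⇒≥ i≮sm)) (ℚ.≤-reflexive (sym (ℚ.+-identityˡ remainder)))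

  prob≤young+remainder : ∀ c → prob n b c ℚ.≤ young c ℚ.+ remainder
  prob≤young+remainder (just (suc r)) = phaseProb≤ (r / b)
  prob≤young+remainder (just zero)    = subst (0ℚ ℚ.≤_) (sym (ℚ.+-identityˡ remainder)) remainder-nonNeg
  prob≤young+remainder nothing        = subst (0ℚ ℚ.≤_) (sym (ℚ.+-identityˡ remainder)) remainder-nonNeg

  -- The origin of log² k: one factor `P` bounds the logarithms, the other the harmonic sum.
  ∑-phaseProb : ∑ (suc m) (phaseProb n) ℚ.≤ natℚ (P ℕ.* P)
  ∑-phaseProb = begin
    ∑ (suc m) (phaseProb n)
      ≤⟨ ∑-mono (suc m) (phaseProb n) (λ i → 1/suc (2 ℕ.+ i) ℚ.* natℚ P) (λ i i≤m →
           ℚ.≤-trans (*-monoʳ (1/suc (2 ℕ.+ i)) (1/suc-nonNeg (2 ℕ.+ i))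
             (lnSeq≤P n (ℕ.+-monoʳ-≤ 3 (ℕ.≤-pred i≤m))))
             (ℚ.≤-reflexive (ℚ.*-comm (natℚ P) (1/suc (2 ℕ.+ i))))) ⟩
    ∑ (suc m) (λ i → 1/suc (2 ℕ.+ i) ℚ.* natℚ P)
      ≡⟨ ∑-*ʳ (suc m) (λ i → 1/suc (2 ℕ.+ i)) (natℚ P) ⟩
    ∑ (suc m) (λ i → 1/suc (2 ℕ.+ i)) ℚ.* natℚ P
      ≤⟨ *-monoʳ (natℚ P) (natℚ-nonNeg P) (ℚ.≤-trans (∑-harmonic (suc m)) (lnSeq≤P 0 ℕ.≤-refl)) ⟩
    natℚ P ℚ.* natℚ P
      ≡⟨ sym (natℚ-homo-* P P) ⟩
    natℚ (P ℕ.* P) ∎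
    where open ℚ.≤-Reasoning

  ∑-youngPhase : ∀ t → ∑ t youngPhase ℚ.≤ natℚ (P ℕ.* P)
  ∑-youngPhase t = begin
    ∑ t youngPhase
      ≤⟨ ∑-mono-length youngPhase youngPhase-nonNeg (ℕ.m≤m+n t (suc m)) ⟩
    ∑ (t ℕ.+ suc m) youngPhase
      ≡⟨ ∑-split (suc m) t youngPhase ⟩
    ∑ (suc m) youngPhase ℚ.+ ∑ t (λ l → youngPhase (l ℕ.+ suc m))
      ≤⟨ ℚ.+-mono-≤ (ℚ.≤-trans (∑-mono (suc m) youngPhase (phaseProb n) (λ i _ → youngPhase≤ i)) ∑-phaseProb)
           (∑-upper t _ 0ℚ (λ l → ℚ.≤-reflexive (cong (λ c → if c then phaseProb n (l ℕ.+ suc m) else 0ℚ)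
             (dec-false (l ℕ.+ suc m ℕ.<? suc m) (ℕ.m+n≮n l (suc m)))))) ⟩
    natℚ (P ℕ.* P) ℚ.+ natℚ t ℚ.* 0ℚ
      ≡⟨ trans (cong (natℚ (P ℕ.* P) ℚ.+_) (ℚ.*-zeroʳ (natℚ t))) (ℚ.+-identityʳ (natℚ (P ℕ.* P))) ⟩
    natℚ (P ℕ.* P) ∎
    where open ℚ.≤-Reasoning

  young-total : ∀ t → ∑ t (young ∘ just) ℚ.≤ natℚ (b ℕ.* (P ℕ.* P))
  young-total zero    = natℚ-nonNeg (b ℕ.* (P ℕ.* P))
  young-total (suc t) = begin
    ∑ (suc t) (young ∘ just)
      ≡⟨ trans (∑-suc t (young ∘ just)) (ℚ.+-identityˡ (∑ t (λ r → youngPhase (r / b)))) ⟩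
    ∑ t (λ r → youngPhase (r / b))
      ≤⟨ ∑-phases b youngPhase youngPhase-nonNeg t ⟩
    natℚ b ℚ.* ∑ t youngPhase
      ≤⟨ *-monoˡ (natℚ b) (natℚ-nonNeg b) (∑-youngPhase t) ⟩
    natℚ b ℚ.* natℚ (P ℕ.* P)
      ≡⟨ sym (natℚ-homo-* b (P ℕ.* P)) ⟩
    natℚ (b ℕ.* (P ℕ.* P)) ∎
    where open ℚ.≤-Reasoning

  k*remainder≤¼ : ∀ k → 4 ℕ.* (k ℕ.* P) ℕ.≤ suc m → natℚ k ℚ.* remainder ℚ.≤ ¼
  k*remainder≤¼ k 4kP≤ = ℚ.≤-trans
    (ℚ.≤-reflexive (trans (sym (ℚ.*-assoc (natℚ k) (natℚ P) (1/suc m)))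
      (cong (ℚ._* 1/suc m) (sym (natℚ-homo-* k P)))))
    (*1/suc≤ {natℚ (k ℕ.* P)} {¼} m (≤*1/suc {natℚ (k ℕ.* P)} {natℚ (suc m)} 3 (subst (ℚ._≤ natℚ (suc m)) (natℚ-homo-* 4 (k ℕ.* P)) (natℚ-mono 4kP≤))))

  onTime-young : ∀ {k} (adv : Adversary k) → 4 ℕ.* (k ℕ.* P) ℕ.≤ suc m →
    ∀ W G → G ℕ.+ 4 ℕ.* (k ℕ.* (b ℕ.* (P ℕ.* P))) ≡ W → ∀ s → IsProb s →
    (∀ r → W ℕ.< r → r ℕ.≤ W ℕ.+ W → s ℚ.+ s ℚ.≤ prob n b (just r)) → ∀ N →
    1ℚ ℚ.≤ onTimeProb n b adv (W ℕ.+ W) N ℚ.+ natℚ k ℚ.* (1ℚ ℚ.- s) ^ℚ G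
  onTime-young {k} adv 4kP≤ W G W-eq s s-isProb prob≥2s = Deadline.onTime-lower n b adv (prob-isProb n b)
    young young-nonNeg refl (b ℕ.* (P ℕ.* P)) young-total remainder prob≤young+remainder
    (k*remainder≤¼ k 4kP≤) W G W-eq s s-isProb prob≥2s

-- Geometric decay and the choice of parameters

-- At m = 1 / s it yields (1 - s) ^ (1 / s) ≤ 1/2, so the failure bound is obtained without `exp`.
bernoulli-inequality : ∀ {s} → IsProb s → ∀ m → (1ℚ ℚ.- s) ^ℚ m ℚ.* (1ℚ ℚ.+ natℚ m ℚ.* s) ℚ.≤ 1ℚ
bernoulli-inequality {s} ps zero    = ℚ.≤-reflexive (solve 1 (λ s → con 1ℚ :* (con 1ℚ :+ con 0ℚ :* s) := con 1ℚ) refl s)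
bernoulli-inequality {s} ps (suc m) = begin
  β ℚ.* β ^ℚ m ℚ.* (1ℚ ℚ.+ natℚ (suc m) ℚ.* s)
    ≡⟨ cong (λ z → β ℚ.* β ^ℚ m ℚ.* (1ℚ ℚ.+ z ℚ.* s)) (natℚ-suc m) ⟩
  β ℚ.* β ^ℚ m ℚ.* (1ℚ ℚ.+ (1ℚ ℚ.+ natℚ m) ℚ.* s)
    ≤⟨ ≤-slack (β ^ℚ m ℚ.* ((1ℚ ℚ.+ natℚ m) ℚ.* (s ℚ.* s)))
         (*-nonNeg (^-nonNeg (0≤1- (proj₂ ps)) m) (*-nonNeg (ℚ.≤-trans (natℚ-nonNeg m) (p≤1+p (natℚ m)))
           (*-nonNeg (proj₁ ps) (proj₁ ps))))
         (solve 3 (λ p m s → (con 1ℚ :- s) :* p :* (con 1ℚ :+ (con 1ℚ :+ m) :* s) :+ p :* ((con 1ℚ :+ m) :* (s :* s))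
           := p :* (con 1ℚ :+ m :* s)) refl (β ^ℚ m) (natℚ m) s) ⟩
  β ^ℚ m ℚ.* (1ℚ ℚ.+ natℚ m ℚ.* s)
    ≤⟨ bernoulli-inequality ps m ⟩
  1ℚ ∎
  where
  open ℚ.≤-Reasoning
  β = 1ℚ ℚ.- s

^-halves : ∀ {β} D → 0ℚ ℚ.≤ β → β ^ℚ D ℚ.* natℚ 2 ℚ.≤ 1ℚ → ∀ M → β ^ℚ (M ℕ.* D) ℚ.* natℚ (2 ℕ.^ M) ℚ.≤ 1ℚ
^-halves D 0≤β half zero    = ℚ.≤-refl
^-halves {β} D 0≤β half (suc M) = begin
  β ^ℚ (D ℕ.+ M ℕ.* D) ℚ.* natℚ (2 ℕ.* 2 ℕ.^ M)
    ≡⟨ cong₂ ℚ._*_ (^-homo-* β D (M ℕ.* D)) (natℚ-homo-* 2 (2 ℕ.^ M)) ⟩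
  (β ^ℚ D ℚ.* β ^ℚ (M ℕ.* D)) ℚ.* (natℚ 2 ℚ.* natℚ (2 ℕ.^ M))
    ≡⟨ solve 4 (λ x y c z → (x :* y) :* (c :* z) := (x :* c) :* (y :* z)) refl
         (β ^ℚ D) (β ^ℚ (M ℕ.* D)) (natℚ 2) (natℚ (2 ℕ.^ M)) ⟩
  (β ^ℚ D ℚ.* natℚ 2) ℚ.* (β ^ℚ (M ℕ.* D) ℚ.* natℚ (2 ℕ.^ M))
    ≤⟨ *-mono (*-nonNeg (^-nonNeg 0≤β D) (natℚ-nonNeg 2)) 1ℚ-nonNeg half (^-halves D 0≤β half M) ⟩
  1ℚ ∎
  where open ℚ.≤-Reasoning

^-antimono : ∀ {β} → IsProb β → ∀ {m n} → m ℕ.≤ n → β ^ℚ n ℚ.≤ β ^ℚ m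
^-antimono {β} (0≤β , β≤1) {m} {n} m≤n = begin
  β ^ℚ n                            ≡⟨ cong (β ^ℚ_) (sym (ℕ.m∸n+n≡m m≤n)) ⟩
  β ^ℚ (n ℕ.∸ m ℕ.+ m)              ≡⟨ ^-homo-* β (n ℕ.∸ m) m ⟩
  β ^ℚ (n ℕ.∸ m) ℚ.* β ^ℚ m         ≤⟨ *-monoʳ (β ^ℚ m) (^-nonNeg 0≤β m) (^≤1 (n ℕ.∸ m)) ⟩
  1ℚ ℚ.* β ^ℚ m                     ≡⟨ ℚ.*-identityˡ (β ^ℚ m) ⟩
  β ^ℚ m                            ∎
  where
  open ℚ.≤-Reasoning
  ^≤1 : ∀ e → β ^ℚ e ℚ.≤ 1ℚ
  ^≤1 zero    = ℚ.≤-refl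
  ^≤1 (suc e) = *-mono 0≤β 1ℚ-nonNeg β≤1 (^≤1 e)

positive⇒suc : ∀ n → 1 ℕ.≤ n → ∃ λ m → n ≡ suc m
positive⇒suc (suc m) _ = m , refl

n≤2^n : ∀ n → n ℕ.≤ 2 ℕ.^ n
n≤2^n zero    = ℕ.z≤n
n≤2^n (suc n) = ℕ.+-mono-≤ (ℕ.m^n>0 2 n) (ℕ.≤-trans (n≤2^n n) (ℕ.m≤m+n (2 ℕ.^ n) 0))

-- With P = 8 L the phases up to 4 k P stay below 2 ^ P, so the logarithms in
-- them are at most P; in later phases a station transmits with probability at
-- most 1 / (4 k).
module Parameters (H b k l : ℕ) .{{_ : NonZero b}} (b-large : 24 ℕ.* (1 ℕ.+ 2 ℕ.* H) ℕ.≤ b)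
  (1≤l : 1 ℕ.≤ l) (2^l≤k : 2 ℕ.^ l ℕ.≤ k) (k<2^[1+l] : k ℕ.< 2 ℕ.^ suc l)
  where

  L P w Y G W T M : ℕ
  L = suc l
  P = 8 ℕ.* L
  -- Counted in phases: the window W + 1, ..., 2 W consists of the phases with index w, ..., 2 w -
  -- 1. The 8 is twice the 4 of the bound on crowded rounds, which thus fill at most half of the
  -- window.
  w = 8 ℕ.* (k ℕ.* (P ℕ.* P))
  Y = b ℕ.* (P ℕ.* P)
  G = 4 ℕ.* (k ℕ.* Y)
  W = w ℕ.* b
  T = W ℕ.+ W
  -- The number of halvings needed: `L` absorb the factor k of the union bound, the other 2 H L give
  -- 4 ^ (H L).
  M = L ℕ.+ 2 ℕ.* (H ℕ.* L)

  open ℕ-Solver using () renaming (solve to ℕsolve; con to #_; _:+_ to _⊕_; _:*_ to _⊗_; _:=_ to _≈_)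

  G+4kY≡W : G ℕ.+ 4 ℕ.* (k ℕ.* Y) ≡ W
  G+4kY≡W = ℕsolve 3 (λ b k p → # 4 ⊗ (k ⊗ (b ⊗ p)) ⊕ # 4 ⊗ (k ⊗ (b ⊗ p)) ≈ # 8 ⊗ (k ⊗ p) ⊗ b) refl b k (P ℕ.* P)

  1≤k : 1 ℕ.≤ k
  1≤k = ℕ.≤-trans (ℕ.m^n>0 2 l) 2^l≤k

  1≤P : 1 ℕ.≤ P
  1≤P = ℕ.s≤s ℕ.z≤n

  1≤kP : 1 ℕ.≤ k ℕ.* P
  1≤kP = ℕ.*-mono-≤ 1≤k 1≤P

  young-phases : ∃ λ m → 4 ℕ.* (k ℕ.* P) ≡ suc m
  young-phases = positive⇒suc (4 ℕ.* (k ℕ.* P)) (ℕ.*-mono-≤ {1} {4} (ℕ.s≤s ℕ.z≤n) 1≤kP)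

  -- The number is 12 w / L, the reciprocal of half the bias L / (6 w) guaranteed in the window.
  1/s : ∃ λ d → 12 ℕ.* (8 ℕ.* (k ℕ.* (8 ℕ.* P))) ≡ suc d
  1/s = positive⇒suc (12 ℕ.* (8 ℕ.* (k ℕ.* (8 ℕ.* P)))) (ℕ.*-mono-≤ {1} {12} (ℕ.s≤s ℕ.z≤n)
    (ℕ.*-mono-≤ {1} {8} (ℕ.s≤s ℕ.z≤n) (ℕ.*-mono-≤ 1≤k (ℕ.*-mono-≤ {1} {8} (ℕ.s≤s ℕ.z≤n) 1≤P))))

  4kP≤ : 4 ℕ.* (k ℕ.* P) ℕ.≤ 2 ℕ.^ (7 ℕ.+ 8 ℕ.* l)
  4kP≤ = begin
    4 ℕ.* (k ℕ.* (8 ℕ.* L))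
      ≤⟨ ℕ.*-monoʳ-≤ 4 (ℕ.*-mono-≤ (ℕ.<⇒≤ k<2^[1+l]) (ℕ.*-monoʳ-≤ 8 (n≤2^n L))) ⟩
    4 ℕ.* (2 ℕ.^ L ℕ.* (8 ℕ.* 2 ℕ.^ L))
      ≡⟨ ℕsolve 1 (λ x → # 4 ⊗ (x ⊗ (# 8 ⊗ x)) ≈ # 32 ⊗ (x ⊗ x)) refl (2 ℕ.^ L) ⟩
    32 ℕ.* (2 ℕ.^ L ℕ.* 2 ℕ.^ L)
      ≡⟨ cong (32 ℕ.*_) (sym (ℕ.^-distribˡ-+-* 2 L L)) ⟩
    2 ℕ.^ 5 ℕ.* 2 ℕ.^ (L ℕ.+ L)
      ≡⟨ sym (ℕ.^-distribˡ-+-* 2 5 (L ℕ.+ L)) ⟩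
    2 ℕ.^ (5 ℕ.+ (L ℕ.+ L))
      ≤⟨ ℕ.^-monoʳ-≤ 2 exponent ⟩
    2 ℕ.^ (7 ℕ.+ 8 ℕ.* l) ∎
    where
    open ℕ.≤-Reasoning
    exponent : 5 ℕ.+ (L ℕ.+ L) ℕ.≤ 7 ℕ.+ 8 ℕ.* l
    exponent = subst (ℕ._≤ 7 ℕ.+ 8 ℕ.* l)
      (ℕsolve 1 (λ l → # 7 ⊕ # 2 ⊗ l ≈ # 5 ⊕ ((# 1 ⊕ l) ⊕ (# 1 ⊕ l))) refl l)
      (ℕ.+-monoʳ-≤ 7 (ℕ.*-monoˡ-≤ l {2} {8} (ℕ.s≤s (ℕ.s≤s ℕ.z≤n))))

  3+m≤2^P : ∀ {m} → 4 ℕ.* (k ℕ.* P) ≡ suc m → 3 ℕ.+ m ℕ.≤ 2 ℕ.^ P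
  3+m≤2^P {m} eq = begin
    2 ℕ.+ suc m                ≡⟨ cong (2 ℕ.+_) (sym eq) ⟩
    2 ℕ.+ 4 ℕ.* (k ℕ.* P)      ≤⟨ ℕ.+-mono-≤ (ℕ.^-monoʳ-≤ 2 {1} {e} (ℕ.s≤s ℕ.z≤n)) 4kP≤ ⟩
    2 ℕ.^ e ℕ.+ 2 ℕ.^ e        ≡⟨ cong (2 ℕ.^ e ℕ.+_) (sym (ℕ.+-identityʳ (2 ℕ.^ e))) ⟩
    2 ℕ.^ suc e                ≡⟨ cong (2 ℕ.^_) (sym (ℕ.*-suc 8 l)) ⟩
    2 ℕ.^ P                    ∎
    where
    open ℕ.≤-Reasoning
    e = 7 ℕ.+ 8 ℕ.* l

  2^L≤w : 2 ℕ.^ L ℕ.≤ w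
  2^L≤w = ℕ.*-mono-≤ {2} {8} (ℕ.s≤s (ℕ.s≤s ℕ.z≤n)) (ℕ.≤-trans 2^l≤k
    (subst (ℕ._≤ k ℕ.* (P ℕ.* P)) (ℕ.*-identityʳ k) (ℕ.*-monoʳ-≤ k (ℕ.*-mono-≤ 1≤P 1≤P))))

  2≤w : 2 ℕ.≤ w
  2≤w = ℕ.≤-trans (ℕ.^-monoʳ-≤ 2 {1} {L} (ℕ.s≤s ℕ.z≤n)) 2^L≤w

  module _ {d : ℕ} (d-eq : 12 ℕ.* (8 ℕ.* (k ℕ.* (8 ℕ.* P))) ≡ suc d) where

    -- The logarithm is at least that of 2 ^ L, hence at least L / 2, and the denominator 3 + i is
    -- at most 3 w. Together they give L / (6 w) = 2 s.
    phaseProb-window : ∀ n i → w ℕ.≤ i → i ℕ.< w ℕ.+ w → 1/suc d ℚ.+ 1/suc d ℚ.≤ phaseProb n i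
    phaseProb-window n i w≤i i<2w = ≤*1/suc (2 ℕ.+ i) (begin
      natℚ (3 ℕ.+ i) ℚ.* (1/suc d ℚ.+ 1/suc d)
        ≤⟨ *-monoʳ _ (ℚ.+-mono-≤ (1/suc-nonNeg d) (1/suc-nonNeg d)) (natℚ-mono 3+i≤3w) ⟩
      natℚ (3 ℕ.* w) ℚ.* (1/suc d ℚ.+ 1/suc d)
        ≡⟨ solve 2 (λ a r → a :* (r :+ r) := (a :+ a) :* r) refl (natℚ (3 ℕ.* w)) (1/suc d) ⟩
      (natℚ (3 ℕ.* w) ℚ.+ natℚ (3 ℕ.* w)) ℚ.* 1/suc d
        ≤⟨ *1/suc≤ d (ℚ.≤-reflexive 6w≡) ⟩
      natℚ L ℚ.* ½
        ≤⟨ lnSeq-2^-lower L n ⟩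
      lnSeq (2 ℕ.^ L) n
        ≤⟨ lnSeq-mono n (ℕ.≤-trans 2^L≤w (ℕ.≤-trans w≤i (ℕ.m≤n+m i 3))) ⟩
      lnSeq (3 ℕ.+ i) n ∎)
      where
      open ℚ.≤-Reasoning
      3+i≤3w : 3 ℕ.+ i ℕ.≤ 3 ℕ.* w
      3+i≤3w = subst (3 ℕ.+ i ℕ.≤_) (ℕsolve 1 (λ w → w ⊕ (w ⊕ w) ≈ # 3 ⊗ w) refl w) (ℕ.+-mono-≤ 2≤w i<2w)
      12w≡ : 12 ℕ.* w ≡ suc d ℕ.* L
      12w≡ = trans (ℕsolve 2 (λ k L → # 12 ⊗ (# 8 ⊗ (k ⊗ ((# 8 ⊗ L) ⊗ (# 8 ⊗ L))))
        ≈ # 12 ⊗ (# 8 ⊗ (k ⊗ (# 8 ⊗ (# 8 ⊗ L)))) ⊗ L) refl k L) (cong (ℕ._* L) d-eq)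
      6w≡ : natℚ (3 ℕ.* w) ℚ.+ natℚ (3 ℕ.* w) ≡ natℚ (suc d) ℚ.* (natℚ L ℚ.* ½)
      6w≡ = trans (cong₂ ℚ._+_ (natℚ-homo-* 3 w) (natℚ-homo-* 3 w))
        (trans (solve 1 (λ w → con (natℚ 3) :* w :+ con (natℚ 3) :* w := con (natℚ 12) :* w :* con ½) refl (natℚ w))
          (trans (cong (ℚ._* ½) (trans (sym (natℚ-homo-* 12 w)) (trans (cong natℚ 12w≡) (natℚ-homo-* (suc d) L))))
            (ℚ.*-assoc (natℚ (suc d)) (natℚ L) ½)))

    prob-window : ∀ n r → W ℕ.< r → r ℕ.≤ W ℕ.+ W → 1/suc d ℚ.+ 1/suc d ℚ.≤ prob n b (just r)
    -- Local round r + 1 lies in phase r / b, and here r runs from W to 2 W - 1.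
    prob-window n (suc r) W<r r≤2W = phaseProb-window n (r / b)
      (subst (ℕ._≤ r / b) (m*n/n≡m w b) (/-monoˡ-≤ b (ℕ.≤-pred W<r)))
      (m<n*o⇒m/o<n {r} {w ℕ.+ w} (subst (suc r ℕ.≤_) (sym (ℕ.*-distribʳ-+ b w w)) r≤2W))

    s-isProb : IsProb (1/suc d)
    s-isProb = 1/suc-nonNeg d , 1/suc-antimono {0} {d} ℕ.z≤n

    β : ℚ
    β = 1ℚ ℚ.- 1/suc d

    β-isProb : IsProb β
    β-isProb = 0≤1- (proj₂ s-isProb) ,
      ≤-slack (1/suc d) (1/suc-nonNeg d) (solve 1 (λ s → con 1ℚ :- s :+ s := con 1ℚ) refl (1/suc d))

    β-half : β ^ℚ suc d ℚ.* natℚ 2 ℚ.≤ 1ℚ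
    β-half = subst (λ z → β ^ℚ suc d ℚ.* (1ℚ ℚ.+ z) ℚ.≤ 1ℚ) (natℚ-inverse d)
      (bernoulli-inequality s-isProb (suc d))

    -- Each halving takes 1 / s fruitful rounds. Equality holds at b = 24 (1 + 2 H), the source of
    -- that threshold.
    M/s≤G : M ℕ.* suc d ℕ.≤ G
    M/s≤G = begin
      M ℕ.* suc d
        ≡⟨ cong (M ℕ.*_) (sym d-eq) ⟩
      M ℕ.* (12 ℕ.* (8 ℕ.* (k ℕ.* (8 ℕ.* P))))
        ≡⟨ ℕsolve 3 (λ H L k → (L ⊕ # 2 ⊗ (H ⊗ L)) ⊗ (# 12 ⊗ (# 8 ⊗ (k ⊗ (# 8 ⊗ (# 8 ⊗ L)))))
             ≈ # 4 ⊗ (k ⊗ ((# 24 ⊗ (# 1 ⊕ # 2 ⊗ H)) ⊗ ((# 8 ⊗ L) ⊗ (# 8 ⊗ L))))) refl H L k ⟩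
      4 ℕ.* (k ℕ.* ((24 ℕ.* (1 ℕ.+ 2 ℕ.* H)) ℕ.* (P ℕ.* P)))
        ≤⟨ ℕ.*-monoʳ-≤ 4 (ℕ.*-monoʳ-≤ k (ℕ.*-monoˡ-≤ (P ℕ.* P) b-large)) ⟩
      G ∎
      where open ℕ.≤-Reasoning

    k4^HL≤2^M : k ℕ.* 4 ℕ.^ (H ℕ.* L) ℕ.≤ 2 ℕ.^ M
    k4^HL≤2^M = begin
      k ℕ.* 4 ℕ.^ (H ℕ.* L)                    ≡⟨ cong (k ℕ.*_) (ℕ.^-*-assoc 2 2 (H ℕ.* L)) ⟩
      k ℕ.* 2 ℕ.^ (2 ℕ.* (H ℕ.* L))            ≤⟨ ℕ.*-monoˡ-≤ _ (ℕ.<⇒≤ k<2^[1+l]) ⟩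
      2 ℕ.^ L ℕ.* 2 ℕ.^ (2 ℕ.* (H ℕ.* L))      ≡⟨ sym (ℕ.^-distribˡ-+-* 2 L (2 ℕ.* (H ℕ.* L))) ⟩
      2 ℕ.^ M                                  ∎
      where open ℕ.≤-Reasoning

    failure-bound : natℚ (4 ℕ.^ (H ℕ.* L)) ℚ.* (natℚ k ℚ.* β ^ℚ G) ℚ.≤ 1ℚ
    failure-bound = begin
      natℚ (4 ℕ.^ (H ℕ.* L)) ℚ.* (natℚ k ℚ.* β ^ℚ G)
        ≡⟨ trans (solve 3 (λ u k x → u :* (k :* x) := x :* (k :* u)) refl (natℚ (4 ℕ.^ (H ℕ.* L))) (natℚ k) (β ^ℚ G))
             (cong (β ^ℚ G ℚ.*_) (sym (natℚ-homo-* k (4 ℕ.^ (H ℕ.* L))))) ⟩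
      β ^ℚ G ℚ.* natℚ (k ℕ.* 4 ℕ.^ (H ℕ.* L))
        ≤⟨ *-mono (^-nonNeg (proj₁ β-isProb) G) (natℚ-nonNeg (2 ℕ.^ M))
             (^-antimono β-isProb M/s≤G) (natℚ-mono k4^HL≤2^M) ⟩
      β ^ℚ (M ℕ.* suc d) ℚ.* natℚ (2 ℕ.^ M)
        ≤⟨ ^-halves (suc d) (proj₁ β-isProb) β-half M ⟩
      1ℚ ∎
      where open ℚ.≤-Reasoning

    onTime : ∀ n (adv : Adversary k) N →
      1ℚ ℚ.≤ onTimeProb n b adv T N ℚ.+ natℚ k ℚ.* β ^ℚ G
    onTime n adv N with m , eq ← young-phases =
      Young.onTime-young n b P m 1≤P (3+m≤2^P eq) adv (ℕ.≤-reflexive eq) W G G+4kY≡W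
        (1/suc d) s-isProb (prob-window n) N

  lnSeq≤L : ∀ n → lnSeq k n ℚ.≤ natℚ L
  lnSeq≤L n = ℚ.≤-trans (lnSeq-mono n (ℕ.<⇒≤ k<2^[1+l])) (lnSeq-2^-upper L n)

  P≤32ln : ∀ n → natℚ P ℚ.≤ natℚ 32 ℚ.* lnSeq k n
  P≤32ln n = begin
    natℚ P                         ≤⟨ natℚ-mono 8L≤16l ⟩
    natℚ (16 ℕ.* l)                ≡⟨ trans (natℚ-homo-* 16 l)
                                       (solve 1 (λ l → con (natℚ 16) :* l := con (natℚ 32) :* (l :* con ½)) refl (natℚ l)) ⟩
    natℚ 32 ℚ.* (natℚ l ℚ.* ½)     ≤⟨ *-monoˡ (natℚ 32) (natℚ-nonNeg 32) (ℚ.≤-trans (lnSeq-2^-lower l n) (lnSeq-mono n 2^l≤k)) ⟩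
    natℚ 32 ℚ.* lnSeq k n          ∎
    where
    open ℚ.≤-Reasoning
    -- Here k ≥ 2 enters: l ≥ 1 gives L ≤ 2 l, so `P` is of the order of ln k from above too.
    8L≤16l : P ℕ.≤ 16 ℕ.* l
    8L≤16l = subst (P ℕ.≤_) (ℕsolve 1 (λ l → # 8 ⊗ (l ⊕ l) ≈ # 16 ⊗ l) refl l)
      (ℕ.*-monoʳ-≤ 8 (ℕ.+-monoˡ-≤ l 1≤l))

  T-bound : ∀ n → natℚ T ℚ.≤
    natℚ (16 ℕ.* b) ℚ.* (natℚ 32 ℚ.* natℚ 32) ℚ.* natℚ k ℚ.* (lnSeq k n ℚ.* lnSeq k n)
  T-bound n = begin
    natℚ T
      ≡⟨ cong natℚ (ℕsolve 3 (λ b k p → # 8 ⊗ (k ⊗ p) ⊗ b ⊕ # 8 ⊗ (k ⊗ p) ⊗ b ≈ # 16 ⊗ b ⊗ k ⊗ p) refl b k (P ℕ.* P)) ⟩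
    natℚ (16 ℕ.* b ℕ.* k ℕ.* (P ℕ.* P))
      ≡⟨ trans (natℚ-homo-* (16 ℕ.* b ℕ.* k) (P ℕ.* P)) (cong₂ ℚ._*_ (natℚ-homo-* (16 ℕ.* b) k) (natℚ-homo-* P P)) ⟩
    (natℚ (16 ℕ.* b) ℚ.* natℚ k) ℚ.* (natℚ P ℚ.* natℚ P)
      ≤⟨ *-monoˡ _ (*-nonNeg (natℚ-nonNeg (16 ℕ.* b)) (natℚ-nonNeg k))
           (*-mono (natℚ-nonNeg P) (*-nonNeg (natℚ-nonNeg 32) (lnSeq-nonNeg k n)) (P≤32ln n) (P≤32ln n)) ⟩
    (natℚ (16 ℕ.* b) ℚ.* natℚ k) ℚ.* ((natℚ 32 ℚ.* lnSeq k n) ℚ.* (natℚ 32 ℚ.* lnSeq k n))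
      ≡⟨ solve 4 (λ a k c x → (a :* k) :* ((c :* x) :* (c :* x)) := a :* (c :* c) :* k :* (x :* x)) refl
           (natℚ (16 ℕ.* b)) (natℚ k) (natℚ 32) (lnSeq k n) ⟩
    natℚ (16 ℕ.* b) ℚ.* (natℚ 32 ℚ.* natℚ 32) ℚ.* natℚ k ℚ.* (lnSeq k n ℚ.* lnSeq k n) ∎
    where open ℚ.≤-Reasoning

  success-bound : ∀ η → (∃ λ N → ∀ n → N ℕ.≤ n → 0ℚ ℚ.≤ seq η n × seq η n ℚ.≤ natℚ H) →
    ∀ (adv : Adversary k) N → fromℕ 1 - k ^ (- η) ≤ Pr (run b adv N) (allOnTime? adv T)
  success-bound η (N₁ , η-bound) adv N ε 0<ε =
    N₁ ℕ.+ N₂ , λ n N≤n → subst₂ (λ y p → 1ℚ ℚ.- expSum y n ℚ.≤ p ℚ.+ ε)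
      (ℚ.neg-distribˡ-* (seq η n) (lnSeq k n)) (sym (seq-Pr n b adv T N)) (bound n N≤n)
    where
    U = 4 ℕ.^ (H ℕ.* L)
    d-eq = proj₂ 1/s
    exp-bound = expSum-neg-lower (H ℕ.* L) ε 0<ε
    N₂ = proj₁ exp-bound
    F = natℚ k ℚ.* β d-eq ^ℚ G

    0<U : 0ℚ ℚ.< natℚ U
    0<U = ℚ.<-≤-trans (ℚ.positive⁻¹ 1ℚ) (natℚ-mono {1} (ℕ.m^n>0 4 (H ℕ.* L)))

    bound : ∀ n → N₁ ℕ.+ N₂ ℕ.≤ n →
      1ℚ ℚ.- expSum (ℚ.- (seq η n ℚ.* lnSeq k n)) n ℚ.≤ onTimeProb n b adv T N ℚ.+ ε
    bound n N≤n = subst (1ℚ ℚ.- e ℚ.≤_) (solve 3 (λ p e ε → p :+ (e :+ ε) :- e := p :+ ε) refl p e ε)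
      (ℚ.+-monoˡ-≤ (ℚ.- e) (ℚ.≤-trans (onTime d-eq n adv N) (ℚ.+-monoʳ-≤ p F≤e+ε)))
      where
      x = seq η n ℚ.* lnSeq k n
      e = expSum (ℚ.- x) n
      p = onTimeProb n b adv T N
      0≤η = proj₁ (η-bound n (ℕ.m+n≤o⇒m≤o N₁ N≤n))
      η≤H = proj₂ (η-bound n (ℕ.m+n≤o⇒m≤o N₁ N≤n))
      -- Both sides are compared after multiplication by `U`: the failure bound gives at most 1, the
      -- exponential at least 1.
      F≤e+ε : F ℚ.≤ e ℚ.+ ε
      F≤e+ε = ℚ.*-cancelˡ-≤-pos (natℚ U) {{ℚ.positive 0<U}} (ℚ.≤-trans (failure-bound d-eq)
        (proj₂ exp-bound n (ℕ.m+n≤o⇒n≤o N₁ N≤n) x (*-nonNeg 0≤η (lnSeq-nonNeg k n))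
          (ℚ.≤-trans (*-mono 0≤η (natℚ-nonNeg L) η≤H (lnSeq≤L n))
            (ℚ.≤-reflexive (sym (natℚ-homo-* H L))))))

  deadline : ∀ η → (∃ λ N → ∀ n → N ℕ.≤ n → 0ℚ ℚ.≤ seq η n × seq η n ℚ.≤ natℚ H) →
    ∃ λ T → fromℕ T ≤ fromℕ (16 ℕ.* b) * (fromℕ 32 * fromℕ 32) * fromℕ k * (ln k * ln k) ×
    (∀ (adv : Adversary k) N → fromℕ 1 - k ^ (- η) ≤ Pr (run b adv N) (allOnTime? adv T))
  deadline η η-bound = T , (λ ε 0<ε → 0 , λ n _ → ℚ.≤-trans (T-bound n) (p≤p+q _ (ℚ.<⇒≤ 0<ε))) ,
    success-bound η η-bound

eventually-bounded : ∀ η → fromℕ 0 < η →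
  ∃ λ H → ∃ λ N → ∀ n → N ℕ.≤ n → 0ℚ ℚ.≤ seq η n × seq η n ℚ.≤ natℚ H
eventually-bounded η (ε , 0<ε , N₁ , ε≤η) = bound (eventuallyBounded {seq η} (cauchy η))
  where
  bound : (∃ λ H → ∃ λ N → ∀ n → N ℕ.≤ n → ∣ seq η n ∣ ℚ.≤ natℚ H) →
    ∃ λ H → ∃ λ N → ∀ n → N ℕ.≤ n → 0ℚ ℚ.≤ seq η n × seq η n ℚ.≤ natℚ H
  bound (H , N₂ , ∣η∣≤H) = H , N₁ ℕ.+ N₂ , λ n N≤n →
    ℚ.≤-trans (ℚ.<⇒≤ 0<ε) (subst (ℚ._≤ seq η n) (ℚ.+-identityˡ ε) (ε≤η n (ℕ.m+n≤o⇒m≤o N₁ N≤n))) ,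
    ℚ.≤-trans (≤∣∣ (seq η n)) (∣η∣≤H n (ℕ.m+n≤o⇒n≤o N₁ N≤n))

log-positive : ∀ {k l} → 2 ℕ.≤ k → k ℕ.< 2 ℕ.^ suc l → 1 ℕ.≤ l
log-positive {l = zero}  2≤k k<2 = contradiction 2≤k (ℕ.<⇒≱ k<2)
log-positive {l = suc l} _   _   = ℕ.s≤s ℕ.z≤n

theorem5p1 : ∀ (η : ℝ) → fromℕ 0 < η →
    ∃ λ (b₀ : ℕ) → ∀ (b : ℕ) .{{_ : NonZero b}} → b₀ ℕ.≤ b →
    ∃ λ (C : ℝ) → ∀ (k : ℕ) → 2 ℕ.≤ k →
    ∃ λ (T : ℕ) → fromℕ T ≤ C * fromℕ k * (ln k * ln k) ×
    (∀ (adv : Adversary k) (N : ℕ) →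
    fromℕ 1 - k ^ (- η) ≤ Pr (run b adv N) (allOnTime? adv T))
theorem5p1 η 0<η =
  let H , η-bound = eventually-bounded η 0<η in
  24 ℕ.* (1 ℕ.+ 2 ℕ.* H) , λ b b₀≤b →
  -- The deadline is 2 W = 16 b k P² with P ≤ 32 ln k.
  fromℕ (16 ℕ.* b) * (fromℕ 32 * fromℕ 32) , λ k 2≤k →
  let l , 2^l≤k , k<2^[1+l] = binaryLog k (ℕ.≤-trans (ℕ.s≤s ℕ.z≤n) 2≤k) in
  Parameters.deadline H b k l b₀≤b (log-positive {l = l} 2≤k k<2^[1+l]) 2^l≤k k<2^[1+l] η η-bound
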